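{- For any integer $b \geq 1$, $X_{T^{\langle 4,b \rangle}_{v_4}}$ is not $e$-positive. In particular, for every integer $k \ge 0$, \begin{align*} [e_{(3^{k+2})}]X_{T^{\langle 4, 3k+1 \rangle}_{v_4}} &= -3\cdot 2^{k+1}, \\ [e_{(3^{k+2},1)}]X_{T^{\langle 4, 3k+2 \rangle}_{v_4}} &= - 2^{k+2}, \\ [e_{(3^{k+2},2)}]X_{T^{\langle 4, 3k+3 \rangle}_{v_4}} &= -(3k+1)\cdot 2^{k+1}. \end{align*}
   Context: For a finite simple graph $G$ with vertex set $\{v_1,\dots,v_d\}$, the chromatic symmetric function is $X_G=\sum_{\kappa} x_{\kappa(v_1)}\cdots x_{\kappa(v_d)}$, summed over all proper colorings $\kappa:V(G)\to\{1,2,\dots\}$, with commuting indeterminates. $e_\lambda=e_{\lambda_1}e_{\lambda_2}\cdots$ are the elementary symmetric functions, and $[e_\lambda]f$ denotes the coefficient of $e_\lambda$ in the expansion of a symmetric function $f$ in the $e$-basis; $G$ (or $X_G$) is $e$-positive if all these coefficients are non-negative. The partition $(3^{m},r)$ has $m$ parts equal to $3$ followed by a part $r$. For $a\ge3$, $b\ge1$, the tadpole graph $T^{\langle a,b\rangle}$ has vertices $v_1,\dots,v_{a+b}$ and consists of the cycle $v_1v_2\cdots v_av_1$, the path $v_{a+1}\cdots v_{a+b}$, and the edge $v_av_{a+1}$; so $v_4$ is the unique degree-$3$ vertex of $T^{\langle 4,b\rangle}$. For a graph $G$ and vertex $v$, the twin graph $G_v$ is obtained by adding a new vertex $v'$ adjacent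 to $v$ and to exactly the neighbors of $v$ in $G$. -}

module Defs where

open import Data.Nat as ℕ using (ℕ; zero; suc; _+_; _∸_; _⊓_; _≡ᵇ_)
open import Data.Fin as Fin using (Fin; zero; suc; toℕ; fromℕ)
open import Data.Fin.Properties using (_≟_)
open import Data.Bool using (Bool; true; false; _∧_; _∨_; not; if_then_else_)
open import Data.Maybe using (Maybe; just; nothing)
import Data.Maybe as Maybe
open import Data.List using (List; []; _∷_; [_]; map; concatMap; upTo; foldr; allFin)
open import Data.List.Membership.Propositional using (_∈_)
open import Data.Vec using (Vec; []; _∷_; lookup)
open import Data.Integer as ℤ using (ℤ; +_)
open import Data.Product using (Σ; Σ-syntax; _×_)
open import Relation.Nullary.Decidable using (⌊_⌋)
open import Relation.Binary.PropositionalEquality using (_≡_)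

-- Finite simple graphs on vertex set Fin size, given by a Boolean
-- adjacency function.  (All graphs built below are loopless and
-- symmetric by construction.)

record Graph : Set where
  field
    size : ℕ
    adj  : Fin size → Fin size → Bool
open Graph public

_==ᶠ_ : ∀ {n} → Fin n → Fin n → Bool
u ==ᶠ w = ⌊ u ≟ w ⌋

-- Tadpole T⟨a,b⟩ (a ≥ 3, b ≥ 1).  Vertex v_i is the element i-1 of Fin (a+b).
-- Edges: v_i v_{i+1} for 1 ≤ i < a+b (cycle edges v_1..v_a, the edge
-- v_a v_{a+1} and the path edges), plus the closing edge v_1 v_a.
tadpole : ℕ → ℕ → Graph
tadpole a b = record { size = a + b ; adj = tadAdj }
  where
  tadAdj : Fin (a + b) → Fin (a + b) → Bool
  tadAdj u w =
    (suc (toℕ u) ≡ᵇ toℕ w) ∨ (suc (toℕ w) ≡ᵇ toℕ u)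
    ∨ ((toℕ u ≡ᵇ 0) ∧ (toℕ w ≡ᵇ a ∸ 1))
    ∨ ((toℕ w ≡ᵇ 0) ∧ (toℕ u ≡ᵇ a ∸ 1))

-- Fin (suc n) = old vertices (just i) plus the new last vertex (nothing).
old? : ∀ {n} → Fin (suc n) → Maybe (Fin n)
old? {zero}  zero    = nothing
old? {suc n} zero    = just zero
old? {suc n} (suc i) = Maybe.map suc (old? i)

twin : (G : Graph) → Fin (size G) → Graph
twin G v = record { size = suc (size G) ; adj = tw }
  where
  tw : Fin (suc (size G)) → Fin (suc (size G)) → Bool
  tw x y with old? x | old? y
  ... | just u  | just w  = adj G u w
  ... | just u  | nothing = adj G u v ∨ (u ==ᶠ v)
  ... | nothing | just w  = adj G v w ∨ (w ==ᶠ v)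
  ... | nothing | nothing = false

allᵇ : ∀ {A : Set} → (A → Bool) → List A → Bool
allᵇ p = foldr (λ x acc → p x ∧ acc) true

countᵇ : ∀ {A : Set} → (A → Bool) → List A → ℕ
countᵇ p = foldr (λ x acc → if p x then suc acc else acc) 0

allVecs : ∀ {A : Set} → List A → (n : ℕ) → List (Vec A n)
allVecs xs zero    = [ [] ]
allVecs xs (suc n) = concatMap (λ x → map (x ∷_) (allVecs xs n)) xs

-- Chromatic symmetric function, restricted to the N variables x_1..x_N:
-- coefficient of the monomial x^α (α : Fin N → ℕ) is the number of
-- proper colourings κ : V(G) → Fin N whose colour-class sizes are α.

proper : (G : Graph) {N : ℕ} → Vec (Fin N) (size G) → Bool
proper G κ = allᵇ (λ u → allᵇ (λ w → not (adj G u w) ∨ not (lookup κ u ==ᶠ lookup κ w))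
                              (allFin (size G)))
                 (allFin (size G))

hasContent : ∀ {n N} → Vec (Fin N) n → (Fin N → ℕ) → Bool
hasContent {n} {N} κ α =
  allᵇ (λ i → countᵇ (λ v → lookup κ v ==ᶠ i) (allFin n) ≡ᵇ α i) (allFin N)

XCoeff : (G : Graph) (N : ℕ) → (Fin N → ℕ) → ℕ
XCoeff G N α =
  countᵇ (λ κ → proper G κ ∧ hasContent κ α) (allVecs (allFin N) (size G))

-- Elementary symmetric functions in N variables.
-- e_r = Σ_{S ⊆ [N], |S| = r} x^S, and e_λ = e_{λ₁} e_{λ₂} ⋯ .
-- eCoeff λ N α = coefficient of x^α in e_λ(x_1,…,x_N), i.e. the number
-- of tuples (S₁,…,S_ℓ) of subsets with |S_i| = λ_i and Σ_i 1_{S_i} = α.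

subsetSize : ∀ {N} → Vec Bool N → ℕ
subsetSize []          = 0
subsetSize (true ∷ s)  = suc (subsetSize s)
subsetSize (false ∷ s) = subsetSize s

ind : Bool → ℕ
ind true  = 1
ind false = 0

eCoeff : List ℕ → (N : ℕ) → (Fin N → ℕ) → ℕ
eCoeff []      N α = if allᵇ (λ i → α i ≡ᵇ 0) (allFin N) then 1 else 0
eCoeff (r ∷ λ') N α =
  foldr _+_ 0
    (map (λ S → if (subsetSize S ≡ᵇ r) ∧ allᵇ (λ i → ind (lookup S i) ℕ.≤ᵇ α i) (allFin N)
                then eCoeff λ' N (λ i → α i ∸ ind (lookup S i))
                else 0)
         (allVecs (true ∷ false ∷ []) N))

partsF : ℕ → ℕ → ℕ → List (List ℕ)
partsF _        zero    m = [ [] ]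
partsF zero     (suc n) m = []
partsF (suc f)  (suc n) m =
  concatMap (λ k → map (k ∷_) (partsF f (suc n ∸ k) k)) (map suc (upTo (suc n ⊓ m)))

partitions : ℕ → List (List ℕ)
partitions d = partsF d d d

-- e-expansion.  c represents X_G in the e-basis iff
--   X_G = Σ_{λ ⊢ |V(G)|} c(λ) e_λ
-- as symmetric functions, i.e. the coefficients of every monomial agree
-- (every monomial involves only finitely many variables x_1..x_N).

sumℤ : List ℤ → ℤ
sumℤ = foldr ℤ._+_ (+ 0)

Represents : Graph → (List ℕ → ℤ) → Set
Represents G c =
  ∀ (N : ℕ) (α : Fin N → ℕ) →
    + XCoeff G N α ≡ sumℤ (map (λ λ' → c λ' ℤ.* + eCoeff λ' N α) (partitions (size G)))

EPositive : Graph → Set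
EPositive G = Σ[ c ∈ (List ℕ → ℤ) ] (Represents G c × (∀ λ' → λ' ∈ partitions (size G) → + 0 ℤ.≤ c λ'))

ECoeffIs : Graph → List ℕ → ℤ → Set
ECoeffIs G λ' z = Σ (List ℕ → ℤ) (Represents G) × (∀ c → Represents G c → c λ' ≡ z)

v₄ : ∀ {b} → Fin (4 + b)
v₄ = suc (suc (suc zero))

TwinTad : ℕ → Graph
TwinTad b = twin (tadpole 4 b) (v₄ {b})

{-# OPTIONS --safe #-}
-- Summing over the colours p ≠ q of v₄ and its twin, the colourings of v₁, v₂, v₃
-- and of the tail separate.  Each factor is a polynomial in x_p, x_q and power sums,
-- the tail through the recursion W_{n+1}(c) = x_c (Σ_d W_n(d) - W_n(c)).  Hence X is an
-- integer polynomial in power sums, and by Newton's identities in the e_r.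
--
-- To read off coefficients, specialise to three variables with e₃ = 1 and
-- (e₁, e₂) = (3ε, 0) or (0, 3ε), ε² = 0, realised in ℤ[ω][ε].  Of all e_λ only
-- λ = (3ᵏ), (3ᵏ,1), (3ᵏ,2) survive, so the value of X determines that coefficient
-- in any e-expansion.  With three colours X = 2 e₃ Σ_c x_c (e₁ - x_c) W(c), and W has
-- a closed form of period three in the length of the tail.
module Submission where

open import Defs
open import Algebra.Bundles using (CommutativeRing)
open import Algebra.Solver.Ring.AlmostCommutativeRing using (AlmostCommutativeRing; fromCommutativeRing; _-Raw-AlmostCommutative⟶_)
open import Data.Bool using (Bool; true; false; _∧_; _∨_; not; if_then_else_)
open import Data.Bool.Properties using (∧-assoc; ∧-identityʳ)
open import Data.Fin using (Fin; zero; suc; toℕ; fromℕ; inject₁)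
open import Data.Fin.Properties using (_≟_; toℕ-injective)
open import Data.Integer using (ℤ; +_; -[1+_]; _⊖_; 1ℤ; 0ℤ; -1ℤ)
import Data.Integer as ℤ
import Data.Integer.Properties as ℤₚ
open import Algebra.Properties.AbelianGroup ℤₚ.+-0-abelianGroup using (inverseˡ-unique)
open import Data.List using (List; []; _∷_; [_]; _++_; map; concatMap; foldr; allFin; tabulate; upTo; length; replicate)
open import Data.List.Membership.Propositional.Properties using (∈-concatMap⁺; ∈-map⁺; ∈-upTo⁺)
open import Data.List.Membership.Propositional using (_∈_)
open import Data.List.Properties using (map-tabulate; ≡-dec; map-upTo; ++-identityʳ)
open import Data.List.Relation.Unary.All as All using (All; []; _∷_)
import Data.List.Relation.Unary.All.Properties as Allₚ
open import Data.List.Relation.Unary.Any as Any using (here)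
open import Data.Maybe using (Maybe; just; nothing)
import Data.Maybe as Maybe
open import Data.Nat as ℕ using (ℕ; zero; suc; _≤_; _<_; z≤n; s≤s; _≡ᵇ_; _⊓_; _∸_)
open import Data.Nat.ListAction using (sum)
open import Data.Nat.ListAction.Properties using (sum-++)
import Data.Nat.Properties as ℕₚ
open import Data.Nat.Tactic.RingSolver using (solve-∀)
open import Data.Product using (Σ; _×_; _,_; proj₁; proj₂)
open import Data.Sum using (_⊎_; inj₁; inj₂)
open import Data.Vec as Vec using (Vec; []; _∷_; lookup; _∷ʳ_)
open import Data.Vec.Properties using (zipWith-comm; zipWith-assoc; zipWith-identityˡ; lookup-zipWith; lookup-replicate; lookup-map)
open import Function using (_∘_)
open import Level using (0ℓ)
open import Relation.Nullary using (¬_; yes; no; contradiction)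
open import Relation.Nullary.Decidable using (⌊_⌋)
open import Relation.Binary.PropositionalEquality as ≡ using (_≡_; _≢_; refl; sym; trans; cong; cong₂; subst)

-- One coefficient function has to serve every number of variables, so the expansion is built as a
-- list of integer terms before `N` is chosen. It stays integral because Newton's identities express
-- power sums in the `e_r` without division; only the converse divides. The evaluation isolates a
-- single partition for these reasons: in three variables `e_r = 0` for `r ≥ 4`, the value `e₃ = 1`
-- makes parts 3 invisible, `ε² = 0` kills every product of two smaller parts, and the number of
-- vertices modulo 3 decides between the three shapes that are left. The multiple `3ε` is forced by
-- integrality: the root of `T³ - εT² - 1` near `ωⁱ` is `ωⁱ + ε/3`. The powers of two come from the
-- tail. After two steps `W` is a constant `t` up to first order, the three colours sum to `3t`, and
-- removing one of them leaves `2t`, so every three vertices double the leading term. In the case of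
-- `e₂` each doubling also feeds the first-order term, and the accumulation gives the factor `3k+1`.

-- Integer coefficients and finite sums in a commutative ring.

module RingKit (R : CommutativeRing 0ℓ 0ℓ) where

  open CommutativeRing R public hiding (zero) renaming (refl to ≈-refl; sym to ≈-sym; trans to ≈-trans)
  open import Algebra.Properties.Semiring.Mult.TCOptimised semiring public using (×1-homo-*; ×-homo-+; 1+×) renaming (_×_ to _·_)
  open import Algebra.Properties.Semiring.Exp semiring public using (_^_; ^-homo-*)
  open import Algebra.Properties.Ring ring public using (-‿distribˡ-*; -‿distribʳ-*; -‿involutive; -‿+-comm; -0#≈0#)
  open import Relation.Binary.Reasoning.Setoid setoid public

  -- The canonical ring map from `ℤ`. With this variant of repeated addition `1 · 1#` computes to
  -- `1#`, so the solver constant `con 1ℤ` stands for `1#` in goals without conversion.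
  ⟦_⟧ : ℤ → Carrier
  ⟦ + n ⟧      = n · 1#
  ⟦ -[1+ n ] ⟧ = - (suc n · 1#)

  private
    swapAround : ∀ a b c d → (a + b) + (c + d) ≈ (a + c) + (b + d)
    swapAround a b c d = begin
      (a + b) + (c + d) ≈⟨ +-assoc a b (c + d) ⟩
      a + (b + (c + d)) ≈⟨ +-congˡ (≈-sym (+-assoc b c d)) ⟩
      a + ((b + c) + d) ≈⟨ +-congˡ (+-congʳ (+-comm b c)) ⟩
      a + ((c + b) + d) ≈⟨ +-congˡ (+-assoc c b d) ⟩
      a + (c + (b + d)) ≈⟨ ≈-sym (+-assoc a c (b + d)) ⟩
      (a + c) + (b + d) ∎

  ⟦⟧-⊖ : ∀ m n → ⟦ m ⊖ n ⟧ ≈ m · 1# + - (n · 1#)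
  ⟦⟧-⊖ m zero = begin
    m · 1#          ≈⟨ ≈-sym (+-identityʳ _) ⟩
    m · 1# + 0#     ≈⟨ +-congˡ (≈-sym -0#≈0#) ⟩
    m · 1# + - 0#   ∎
  ⟦⟧-⊖ zero (suc n) = ≈-sym (+-identityˡ _)
  ⟦⟧-⊖ (suc m) (suc n) = begin
    ⟦ suc m ⊖ suc n ⟧                     ≡⟨ ≡.cong ⟦_⟧ (ℤₚ.[1+m]⊖[1+n]≡m⊖n m n) ⟩
    ⟦ m ⊖ n ⟧                             ≈⟨ ⟦⟧-⊖ m n ⟩
    m · 1# + - (n · 1#)                   ≈⟨ ≈-sym (+-identityˡ _) ⟩
    0# + (m · 1# + - (n · 1#))            ≈⟨ +-congʳ (≈-sym (-‿inverseʳ 1#)) ⟩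
    (1# + - 1#) + (m · 1# + - (n · 1#))   ≈⟨ swapAround _ _ _ _ ⟩
    (1# + m · 1#) + (- 1# + - (n · 1#))   ≈⟨ +-congˡ (-‿+-comm _ _) ⟩
    (1# + m · 1#) + - (1# + n · 1#)       ≈⟨ +-cong (≈-sym (1+× m 1#)) (-‿cong (≈-sym (1+× n 1#))) ⟩
    suc m · 1# + - (suc n · 1#)           ∎

  ⟦⟧-neg : ∀ i → ⟦ ℤ.- i ⟧ ≈ - ⟦ i ⟧
  ⟦⟧-neg (+ zero)  = ≈-sym -0#≈0#
  ⟦⟧-neg (+ suc n) = ≈-refl
  ⟦⟧-neg -[1+ n ]  = ≈-sym (-‿involutive _)

  ⟦⟧-+ : ∀ i j → ⟦ i ℤ.+ j ⟧ ≈ ⟦ i ⟧ + ⟦ j ⟧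
  ⟦⟧-+ (+ m)    (+ n)    = ×-homo-+ 1# m n
  ⟦⟧-+ (+ m)    -[1+ n ] = ⟦⟧-⊖ m (suc n)
  ⟦⟧-+ -[1+ m ] (+ n)    = ≈-trans (⟦⟧-⊖ n (suc m)) (+-comm _ _)
  ⟦⟧-+ -[1+ m ] -[1+ n ] = begin
    - (suc (suc (m ℕ.+ n)) · 1#)          ≡⟨ ≡.cong (λ k → - (suc k · 1#)) (≡.sym (ℕₚ.+-suc m n)) ⟩
    - ((suc m ℕ.+ suc n) · 1#)            ≈⟨ -‿cong (×-homo-+ 1# (suc m) (suc n)) ⟩
    - (suc m · 1# + suc n · 1#)           ≈⟨ ≈-sym (-‿+-comm _ _) ⟩
    - (suc m · 1#) + - (suc n · 1#)       ∎

  ⟦⟧-* : ∀ i j → ⟦ i ℤ.* j ⟧ ≈ ⟦ i ⟧ * ⟦ j ⟧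
  ⟦⟧-*-pos : ∀ m j → ⟦ + m ℤ.* j ⟧ ≈ ⟦ + m ⟧ * ⟦ j ⟧
  ⟦⟧-*-pos m (+ n) = begin
    ⟦ + m ℤ.* + n ⟧ ≡⟨ ≡.cong ⟦_⟧ (≡.sym (ℤₚ.pos-* m n)) ⟩
    ⟦ + (m ℕ.* n) ⟧ ≈⟨ ×1-homo-* m n ⟩
    ⟦ + m ⟧ * ⟦ + n ⟧ ∎
  ⟦⟧-*-pos m -[1+ n ] = begin
    ⟦ + m ℤ.* -[1+ n ] ⟧       ≡⟨ ≡.cong ⟦_⟧ (≡.sym (ℤₚ.neg-distribʳ-* (+ m) (+ suc n))) ⟩
    ⟦ ℤ.- (+ m ℤ.* + suc n) ⟧  ≈⟨ ⟦⟧-neg (+ m ℤ.* + suc n) ⟩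
    - ⟦ + m ℤ.* + suc n ⟧      ≈⟨ -‿cong (⟦⟧-*-pos m (+ suc n)) ⟩
    - (⟦ + m ⟧ * ⟦ + suc n ⟧)  ≈⟨ -‿distribʳ-* _ _ ⟩
    ⟦ + m ⟧ * ⟦ -[1+ n ] ⟧     ∎
  ⟦⟧-* (+ m)    j = ⟦⟧-*-pos m j
  ⟦⟧-* -[1+ m ] j = begin
    ⟦ -[1+ m ] ℤ.* j ⟧       ≡⟨ ≡.cong ⟦_⟧ (≡.sym (ℤₚ.neg-distribˡ-* (+ suc m) j)) ⟩
    ⟦ ℤ.- (+ suc m ℤ.* j) ⟧  ≈⟨ ⟦⟧-neg (+ suc m ℤ.* j) ⟩
    - ⟦ + suc m ℤ.* j ⟧      ≈⟨ -‿cong (⟦⟧-*-pos (suc m) j) ⟩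
    - (⟦ + suc m ⟧ * ⟦ j ⟧)  ≈⟨ -‿distribˡ-* _ _ ⟩
    ⟦ -[1+ m ] ⟧ * ⟦ j ⟧     ∎

  private
    almostR : AlmostCommutativeRing 0ℓ 0ℓ
    almostR = fromCommutativeRing R

    ℤ⟶R : CommutativeRing.rawRing ℤₚ.+-*-commutativeRing -Raw-AlmostCommutative⟶ almostR
    ℤ⟶R = record
      { ⟦_⟧ = ⟦_⟧ ; +-homo = ⟦⟧-+ ; *-homo = ⟦⟧-* ; -‿homo = ⟦⟧-neg
      ; 0-homo = ≈-refl ; 1-homo = ≈-refl }

    _≟ℤ_ : ∀ i j → Maybe (⟦ i ⟧ ≈ ⟦ j ⟧)
    i ≟ℤ j with i ℤ.≟ j
    ... | yes ≡.refl = just ≈-refl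
    ... | no _       = nothing

  -- Normal forms carry integer coefficients, which can be compared decidably over every `R`, even
  -- over `polyRing`, where equality quantifies over functionals.
  open import Algebra.Solver.Ring (CommutativeRing.rawRing ℤₚ.+-*-commutativeRing) almostR ℤ⟶R _≟ℤ_ public
    using (solve; _:=_; _:+_; _:*_; _:-_; :-_; con)

  ∑ : {A : Set} → List A → (A → Carrier) → Carrier
  ∑ L f = foldr _+_ 0# (map f L)

  module _ {A : Set} where

    ∑-cong : ∀ (L : List A) {f g : A → Carrier} → (∀ a → f a ≈ g a) → ∑ L f ≈ ∑ L g
    ∑-cong []      e = ≈-refl
    ∑-cong (a ∷ L) e = +-cong (e a) (∑-cong L e)

    ∑-0 : ∀ (L : List A) → ∑ L (λ _ → 0#) ≈ 0#
    ∑-0 []      = ≈-refl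
    ∑-0 (a ∷ L) = ≈-trans (+-identityˡ _) (∑-0 L)

    ∑-+ : ∀ (L : List A) (f g : A → Carrier) → ∑ L (λ a → f a + g a) ≈ ∑ L f + ∑ L g
    ∑-+ []      f g = ≈-sym (+-identityˡ 0#)
    ∑-+ (a ∷ L) f g = ≈-trans (+-congˡ (∑-+ L f g)) (swapAround _ _ _ _)

    ∑-*ˡ : ∀ (L : List A) k (f : A → Carrier) → ∑ L (λ a → k * f a) ≈ k * ∑ L f
    ∑-*ˡ []      k f = ≈-sym (zeroʳ k)
    ∑-*ˡ (a ∷ L) k f = ≈-trans (+-congˡ (∑-*ˡ L k f)) (≈-sym (distribˡ k _ _))

    ∑-*ʳ : ∀ (L : List A) k (f : A → Carrier) → ∑ L (λ a → f a * k) ≈ ∑ L f * k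
    ∑-*ʳ L k f = ≈-trans (∑-cong L λ a → *-comm (f a) k) (≈-trans (∑-*ˡ L k f) (*-comm k _))

    ∑-neg : ∀ (L : List A) (f : A → Carrier) → ∑ L (λ a → - f a) ≈ - ∑ L f
    ∑-neg []      f = ≈-sym -0#≈0#
    ∑-neg (a ∷ L) f = ≈-trans (+-congˡ (∑-neg L f)) (-‿+-comm _ _)

    ∑-++ : ∀ (L K : List A) (f : A → Carrier) → ∑ (L ++ K) f ≈ ∑ L f + ∑ K f
    ∑-++ []      K f = ≈-sym (+-identityˡ _)
    ∑-++ (a ∷ L) K f = ≈-trans (+-congˡ (∑-++ L K f)) (≈-sym (+-assoc _ _ _))

  module _ {A B : Set} where

    ∑-map : ∀ (L : List A) (h : A → B) (f : B → Carrier) → ∑ (map h L) f ≈ ∑ L (λ a → f (h a))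
    ∑-map []      h f = ≈-refl
    ∑-map (a ∷ L) h f = +-congˡ (∑-map L h f)

    ∑-concatMap : ∀ (L : List A) (h : A → List B) (f : B → Carrier) →
                  ∑ (concatMap h L) f ≈ ∑ L (λ a → ∑ (h a) f)
    ∑-concatMap []      h f = ≈-refl
    ∑-concatMap (a ∷ L) h f = ≈-trans (∑-++ (h a) _ f) (+-congˡ (∑-concatMap L h f))

    ∑-swap : ∀ (L : List A) (K : List B) (f : A → B → Carrier) →
             ∑ L (λ a → ∑ K (f a)) ≈ ∑ K (λ b → ∑ L (λ a → f a b))
    ∑-swap []      K f = ≈-sym (∑-0 K)
    ∑-swap (a ∷ L) K f = ≈-trans (+-congˡ (∑-swap L K f)) (≈-sym (∑-+ K (f a) _))

  ∑-allFin : ∀ {n} (f : Fin (suc n) → Carrier) →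
             ∑ (allFin (suc n)) f ≈ f zero + ∑ (allFin n) (λ i → f (suc i))
  ∑-allFin {n} f = +-congˡ (≈-trans (reflexive (≡.cong (λ L → ∑ L f) (≡.sym (map-tabulate {n = n} (λ i → i) suc))))
                                  (∑-map (allFin n) suc f))

  [_]ᵇ : Bool → Carrier
  [ b ]ᵇ = if b then 1# else 0#

  []ᵇ-∧ : ∀ b c → [ b ∧ c ]ᵇ ≈ [ b ]ᵇ * [ c ]ᵇ
  []ᵇ-∧ true  c = ≈-sym (*-identityˡ _)
  []ᵇ-∧ false c = ≈-sym (zeroˡ _)

  ∑-if : {A : Set} (b : Bool) (L : List A) (f : A → Carrier) →
         ∑ (if b then L else []) f ≈ [ b ]ᵇ * ∑ L f
  ∑-if true  L f = ≈-sym (*-identityˡ _)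
  ∑-if false L f = ≈-sym (zeroˡ _)

module ℤK = RingKit ℤₚ.+-*-commutativeRing

-- Exponent vectors, and integer polynomials tested by linear functionals.

infixl 6 _⊕_
_⊕_ : ∀ {N} → Vec ℕ N → Vec ℕ N → Vec ℕ N
_⊕_ = Vec.zipWith ℕ._+_

𝟎 : ∀ {N} → Vec ℕ N
𝟎 = Vec.replicate _ 0

⊕-comm : ∀ {N} (m n : Vec ℕ N) → m ⊕ n ≡ n ⊕ m
⊕-comm = zipWith-comm ℕₚ.+-comm

⊕-assoc : ∀ {N} (m n o : Vec ℕ N) → (m ⊕ n) ⊕ o ≡ m ⊕ (n ⊕ o)
⊕-assoc = zipWith-assoc ℕₚ.+-assoc

⊕-identityˡ : ∀ {N} (m : Vec ℕ N) → 𝟎 ⊕ m ≡ m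
⊕-identityˡ = zipWith-identityˡ ℕₚ.+-identityˡ

module Polynomials (N : ℕ) where

  infix 4 _≋_
  infixl 7 _⊛_

  Poly : Set
  Poly = List (ℤ × Vec ℕ N)

  term : (Vec ℕ N → ℤ) → ℤ × Vec ℕ N → ℤ
  term g (z , m) = z ℤ.* g m

  ⟨_,_⟩ : Poly → (Vec ℕ N → ℤ) → ℤ
  ⟨ L , g ⟩ = ℤK.∑ L (term g)

  -- Testing against every functional makes all ring laws instances of
  -- linearity and Fubini.
  record _≋_ (L K : Poly) : Set where
    constructor ext
    field at : ∀ g → ⟨ L , g ⟩ ≡ ⟨ K , g ⟩
  open _≋_ public

  shift : ℤ × Vec ℕ N → ℤ × Vec ℕ N → ℤ × Vec ℕ N
  shift (z , m) (w , n) = z ℤ.* w , m ⊕ n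

  _⊛_ : Poly → Poly → Poly
  L ⊛ K = concatMap (λ t → map (shift t) K) L

  neg : Poly → Poly
  neg = map λ { (z , m) → ℤ.- z , m }

  const : ℤ → Poly
  const z = (z , 𝟎) ∷ []

  ⟨⟩-cong : ∀ L {g h} → (∀ m → g m ≡ h m) → ⟨ L , g ⟩ ≡ ⟨ L , h ⟩
  ⟨⟩-cong L e = ℤK.∑-cong L λ { (z , m) → cong (z ℤ.*_) (e m) }

  ⟨⟩-swap : ∀ L K (g : Vec ℕ N → Vec ℕ N → ℤ) →
            ⟨ L , (λ m → ⟨ K , g m ⟩) ⟩ ≡ ⟨ K , (λ n → ⟨ L , (λ m → g m n) ⟩) ⟩
  ⟨⟩-swap L K g = trans
    (ℤK.∑-cong L λ { (z , m) → sym (ℤK.∑-*ˡ K z _) })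
    (trans (ℤK.∑-swap L K _)
           (ℤK.∑-cong K λ { (w , n) → trans (ℤK.∑-cong L λ { (z , m) → lem z w (g m n) }) (ℤK.∑-*ˡ L w _) }))
    where
    lem : ∀ z w c → z ℤ.* (w ℤ.* c) ≡ w ℤ.* (z ℤ.* c)
    lem = ℤK.solve 3 (λ z w c → z ℤK.:* (w ℤK.:* c) ℤK.:= w ℤK.:* (z ℤK.:* c)) refl

  ⟨⟩-++ : ∀ L K g → ⟨ L ++ K , g ⟩ ≡ ⟨ L , g ⟩ ℤ.+ ⟨ K , g ⟩
  ⟨⟩-++ L K g = ℤK.∑-++ L K _

  ⟨⟩-+ : ∀ L g h → ⟨ L , (λ m → g m ℤ.+ h m) ⟩ ≡ ⟨ L , g ⟩ ℤ.+ ⟨ L , h ⟩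
  ⟨⟩-+ L g h = trans (ℤK.∑-cong L λ { (z , m) → ℤₚ.*-distribˡ-+ z (g m) (h m) }) (ℤK.∑-+ L _ _)

  -- Pairing with a product is pairing twice. Together with `⟨⟩-swap` this reduces commutativity and
  -- associativity of `⊛` to those of `⊕`.
  ⟨⟩-⊛ : ∀ L K g → ⟨ L ⊛ K , g ⟩ ≡ ⟨ L , (λ m → ⟨ K , (λ n → g (m ⊕ n)) ⟩) ⟩
  ⟨⟩-⊛ L K g = trans (ℤK.∑-concatMap L _ _) (ℤK.∑-cong L λ { (z , m) →
    trans (ℤK.∑-map K _ _)
    (trans (ℤK.∑-cong K λ { (w , n) → ℤₚ.*-assoc z w (g (m ⊕ n)) }) (ℤK.∑-*ˡ K z _)) })

  ⟨⟩-neg : ∀ L g → ⟨ neg L , g ⟩ ≡ ℤ.- ⟨ L , g ⟩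
  ⟨⟩-neg L g = trans (ℤK.∑-map L _ _)
    (trans (ℤK.∑-cong L λ { (z , m) → sym (ℤₚ.neg-distribˡ-* z (g m)) }) (ℤK.∑-neg L _))

  ⟨⟩-const : ∀ z g → ⟨ const z , g ⟩ ≡ z ℤ.* g 𝟎
  ⟨⟩-const z g = ℤₚ.+-identityʳ _

  ⟨⟩-const-⊛ : ∀ z L g → ⟨ const z ⊛ L , g ⟩ ≡ z ℤ.* ⟨ L , g ⟩
  ⟨⟩-const-⊛ z L g = trans (⟨⟩-⊛ (const z) L g) (trans (⟨⟩-const z (λ m → ⟨ L , (λ n → g (m ⊕ n)) ⟩))
    (cong (z ℤ.*_) (⟨⟩-cong L λ m → cong g (⊕-identityˡ m))))

  private
    ⊛-comm : ∀ L K → (L ⊛ K) ≋ (K ⊛ L)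
    ⊛-comm L K = ext λ g → trans (⟨⟩-⊛ L K g) (trans (⟨⟩-swap L K _) (trans
      (⟨⟩-cong K λ n → ⟨⟩-cong L λ m → cong g (⊕-comm m n)) (sym (⟨⟩-⊛ K L g))))

    -- The hypothesis on `L` is applied to the functional that pairs with `K` first. This is no
    -- indicator of a monomial, which is why `_≋_` asks for agreement on all functionals and not
    -- only on coefficients.
    ⊛-cong : ∀ {L L′ K K′} → L ≋ L′ → K ≋ K′ → (L ⊛ K) ≋ (L′ ⊛ K′)
    ⊛-cong {L} {L′} {K} {K′} p q = ext λ g → trans (⟨⟩-⊛ L K g) (trans (at p _) (trans
      (⟨⟩-cong L′ λ m → at q _) (sym (⟨⟩-⊛ L′ K′ g))))

    ⊛-assoc : ∀ L K J → ((L ⊛ K) ⊛ J) ≋ (L ⊛ (K ⊛ J))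
    ⊛-assoc L K J = ext λ g → trans (⟨⟩-⊛ (L ⊛ K) J g) (trans (⟨⟩-⊛ L K _) (trans
      (⟨⟩-cong L λ m → trans
        (⟨⟩-cong K λ n → ⟨⟩-cong J λ o → cong g (⊕-assoc m n o))
        (sym (⟨⟩-⊛ K J _)))
      (sym (⟨⟩-⊛ L (K ⊛ J) g))))

    ⊛-identityˡ : ∀ L → (const 1ℤ ⊛ L) ≋ L
    ⊛-identityˡ L = ext λ g → trans (⟨⟩-const-⊛ 1ℤ L g) (ℤₚ.*-identityˡ _)

    ⊛-distribˡ : ∀ L K J → (L ⊛ (K ++ J)) ≋ ((L ⊛ K) ++ (L ⊛ J))
    ⊛-distribˡ L K J = ext λ g → trans (⟨⟩-⊛ L (K ++ J) g) (trans
      (⟨⟩-cong L λ m → ⟨⟩-++ K J _)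
      (trans (⟨⟩-+ L _ _) (trans (sym (cong₂ ℤ._+_ (⟨⟩-⊛ L K g) (⟨⟩-⊛ L J g))) (sym (⟨⟩-++ (L ⊛ K) _ g)))))

    ++-cong : ∀ {L L′ K K′} → L ≋ L′ → K ≋ K′ → (L ++ K) ≋ (L′ ++ K′)
    ++-cong {L} {L′} p q = ext λ g → trans (⟨⟩-++ L _ g) (trans (cong₂ ℤ._+_ (at p g) (at q g)) (sym (⟨⟩-++ L′ _ g)))

    ++-comm : ∀ L K → (L ++ K) ≋ (K ++ L)
    ++-comm L K = ext λ g → trans (⟨⟩-++ L K g) (trans (ℤₚ.+-comm ⟨ L , g ⟩ ⟨ K , g ⟩) (sym (⟨⟩-++ K L g)))

    ++-assoc : ∀ L K J → ((L ++ K) ++ J) ≋ (L ++ (K ++ J))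
    ++-assoc L K J = ext λ g → trans (⟨⟩-++ (L ++ K) J g) (trans (cong (ℤ._+ _) (⟨⟩-++ L K g))
      (trans (ℤₚ.+-assoc ⟨ L , g ⟩ ⟨ K , g ⟩ ⟨ J , g ⟩)
      (sym (trans (⟨⟩-++ L (K ++ J) g) (cong₂ ℤ._+_ (refl {x = ⟨ L , g ⟩}) (⟨⟩-++ K J g))))))

    neg-cong : ∀ {L K} → L ≋ K → neg L ≋ neg K
    neg-cong {L} {K} p = ext λ g → trans (⟨⟩-neg L g) (trans (cong ℤ.-_ (at p g)) (sym (⟨⟩-neg K g)))

    neg-inverseˡ : ∀ L → (neg L ++ L) ≋ []
    neg-inverseˡ L = ext λ g → trans (⟨⟩-++ (neg L) L g) (trans (cong (ℤ._+ ⟨ L , g ⟩) (⟨⟩-neg L g)) (ℤₚ.+-inverseˡ ⟨ L , g ⟩))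

  polyRing : CommutativeRing 0ℓ 0ℓ
  polyRing = record
    { Carrier = Poly ; _≈_ = _≋_ ; _+_ = _++_ ; _*_ = _⊛_ ; -_ = neg ; 0# = [] ; 1# = const 1ℤ
    ; isCommutativeRing = record
      { isRing = record
        { +-isAbelianGroup = record
          { isGroup = record
            { isMonoid = record
              { isSemigroup = record
                { isMagma = record
                  { isEquivalence = record
                    { refl = ext λ g → refl ; sym = λ p → ext λ g → sym (at p g) ; trans = λ p q → ext λ g → trans (at p g) (at q g) }
                  ; ∙-cong = ++-cong }
                ; assoc = ++-assoc }
              ; identity = (λ L → ext λ g → refl) , (λ L → ext λ g → trans (⟨⟩-++ L [] g) (ℤₚ.+-identityʳ _)) }
            ; inverse = neg-inverseˡ
                      , λ L → ext λ g → trans (at (++-comm L (neg L)) g) (at (neg-inverseˡ L) g)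
            ; ⁻¹-cong = neg-cong }
          ; comm = ++-comm }
        ; *-cong = ⊛-cong
        ; *-assoc = ⊛-assoc
        ; *-identity = ⊛-identityˡ , λ L → ext λ g → trans (at (⊛-comm L (const 1ℤ)) g) (at (⊛-identityˡ L) g)
        ; distrib = ⊛-distribˡ
                  , λ L K J → ext λ g → trans (at (⊛-comm (K ++ J) L) g) (trans (at (⊛-distribˡ L K J) g)
                      (at (++-cong (⊛-comm L K) (⊛-comm L J)) g)) }
      ; *-comm = ⊛-comm } }

-- The chromatic and elementary symmetric functions as lists of monomials.

unit : ∀ {N} → Fin N → Vec ℕ N
unit zero    = 1 ∷ 𝟎
unit (suc i) = 0 ∷ unit i

content : ∀ {N n} → Vec (Fin N) n → Vec ℕ N
content []      = 𝟎
content (c ∷ κ) = unit c ⊕ content κ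

indV : ∀ {N} → Vec Bool N → Vec ℕ N
indV = Vec.map ind

subsets : (N : ℕ) → List (Vec Bool N)
subsets = allVecs (true ∷ false ∷ [])

-- Monomials are listed with multiplicity: a coefficient is then a sum of indicators over the list,
-- and any other functional, such as evaluation in a ring, can be summed over the same list.
eMonomials : List ℕ → (N : ℕ) → List (Vec ℕ N)
eMonomials []       N = [ 𝟎 ]
eMonomials (r ∷ λ') N =
  concatMap (λ S → if subsetSize S ≡ᵇ r then map (indV S ⊕_) (eMonomials λ' N) else []) (subsets N)

colourings : (G : Graph) (N : ℕ) → List (Vec (Fin N) (size G))
colourings G N = allVecs (allFin N) (size G)

XMonomials : (G : Graph) (N : ℕ) → List (Vec ℕ N)
XMonomials G N = concatMap (λ κ → if proper G κ then [ content κ ] else []) (colourings G N)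

matches : ∀ {N} → (Fin N → ℕ) → Vec ℕ N → Bool
matches {N} α m = allᵇ (λ i → lookup m i ≡ᵇ α i) (allFin N)

δ : ∀ {N} → (Fin N → ℕ) → Vec ℕ N → ℤ
δ α m = ℤK.[ matches α m ]ᵇ

allᵇ-cong : ∀ {A : Set} {p q : A → Bool} → (∀ a → p a ≡ q a) → ∀ L → allᵇ p L ≡ allᵇ q L
allᵇ-cong e []      = refl
allᵇ-cong e (a ∷ L) = cong₂ _∧_ (e a) (allᵇ-cong e L)

allᵇ-∧ : ∀ {A : Set} (p q : A → Bool) L → allᵇ (λ a → p a ∧ q a) L ≡ allᵇ p L ∧ allᵇ q L
allᵇ-∧ p q []      = refl
allᵇ-∧ p q (a ∷ L) rewrite allᵇ-∧ p q L = interchange (p a) (q a) (allᵇ p L) (allᵇ q L)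
  where
  interchange : ∀ a b c d → (a ∧ b) ∧ (c ∧ d) ≡ (a ∧ c) ∧ (b ∧ d)
  interchange true  true  c d = refl
  interchange true  false true  d = refl
  interchange true  false false d = refl
  interchange false b c d = refl

countᵇ-sum : ∀ {A : Set} (p : A → Bool) L → + countᵇ p L ≡ ℤK.∑ L (λ a → ℤK.[ p a ]ᵇ)
countᵇ-sum p []      = refl
countᵇ-sum p (a ∷ L) with p a
... | true  = trans (ℤₚ.pos-+ 1 (countᵇ p L)) (cong (λ z → 1ℤ ℤ.+ z) (countᵇ-sum p L))
... | false = trans (countᵇ-sum p L) (sym (ℤₚ.+-identityˡ _))

countᵇ-map : ∀ {A B : Set} (h : A → B) (p : B → Bool) L → countᵇ p (map h L) ≡ countᵇ (p ∘ h) L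
countᵇ-map h p []      = refl
countᵇ-map h p (a ∷ L) rewrite countᵇ-map h p L = refl

allᵇ-map : ∀ {A B : Set} (h : A → B) (p : B → Bool) L → allᵇ p (map h L) ≡ allᵇ (p ∘ h) L
allᵇ-map h p []      = refl
allᵇ-map h p (a ∷ L) = cong (p (h a) ∧_) (allᵇ-map h p L)

tabulate-suc : ∀ n → tabulate {A = Fin (suc n)} suc ≡ map suc (allFin n)
tabulate-suc n = sym (map-tabulate {n = n} (λ i → i) suc)

suc-==ᶠ : ∀ {N} (c i : Fin N) → (suc c ==ᶠ suc i) ≡ (c ==ᶠ i)
suc-==ᶠ c i with c ≟ i
... | yes _ = refl
... | no  _ = refl

lookup-unit : ∀ {N} (c i : Fin N) → lookup (unit c) i ≡ ind (c ==ᶠ i)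
lookup-unit zero    zero    = refl
lookup-unit zero    (suc i) = lookup-replicate i 0
lookup-unit (suc c) zero    = refl
lookup-unit (suc c) (suc i) = trans (lookup-unit c i) (cong ind (sym (suc-==ᶠ c i)))

lookup-content : ∀ {N n} (κ : Vec (Fin N) n) i →
  lookup (content κ) i ≡ countᵇ (λ v → lookup κ v ==ᶠ i) (allFin n)
lookup-content []      i = lookup-replicate i 0
lookup-content {n = suc n} (c ∷ κ) i = trans (lookup-zipWith ℕ._+_ i (unit c) (content κ))
  (trans (cong₂ ℕ._+_ (lookup-unit c i) (lookup-content κ i)) head)
  where
  p : Fin (suc n) → Bool
  p v = lookup (c ∷ κ) v ==ᶠ i
  head : ind (c ==ᶠ i) ℕ.+ countᵇ (p ∘ suc) (allFin n) ≡ countᵇ p (allFin (suc n))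
  tail : countᵇ (p ∘ suc) (allFin n) ≡ countᵇ p (tabulate suc)
  tail = trans (sym (countᵇ-map suc p (allFin n))) (cong (countᵇ p) (sym (tabulate-suc n)))
  head with c ==ᶠ i
  ... | true  = cong suc tail
  ... | false = tail

matches-content : ∀ {N n} (κ : Vec (Fin N) n) α → matches α (content κ) ≡ hasContent κ α
matches-content {N} κ α = allᵇ-cong (λ i → cong (_≡ᵇ α i) (lookup-content κ i)) (allFin N)

XCoeff-sum : ∀ G N α → + XCoeff G N α ≡ ℤK.∑ (XMonomials G N) (δ α)
XCoeff-sum G N α = trans (countᵇ-sum _ (colourings G N)) (sym (trans
  (ℤK.∑-concatMap (colourings G N) _ (δ α))
  (ℤK.∑-cong (colourings G N) λ κ → trans (ℤK.∑-if (proper G κ) [ content κ ] (δ α))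
    (trans (cong (ℤK.[ proper G κ ]ᵇ ℤ.*_) (trans (ℤₚ.+-identityʳ _) (cong ℤK.[_]ᵇ (matches-content κ α))))
           (sym (ℤK.[]ᵇ-∧ (proper G κ) _))))))

-- The guard `≤ᵇ` makes the truncated subtraction of `eCoeff` faithful: for `ind b = 1` and `a = 0`
-- the test `k ≡ᵇ a ∸ 1` alone would wrongly accept `k = 0`.
matches-⊕ : ∀ {N} (S : Vec Bool N) (m : Vec ℕ N) α →
  matches α (indV S ⊕ m)
    ≡ allᵇ (λ i → ind (lookup S i) ℕ.≤ᵇ α i) (allFin N) ∧ matches (λ i → α i ℕ.∸ ind (lookup S i)) m
matches-⊕ {N} S m α = trans
  (allᵇ-cong (λ i → trans
     (cong (_≡ᵇ α i) (trans (lookup-zipWith ℕ._+_ i (indV S) m) (cong (ℕ._+ lookup m i) (lookup-map i ind S))))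
     (cancel (lookup S i) (lookup m i) (α i)))
   (allFin N))
  (allᵇ-∧ _ _ (allFin N))
  where
  cancel : ∀ b k a → (ind b ℕ.+ k ≡ᵇ a) ≡ (ind b ℕ.≤ᵇ a) ∧ (k ≡ᵇ a ℕ.∸ ind b)
  cancel true  k zero    = refl
  cancel true  k (suc a) = refl
  cancel false k a       = refl

eCoeff-sum : ∀ λ' N α → + eCoeff λ' N α ≡ ℤK.∑ (eMonomials λ' N) (δ α)
eCoeff-sum [] N α = trans (pos-if (allᵇ (λ i → α i ≡ᵇ 0) (allFin N))) (trans
  (cong ℤK.[_]ᵇ (allᵇ-cong (λ i → trans (≡ᵇ-zero (α i)) (cong (_≡ᵇ α i) (sym (lookup-replicate i 0)))) (allFin N)))
  (sym (ℤₚ.+-identityʳ _)))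
  where
  ≡ᵇ-zero : ∀ a → (a ≡ᵇ 0) ≡ (0 ≡ᵇ a)
  ≡ᵇ-zero zero    = refl
  ≡ᵇ-zero (suc a) = refl
  pos-if : ∀ b → + (if b then 1 else 0) ≡ ℤK.[ b ]ᵇ
  pos-if true  = refl
  pos-if false = refl
eCoeff-sum (r ∷ λ') N α = trans (pos-sum (subsets N)) (sym (trans
  (ℤK.∑-concatMap (subsets N) _ (δ α))
  (ℤK.∑-cong (subsets N) step)))
  where
  f : Vec Bool N → ℕ
  f S = if (subsetSize S ≡ᵇ r) ∧ allᵇ (λ i → ind (lookup S i) ℕ.≤ᵇ α i) (allFin N)
        then eCoeff λ' N (λ i → α i ℕ.∸ ind (lookup S i)) else 0

  pos-sum : ∀ L → + foldr ℕ._+_ 0 (map f L) ≡ ℤK.∑ L (λ S → + f S)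
  pos-sum []      = refl
  pos-sum (S ∷ L) = trans (ℤₚ.pos-+ (f S) _) (cong (λ z → + f S ℤ.+ z) (pos-sum L))

  pos-if : ∀ b c n → ℤK.[ b ]ᵇ ℤ.* (ℤK.[ c ]ᵇ ℤ.* + n) ≡ + (if b ∧ c then n else 0)
  pos-if true  true  n = trans (ℤₚ.*-identityˡ _) (ℤₚ.*-identityˡ _)
  pos-if true  false n = refl
  pos-if false c     n = refl

  step : ∀ S → ℤK.∑ (if subsetSize S ≡ᵇ r then map (indV S ⊕_) (eMonomials λ' N) else []) (δ α) ≡ + f S
  step S = trans (ℤK.∑-if (subsetSize S ≡ᵇ r) _ (δ α)) (trans
    (cong (ℤK.[ subsetSize S ≡ᵇ r ]ᵇ ℤ.*_) (trans
      (ℤK.∑-map (eMonomials λ' N) (indV S ⊕_) (δ α))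
      (trans (ℤK.∑-cong (eMonomials λ' N) λ m →
                trans (cong ℤK.[_]ᵇ (matches-⊕ S m α)) (ℤK.[]ᵇ-∧ fits _))
      (trans (ℤK.∑-*ˡ (eMonomials λ' N) ℤK.[ fits ]ᵇ _)
             (cong (ℤK.[ fits ]ᵇ ℤ.*_) (sym (eCoeff-sum λ' N _)))))))
    (pos-if (subsetSize S ≡ᵇ r) fits _))
    where
    fits : Bool
    fits = allᵇ (λ i → ind (lookup S i) ℕ.≤ᵇ α i) (allFin N)

-- Evaluation of symmetric functions in a commutative ring.

module Symmetric (R : CommutativeRing 0ℓ 0ℓ) where
  open RingKit R

  mon : ∀ {N} → (Fin N → Carrier) → Vec ℕ N → Carrier
  mon x []      = 1#
  mon x (k ∷ m) = x zero ^ k * mon (x ∘ suc) m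

  mon-𝟎 : ∀ {N} (x : Fin N → Carrier) → mon x 𝟎 ≈ 1#
  mon-𝟎 {zero}  x = ≈-refl
  mon-𝟎 {suc N} x = ≈-trans (*-identityˡ _) (mon-𝟎 (x ∘ suc))

  mon-unit : ∀ {N} (x : Fin N → Carrier) c → mon x (unit c) ≈ x c
  mon-unit x zero    = ≈-trans (*-cong (*-identityʳ _) (mon-𝟎 (x ∘ suc))) (*-identityʳ _)
  mon-unit x (suc c) = ≈-trans (*-identityˡ _) (mon-unit (x ∘ suc) c)

  mon-⊕ : ∀ {N} (x : Fin N → Carrier) m n → mon x (m ⊕ n) ≈ mon x m * mon x n
  mon-⊕ x []      []      = ≈-sym (*-identityˡ _)
  mon-⊕ x (k ∷ m) (l ∷ n) = ≈-trans (*-cong (^-homo-* (x zero) k l) (mon-⊕ (x ∘ suc) m n))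
    (solve 4 (λ a b c d → (a :* b) :* (c :* d) := (a :* c) :* (b :* d)) ≈-refl _ _ _ _)

  e : ℕ → ∀ {N} → (Fin N → Carrier) → Carrier
  e zero            x = 1#
  e (suc r) {zero}  x = 0#
  e (suc r) {suc N} x = e (suc r) (x ∘ suc) + x zero * e r (x ∘ suc)

  -- Splitting the subsets by whether they contain the first variable reproduces the recursion of
  -- `e`.
  e-subsets : ∀ r {N} (x : Fin N → Carrier) →
    ∑ (subsets N) (λ S → [ subsetSize S ≡ᵇ r ]ᵇ * mon x (indV S)) ≈ e r x
  e-subsets zero    {zero} x = ≈-trans (+-identityʳ _) (*-identityˡ _)
  e-subsets (suc r) {zero} x = ≈-trans (+-identityʳ _) (zeroˡ _)
  e-subsets r {suc N} x = ≈-trans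
    (≈-trans (∑-concatMap (true ∷ false ∷ []) (λ b → map (b ∷_) (subsets N)) _)
             (+-cong (∑-map (subsets N) (true ∷_) _) (≈-trans (+-identityʳ _) (∑-map (subsets N) (false ∷_) _))))
    (split r)
    where
    split : ∀ r →
      ∑ (subsets N) (λ S → [ suc (subsetSize S) ≡ᵇ r ]ᵇ * ((x zero * 1#) * mon (x ∘ suc) (indV S)))
      + ∑ (subsets N) (λ S → [ subsetSize S ≡ᵇ r ]ᵇ * (1# * mon (x ∘ suc) (indV S))) ≈ e r x
    split zero = ≈-trans
      (+-cong (≈-trans (∑-cong (subsets N) λ S → zeroˡ _) (∑-0 (subsets N)))
              (≈-trans (∑-cong (subsets N) λ S → *-congˡ (*-identityˡ _)) (e-subsets zero (x ∘ suc))))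
      (+-identityˡ _)
    split (suc r) = ≈-trans
      (+-cong (≈-trans (∑-cong (subsets N) λ S →
                          solve 3 (λ b t m → b :* ((t :* con 1ℤ) :* m) := t :* (b :* m)) ≈-refl [ subsetSize S ≡ᵇ r ]ᵇ _ _)
                       (≈-trans (∑-*ˡ (subsets N) (x zero) _) (*-congˡ (e-subsets r (x ∘ suc)))))
              (≈-trans (∑-cong (subsets N) λ S → *-congˡ (*-identityˡ _)) (e-subsets (suc r) (x ∘ suc))))
      (+-comm _ _)

  E : List ℕ → ∀ {N} → (Fin N → Carrier) → Carrier
  E λ' x = foldr (λ r acc → e r x * acc) 1# λ'

  eMonomials-sum : ∀ λ' {N} (x : Fin N → Carrier) → ∑ (eMonomials λ' N) (mon x) ≈ E λ' x
  eMonomials-sum []       x = ≈-trans (+-identityʳ _) (mon-𝟎 x)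
  eMonomials-sum (r ∷ λ') {N} x = ≈-trans (∑-concatMap (subsets N) _ (mon x)) (≈-trans
    (∑-cong (subsets N) λ S → ≈-trans (∑-if (subsetSize S ≡ᵇ r) _ (mon x)) (≈-trans
      (*-congˡ (≈-trans (∑-map (eMonomials λ' N) (indV S ⊕_) (mon x)) (≈-trans
        (∑-cong (eMonomials λ' N) λ m → mon-⊕ x (indV S) m)
        (∑-*ˡ (eMonomials λ' N) (mon x (indV S)) (mon x)))))
      (≈-sym (*-assoc _ _ _))))
    (≈-trans (∑-*ʳ (subsets N) _ _) (*-cong (e-subsets r x) (eMonomials-sum λ' x))))

  prod : ∀ {N n} → (Fin N → Carrier) → Vec (Fin N) n → Carrier
  prod x []      = 1#
  prod x (c ∷ κ) = x c * prod x κ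

  mon-content : ∀ {N n} (x : Fin N → Carrier) (κ : Vec (Fin N) n) → mon x (content κ) ≈ prod x κ
  mon-content x []      = mon-𝟎 x
  mon-content x (c ∷ κ) = ≈-trans (mon-⊕ x (unit c) (content κ)) (*-cong (mon-unit x c) (mon-content x κ))

  X : (G : Graph) → ∀ {N} → (Fin N → Carrier) → Carrier
  X G {N} x = ∑ (colourings G N) (λ κ → [ proper G κ ]ᵇ * prod x κ)

  XMonomials-sum : ∀ G {N} (x : Fin N → Carrier) → ∑ (XMonomials G N) (mon x) ≈ X G x
  XMonomials-sum G {N} x = ≈-trans (∑-concatMap (colourings G N) _ (mon x))
    (∑-cong (colourings G N) λ κ → ≈-trans (∑-if (proper G κ) [ content κ ] (mon x))
      (*-congˡ (≈-trans (+-identityʳ _) (mon-content x κ))))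

-- Evaluation at generic variables recovers coefficients.

module Generic (N : ℕ) where
  open Polynomials N public
  open RingKit polyRing
  open Symmetric polyRing

  monomial : Vec ℕ N → Poly
  monomial m = (1ℤ , m) ∷ []

  var : Fin N → Poly
  var i = monomial (unit i)

  ⟨⟩-monomial : ∀ m g → ⟨ monomial m , g ⟩ ≡ g m
  ⟨⟩-monomial m g = trans (ℤₚ.+-identityʳ _) (ℤₚ.*-identityˡ _)

  scale : ∀ {n} → ℕ → Vec ℕ n → Vec ℕ n
  scale k = Vec.map (k ℕ.*_)

  monomial-cong : ∀ {m n} → m ≡ n → monomial m ≋ monomial n
  monomial-cong refl = ≈-refl

  monomial-^ : ∀ m k → monomial m ^ k ≋ monomial (scale k m)
  monomial-^ m zero    = monomial-cong (sym (scale-0 m))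
    where
    scale-0 : ∀ {n} (m : Vec ℕ n) → scale 0 m ≡ 𝟎
    scale-0 []      = refl
    scale-0 (k ∷ m) = cong (0 ∷_) (scale-0 m)
  monomial-^ m (suc k) = ≈-trans (*-congˡ {monomial m} (monomial-^ m k)) (monomial-cong (scale-suc m))
    where
    scale-suc : ∀ {n} (m : Vec ℕ n) → m ⊕ scale k m ≡ scale (suc k) m
    scale-suc []      = refl
    scale-suc (l ∷ m) = cong (_ ∷_) (scale-suc m)

  -- Defined for an arbitrary family `u`, because the recursion of `mon` drops variables and so
  -- turns `unit` into `unit ∘ suc`.
  lin : ∀ {n M} → (Fin n → Vec ℕ M) → Vec ℕ n → Vec ℕ M
  lin u []      = 𝟎
  lin u (k ∷ m) = scale k (u zero) ⊕ lin (u ∘ suc) m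

  mon-monomial : ∀ {n} (u : Fin n → Vec ℕ N) m → mon (monomial ∘ u) m ≋ monomial (lin u m)
  mon-monomial u []      = ≈-refl
  mon-monomial u (k ∷ m) = *-cong (monomial-^ (u zero) k) (mon-monomial (u ∘ suc) m)

  lin-unit : ∀ {n} (m : Vec ℕ n) → lin unit m ≡ m
  lin-unit []      = refl
  lin-unit (k ∷ m) = trans (cong (scale k (1 ∷ 𝟎) ⊕_) (lin-0∷ unit m))
    (cong₂ _∷_ (trans (ℕₚ.+-identityʳ _) (ℕₚ.*-identityʳ k))
               (trans (cong₂ _⊕_ (scale-𝟎 k) (lin-unit m)) (⊕-identityˡ m)))
    where
    scale-𝟎 : ∀ {n} k → scale {n} k 𝟎 ≡ 𝟎
    scale-𝟎 {zero}  k = refl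
    scale-𝟎 {suc n} k = cong₂ _∷_ (ℕₚ.*-zeroʳ k) (scale-𝟎 k)
    lin-0∷ : ∀ {n M} (u : Fin n → Vec ℕ M) m → lin (λ i → 0 ∷ u i) m ≡ 0 ∷ lin u m
    lin-0∷ u []      = refl
    lin-0∷ u (k ∷ m) = trans (cong (scale k (0 ∷ u zero) ⊕_) (lin-0∷ (u ∘ suc) m))
      (cong (_∷ lin u (k ∷ m)) (trans (ℕₚ.+-identityʳ _) (ℕₚ.*-zeroʳ k)))

  mon-var : ∀ m → mon var m ≋ monomial m
  mon-var m = ≈-trans (mon-monomial unit m) (monomial-cong (lin-unit m))

  ⟨∑⟩ : ∀ {A : Set} (L : List A) (f : A → Poly) g → ⟨ ∑ L f , g ⟩ ≡ ℤK.∑ L (λ a → ⟨ f a , g ⟩)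
  ⟨∑⟩ []      f g = refl
  ⟨∑⟩ (a ∷ L) f g = trans (⟨⟩-++ (f a) (∑ L f) g) (cong (λ z → ⟨ f a , g ⟩ ℤ.+ z) (⟨∑⟩ L f g))

  ⟨∑mon⟩ : ∀ (L : List (Vec ℕ N)) g → ⟨ ∑ L (mon var) , g ⟩ ≡ ℤK.∑ L g
  ⟨∑mon⟩ L g = trans (⟨∑⟩ L (mon var) g) (ℤK.∑-cong L λ m → trans (at (mon-var m) g) (⟨⟩-monomial m g))

  -- Through this and `⟨E⟩`, identities proved in `polyRing` at the variables `var` become
  -- identities between the counted coefficients.
  ⟨X⟩ : ∀ G α → ⟨ X G var , δ α ⟩ ≡ + XCoeff G N α
  ⟨X⟩ G α = trans (sym (at (XMonomials-sum G var) (δ α))) (trans (⟨∑mon⟩ (XMonomials G N) (δ α)) (sym (XCoeff-sum G N α)))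

  ⟨E⟩ : ∀ λ' α → ⟨ E λ' var , δ α ⟩ ≡ + eCoeff λ' N α
  ⟨E⟩ λ' α = trans (sym (at (eMonomials-sum λ' var) (δ α))) (trans (⟨∑mon⟩ (eMonomials λ' N) (δ α)) (sym (eCoeff-sum λ' N α)))

-- Proper colourings of the twinned tadpole.

neᵇ : ∀ {N} → Fin N → Fin N → Bool
neᵇ c d = not (c ==ᶠ d)

==ᶠ-sym : ∀ {N} (c d : Fin N) → (c ==ᶠ d) ≡ (d ==ᶠ c)
==ᶠ-sym c d with c ≟ d | d ≟ c
... | yes _    | yes _    = refl
... | no _     | no _     = refl
... | yes refl | no d≢d   = contradiction refl d≢d
... | no c≢c   | yes refl = contradiction refl c≢c

neᵇ-sym : ∀ {N} (c d : Fin N) → neᵇ c d ≡ neᵇ d c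
neᵇ-sym c d = cong not (==ᶠ-sym c d)

chain : ∀ {N n} → Vec (Fin N) n → Bool
chain []          = true
chain (c ∷ [])    = true
chain (c ∷ d ∷ κ) = neᵇ c d ∧ chain (d ∷ κ)

iff⇒≡ : ∀ {a b} → (a ≡ true → b ≡ true) → (b ≡ true → a ≡ true) → a ≡ b
iff⇒≡ {true}  {true}  f g = refl
iff⇒≡ {false} {false} f g = refl
iff⇒≡ {true}  {false} f g = sym (f refl)
iff⇒≡ {false} {true}  f g = g refl

∧-true : ∀ {a b} → a ∧ b ≡ true → a ≡ true × b ≡ true
∧-true {true} {true} _ = refl , refl

∨-true : ∀ a {b} → a ∨ b ≡ true → a ≡ true ⊎ b ≡ true
∨-true true  _ = inj₁ refl
∨-true false p = inj₂ p

∧-intro : ∀ {a b} → a ≡ true → b ≡ true → a ∧ b ≡ true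
∧-intro refl refl = refl

allᵇ-allFin : ∀ {n} (p : Fin (suc n) → Bool) → allᵇ p (allFin (suc n)) ≡ p zero ∧ allᵇ (p ∘ suc) (allFin n)
allᵇ-allFin {n} p = cong (p zero ∧_) (trans (cong (allᵇ p) (tabulate-suc n)) (allᵇ-map suc p (allFin n)))

allᵇ-elim : ∀ {n} (p : Fin n → Bool) → allᵇ p (allFin n) ≡ true → ∀ i → p i ≡ true
allᵇ-elim p h zero    = proj₁ (∧-true (trans (sym (allᵇ-allFin p)) h))
allᵇ-elim p h (suc i) = allᵇ-elim (p ∘ suc) (proj₂ (∧-true {p zero} (trans (sym (allᵇ-allFin p)) h))) i

allᵇ-intro : ∀ {A : Set} (p : A → Bool) → (∀ i → p i ≡ true) → ∀ L → allᵇ p L ≡ true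
allᵇ-intro p h []      = refl
allᵇ-intro p h (a ∷ L) = ∧-intro (h a) (allᵇ-intro p h L)

-- `twin` places its new vertex last, whereas `allFin` unfolds from the front.
allᵇ-last : ∀ {n} (p : Fin (suc n) → Bool) →
  allᵇ p (allFin (suc n)) ≡ allᵇ (p ∘ inject₁) (allFin n) ∧ p (fromℕ n)
allᵇ-last {zero}  p with p zero
... | true  = refl
... | false = refl
allᵇ-last {suc n} p = trans (allᵇ-allFin p) (trans (cong (p zero ∧_) (allᵇ-last (p ∘ suc)))
  (trans (sym (∧-assoc (p zero) _ _)) (cong (_∧ p (fromℕ (suc n))) (sym (allᵇ-allFin (p ∘ inject₁))))))

module _ {A : Set} where

  lookup-∷ʳ-inject₁ : ∀ {n} (κ : Vec A n) c i → lookup (κ ∷ʳ c) (inject₁ i) ≡ lookup κ i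
  lookup-∷ʳ-inject₁ (d ∷ κ) c zero    = refl
  lookup-∷ʳ-inject₁ (d ∷ κ) c (suc i) = lookup-∷ʳ-inject₁ κ c i

  lookup-∷ʳ-last : ∀ {n} (κ : Vec A n) c → lookup (κ ∷ʳ c) (fromℕ n) ≡ c
  lookup-∷ʳ-last []      c = refl
  lookup-∷ʳ-last (d ∷ κ) c = lookup-∷ʳ-last κ c

old?-inject₁ : ∀ {n} (i : Fin n) → old? (inject₁ i) ≡ just i
old?-inject₁ zero    = refl
old?-inject₁ (suc i) = cong (Maybe.map suc) (old?-inject₁ i)

old?-last : ∀ n → old? (fromℕ n) ≡ nothing
old?-last zero    = refl
old?-last (suc n) = cong (Maybe.map suc) (old?-last n)

module _ (G : Graph) (v : Fin (size G)) (adj-sym : ∀ u w → adj G u w ≡ adj G w u) {N : ℕ} where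

  private
    n : ℕ
    n = size G

  nearTwin : Vec (Fin N) n → Fin N → Fin n → Bool
  nearTwin κ c u = not (adj G u v ∨ (u ==ᶠ v)) ∨ neᵇ (lookup κ u) c

  -- `proper` runs over ordered pairs, so every edge at the new vertex is tested twice. Symmetry of
  -- adjacency and of equality identifies the two tests, and `absorb` drops the duplicate.
  proper-twin : ∀ (κ : Vec (Fin N) n) c →
    proper (twin G v) (κ ∷ʳ c) ≡ proper G κ ∧ allᵇ (nearTwin κ c) (allFin n)
  proper-twin κ c = trans (allᵇ-last (λ u → allᵇ (ok u) (allFin (suc n)))) (trans
    (cong₂ _∧_
      (trans (allᵇ-cong (λ u → trans (allᵇ-last (ok (inject₁ u)))
                                     (cong₂ _∧_ (allᵇ-cong (old-old u) (allFin n)) (old-new u))) (allFin n))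
             (allᵇ-∧ _ (nearTwin κ c) (allFin n)))
      (trans (allᵇ-last (ok (fromℕ n))) (cong₂ _∧_ (allᵇ-cong new-old (allFin n)) new-new)))
    (absorb (proper G κ) (allᵇ (nearTwin κ c) (allFin n))))
    where
    κ′ : Vec (Fin N) (suc n)
    κ′ = κ ∷ʳ c

    ok : Fin (suc n) → Fin (suc n) → Bool
    ok u w = not (adj (twin G v) u w) ∨ not (lookup κ′ u ==ᶠ lookup κ′ w)

    old-old : ∀ u w → ok (inject₁ u) (inject₁ w) ≡ not (adj G u w) ∨ not (lookup κ u ==ᶠ lookup κ w)
    old-old u w rewrite old?-inject₁ u | old?-inject₁ w | lookup-∷ʳ-inject₁ κ c u | lookup-∷ʳ-inject₁ κ c w = refl

    old-new : ∀ u → ok (inject₁ u) (fromℕ n) ≡ nearTwin κ c u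
    old-new u rewrite old?-inject₁ u | old?-last n | lookup-∷ʳ-inject₁ κ c u | lookup-∷ʳ-last κ c = refl

    new-old : ∀ u → ok (fromℕ n) (inject₁ u) ≡ nearTwin κ c u
    new-old u rewrite old?-inject₁ u | old?-last n | lookup-∷ʳ-inject₁ κ c u | lookup-∷ʳ-last κ c
      | adj-sym v u | ==ᶠ-sym c (lookup κ u) = refl

    new-new : ok (fromℕ n) (fromℕ n) ≡ true
    new-new rewrite old?-last n = refl

    absorb : ∀ a b → (a ∧ b) ∧ (b ∧ true) ≡ a ∧ b
    absorb true  true  = refl
    absorb true  false = refl
    absorb false b     = refl

chain-elim : ∀ {N n} (κ : Vec (Fin N) n) → chain κ ≡ true →
  ∀ u w → (suc (toℕ u) ≡ᵇ toℕ w) ≡ true → neᵇ (lookup κ u) (lookup κ w) ≡ true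
chain-elim (c ∷ d ∷ κ) h zero    (suc zero)    _ = proj₁ (∧-true h)
chain-elim (c ∷ d ∷ κ) h (suc u) (suc w)       q = chain-elim (d ∷ κ) (proj₂ (∧-true {neᵇ c d} h)) u w q

chain-intro : ∀ {N n} (κ : Vec (Fin N) n) →
  (∀ u w → (suc (toℕ u) ≡ᵇ toℕ w) ≡ true → neᵇ (lookup κ u) (lookup κ w) ≡ true) → chain κ ≡ true
chain-intro []          h = refl
chain-intro (c ∷ [])    h = refl
chain-intro (c ∷ d ∷ κ) h = ∧-intro (h zero (suc zero) refl) (chain-intro (d ∷ κ) λ u w → h (suc u) (suc w))

tadpole-sym : ∀ b u w → adj (tadpole 4 b) u w ≡ adj (tadpole 4 b) w u
tadpole-sym b u w = swap (suc (toℕ u) ≡ᵇ toℕ w) (suc (toℕ w) ≡ᵇ toℕ u)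
  ((toℕ u ≡ᵇ 0) ∧ (toℕ w ≡ᵇ 3)) ((toℕ w ≡ᵇ 0) ∧ (toℕ u ≡ᵇ 3))
  where
  swap : ∀ p q r s → p ∨ q ∨ r ∨ s ≡ q ∨ p ∨ s ∨ r
  swap true  true  r s = refl
  swap true  false r s = refl
  swap false true  r s = refl
  swap false false true  true  = refl
  swap false false true  false = refl
  swap false false false true  = refl
  swap false false false false = refl

-- Shown as an equivalence, since the number of vertices is variable. Adjacency is a disjunction of
-- the two orientations of a path edge and of the closing edge, and `edge` treats them one by one.
proper-tadpole : ∀ {b N} (c₁ c₂ c₃ c₄ : Fin N) (κ : Vec (Fin N) b) →
  let κ′ = c₁ ∷ c₂ ∷ c₃ ∷ c₄ ∷ κ in proper (tadpole 4 b) κ′ ≡ chain κ′ ∧ neᵇ c₁ c₄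
proper-tadpole {b} {N} c₁ c₂ c₃ c₄ κ = iff⇒≡
  (λ h → ∧-intro
    (chain-intro κ′ λ u w q → modus (separated h u w) (∨-left q))
    (separated h zero (suc (suc (suc zero)))))
  (λ h → allᵇ-intro _ (λ u → allᵇ-intro _ (λ w → imp (edge h u w)) (allFin (4 ℕ.+ b))) (allFin (4 ℕ.+ b)))
  where
  κ′ : Vec (Fin N) (4 ℕ.+ b)
  κ′ = c₁ ∷ c₂ ∷ c₃ ∷ c₄ ∷ κ

  ok : Fin (4 ℕ.+ b) → Fin (4 ℕ.+ b) → Bool
  ok u w = not (adj (tadpole 4 b) u w) ∨ not (lookup κ′ u ==ᶠ lookup κ′ w)

  separated : proper (tadpole 4 b) κ′ ≡ true → ∀ u w → ok u w ≡ true
  separated h u = allᵇ-elim (ok u) (allᵇ-elim (λ u → allᵇ (ok u) (allFin (4 ℕ.+ b))) h u)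

  ∨-left : ∀ {a c} → a ≡ true → a ∨ c ≡ true
  ∨-left refl = refl

  modus : ∀ {a c} → not a ∨ c ≡ true → a ≡ true → c ≡ true
  modus p refl = p

  imp : ∀ {a c} → (a ≡ true → c ≡ true) → not a ∨ c ≡ true
  imp {true}  f = f refl
  imp {false} f = refl

  closing : ∀ u w → neᵇ c₁ c₄ ≡ true → (toℕ u ≡ᵇ 0) ∧ (toℕ w ≡ᵇ 3) ≡ true → neᵇ (lookup κ′ u) (lookup κ′ w) ≡ true
  closing zero (suc (suc (suc zero))) h _ = h

  flipped : ∀ u w → neᵇ (lookup κ′ w) (lookup κ′ u) ≡ true → neᵇ (lookup κ′ u) (lookup κ′ w) ≡ true
  flipped u w = trans (neᵇ-sym (lookup κ′ u) (lookup κ′ w))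

  edge : chain κ′ ∧ neᵇ c₁ c₄ ≡ true → ∀ u w → adj (tadpole 4 b) u w ≡ true → neᵇ (lookup κ′ u) (lookup κ′ w) ≡ true
  edge h u w p with ∧-true {chain κ′} h | ∨-true (suc (toℕ u) ≡ᵇ toℕ w) p
  ... | hc , h₁₄ | inj₁ q = chain-elim κ′ hc u w q
  ... | hc , h₁₄ | inj₂ p′ with ∨-true (suc (toℕ w) ≡ᵇ toℕ u) p′
  ...   | inj₁ q = flipped u w (chain-elim κ′ hc w u q)
  ...   | inj₂ p″ with ∨-true ((toℕ u ≡ᵇ 0) ∧ (toℕ w ≡ᵇ 3)) p″
  ...     | inj₁ q = closing u w h₁₄ q
  ...     | inj₂ q = flipped u w (closing w u h₁₄ q)

proper-TwinTad : ∀ {n N} (c₁ c₂ c₃ p d : Fin N) (κ : Vec (Fin N) n) (q : Fin N) →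
  proper (TwinTad (suc n)) ((c₁ ∷ c₂ ∷ c₃ ∷ p ∷ d ∷ κ) ∷ʳ q)
    ≡ (chain (c₁ ∷ c₂ ∷ c₃ ∷ p ∷ d ∷ κ) ∧ neᵇ c₁ p) ∧ (neᵇ c₁ q ∧ (neᵇ c₃ q ∧ (neᵇ p q ∧ neᵇ d q)))
proper-TwinTad {n} {N} c₁ c₂ c₃ p d κ q = trans
  (proper-twin (tadpole 4 (suc n)) v₄ (tadpole-sym (suc n)) κ′ q)
  (cong₂ _∧_ (proper-tadpole c₁ c₂ c₃ p (d ∷ κ))
    (trans (allᵇ-allFin near) (cong (neᵇ c₁ q ∧_)
      -- The factor of `v₂` computes to `true` and disappears; so do, below, the factors of the tail
      -- vertices after the first.
      (trans (allᵇ-allFin (near ∘ suc)) (trans (allᵇ-allFin (λ i → near (suc (suc i)))) (cong (neᵇ c₃ q ∧_)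
        (trans (allᵇ-allFin (λ i → near (suc (suc (suc i))))) (cong (neᵇ p q ∧_)
          (trans (allᵇ-allFin (λ i → near (suc (suc (suc (suc i))))))
            (trans (cong (neᵇ d q ∧_) (allᵇ-intro (λ i → near (suc (suc (suc (suc (suc i)))))) (λ _ → refl) (allFin n)))
                   (∧-identityʳ (neᵇ d q))))))))))))
  where
  κ′ : Vec (Fin N) (5 ℕ.+ n)
  κ′ = c₁ ∷ c₂ ∷ c₃ ∷ p ∷ d ∷ κ
  near : Fin (5 ℕ.+ n) → Bool
  near = nearTwin (tadpole 4 (suc n)) v₄ (tadpole-sym (suc n)) κ′ q

-- The chromatic sum of the twinned tadpole, separated at `v₄` and its twin.

module VecSums (R : CommutativeRing 0ℓ 0ℓ) where
  open RingKit R

  ∑-allVecs : ∀ {A : Set} (L : List A) n (f : Vec A (suc n) → Carrier) →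
    ∑ (allVecs L (suc n)) f ≈ ∑ L (λ c → ∑ (allVecs L n) (λ κ → f (c ∷ κ)))
  ∑-allVecs L n f = ≈-trans (∑-concatMap L _ f) (∑-cong L λ c → ∑-map (allVecs L n) (c ∷_) f)

  ∑-allVecs-∷ʳ : ∀ {A : Set} (L : List A) n (f : Vec A (suc n) → Carrier) →
    ∑ (allVecs L (suc n)) f ≈ ∑ (allVecs L n) (λ κ → ∑ L (λ c → f (κ ∷ʳ c)))
  ∑-allVecs-∷ʳ L zero    f = ≈-trans (∑-allVecs L zero f)
    (≈-trans (∑-cong L λ c → +-identityʳ _) (≈-sym (+-identityʳ _)))
  ∑-allVecs-∷ʳ L (suc n) f = ≈-trans (∑-allVecs L (suc n) f)
    (≈-trans (∑-cong L λ c → ∑-allVecs-∷ʳ L n (λ κ → f (c ∷ κ)))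
             (≈-sym (∑-allVecs L n (λ κ → ∑ L (λ c → f (κ ∷ʳ c))))))

module TwinTadpole (R : CommutativeRing 0ℓ 0ℓ) {N : ℕ} (x : Fin N → CommutativeRing.Carrier R) where
  open RingKit R
  open VecSums R
  open Symmetric R

  Σᶜ : (Fin N → Carrier) → Carrier
  Σᶜ = ∑ (allFin N)

  Σᶜ-cong : ∀ {f g : Fin N → Carrier} → (∀ c → f c ≈ g c) → Σᶜ f ≈ Σᶜ g
  Σᶜ-cong = ∑-cong (allFin N)

  Δ : ∀ {N} → Fin N → Fin N → Carrier
  Δ c d = [ c ==ᶠ d ]ᵇ

  ne : Fin N → Fin N → Carrier
  ne c d = [ neᵇ c d ]ᵇ

  ne-Δ : ∀ c d → ne c d ≈ 1# - Δ c d
  ne-Δ c d with c ==ᶠ d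
  ... | true  = ≈-sym (-‿inverseʳ 1#)
  ... | false = solve 0 (con 1ℤ := con 1ℤ :- con (+ 0)) ≈-refl

  ∑-Δ : ∀ {N} s (f : Fin N → Carrier) → ∑ (allFin N) (λ c → Δ c s * f c) ≈ f s
  ∑-Δ {suc N} zero f = ≈-trans (∑-allFin (λ c → Δ c zero * f c)) (≈-trans
    (+-cong (*-identityˡ _) (≈-trans (∑-cong (allFin N) λ c → zeroˡ _) (∑-0 (allFin N))))
    (+-identityʳ _))
  ∑-Δ {suc N} (suc s) f = ≈-trans (∑-allFin (λ c → Δ c (suc s) * f c)) (≈-trans
    (+-cong (zeroˡ _) (≈-trans (∑-cong (allFin N) λ c → *-congʳ (reflexive (cong [_]ᵇ (suc-==ᶠ c s))))
                               (∑-Δ s (f ∘ suc))))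
    (+-identityˡ _))

  ∑-minus : ∀ {A : Set} (L : List A) (f g : A → Carrier) → ∑ L (λ a → f a - g a) ≈ ∑ L f - ∑ L g
  ∑-minus L f g = ≈-trans (∑-+ L f _) (+-congˡ (∑-neg L g))

  ∑-ne : ∀ s (f : Fin N → Carrier) → Σᶜ (λ c → ne c s * f c) ≈ Σᶜ f - f s
  ∑-ne s f = ≈-trans
    (Σᶜ-cong λ c → ≈-trans (*-congʳ (ne-Δ c s))
      (solve 2 (λ d y → (con 1ℤ :- d) :* y := y :- d :* y) ≈-refl (Δ c s) (f c)))
    (≈-trans (∑-minus (allFin N) f _) (+-congˡ (-‿cong (∑-Δ s f))))

  ne-sym : ∀ c d → ne c d ≈ ne d c
  ne-sym c d = reflexive (cong [_]ᵇ (neᵇ-sym c d))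

  -- W n c sums over the proper colourings of the path with n + 1 vertices
  -- whose first vertex has colour c.
  W : ℕ → Fin N → Carrier
  W zero    c = x c
  W (suc n) c = x c * (Σᶜ (W n) - W n c)

  path-sum : ∀ n c →
    ∑ (allVecs (allFin N) n) (λ κ → [ chain (c ∷ κ) ]ᵇ * prod x (c ∷ κ)) ≈ W n c
  path-sum zero    c = solve 1 (λ y → con 1ℤ :* (y :* con 1ℤ) :+ con (+ 0) := y) ≈-refl (x c)
  path-sum (suc n) c = begin
    ∑ (allVecs (allFin N) (suc n)) (λ κ → [ chain (c ∷ κ) ]ᵇ * prod x (c ∷ κ))
      ≈⟨ ∑-allVecs (allFin N) n _ ⟩
    Σᶜ (λ d → ∑ (allVecs (allFin N) n) (λ κ → [ neᵇ c d ∧ chain (d ∷ κ) ]ᵇ * (x c * prod x (d ∷ κ))))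
      ≈⟨ Σᶜ-cong (λ d → ≈-trans
           (∑-cong (allVecs (allFin N) n) λ κ → ≈-trans (*-congʳ ([]ᵇ-∧ (neᵇ c d) _))
             (solve 4 (λ a b y z → (a :* b) :* (y :* z) := y :* a :* (b :* z)) ≈-refl (ne c d) _ (x c) _))
           (∑-*ˡ (allVecs (allFin N) n) (x c * ne c d) _)) ⟩
    Σᶜ (λ d → (x c * ne c d) * ∑ (allVecs (allFin N) n) (λ κ → [ chain (d ∷ κ) ]ᵇ * prod x (d ∷ κ)))
      ≈⟨ Σᶜ-cong (λ d → ≈-trans (*-cong (*-congˡ (ne-sym c d)) (path-sum n d)) (*-assoc _ _ _)) ⟩
    Σᶜ (λ d → x c * (ne d c * W n d))
      ≈⟨ ∑-*ˡ (allFin N) (x c) _ ⟩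
    x c * Σᶜ (λ d → ne d c * W n d)
      ≈⟨ *-congˡ (∑-ne c (W n)) ⟩
    x c * (Σᶜ (W n) - W n c) ∎

  prod-∷ʳ : ∀ {n} (κ : Vec (Fin N) n) c → prod x (κ ∷ʳ c) ≈ prod x κ * x c
  prod-∷ʳ []      c = *-comm _ _
  prod-∷ʳ (d ∷ κ) c = ≈-trans (*-congˡ (prod-∷ʳ κ c)) (≈-sym (*-assoc _ _ _))

  p₁ p₂ p₃ : Carrier
  p₁ = Σᶜ x
  p₂ = Σᶜ (λ c → x c * x c)
  p₃ = Σᶜ (λ c → x c * (x c * x c))

  u : Fin N → Fin N → Carrier
  u p q = p₁ - x p - x q

  private
    -- The contribution of `v₁` when `v₂` has colour `s` and `v₄` and its twin have colours `p` and
    -- `q`. By symmetry it is also that of `v₃`.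
    avoid : Fin N → Fin N → Fin N → Carrier
    avoid s p q = Σᶜ (λ c → (ne c s * (ne c p * ne c q)) * x c)

  -- A p q sums over the colourings of v₁, v₂, v₃ when v₄ and its twin have
  -- the distinct colours p and q.
  A : Fin N → Fin N → Carrier
  A p q = (((p₁ * u p q) * u p q - ((p₂ + p₂) * u p q)) + p₃)
          + (((x p * (x p * (u p q + u p q))) - x p * (x p * x p))
            + ((x q * (x q * (u p q + u p q))) - x q * (x q * x q)))

  tail : ℕ → Fin N → Fin N → Carrier
  tail n p q = Σᶜ (W n) - W n p - W n q

  private
    module _ (p q : Fin N) (p≢q : p ≢ q) where

      ΔΔ : ∀ c → Δ c p * Δ c q ≈ 0#
      ΔΔ c with c ≟ p | c ≟ q
      ... | yes refl | yes refl = contradiction refl p≢q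
      ... | yes _    | no _     = zeroʳ _
      ... | no _     | yes _    = zeroˡ _
      ... | no _     | no _     = zeroˡ _

      Δ-idem : ∀ (c d : Fin N) → Δ c d * Δ c d ≈ Δ c d
      Δ-idem c d with c ==ᶠ d
      ... | true  = *-identityˡ _
      ... | false = zeroˡ _

      ν : Fin N → Carrier
      ν c = 1# - Δ c p - Δ c q

      -- For `p ≢ q` the cross term `Δ c p * Δ c q` vanishes. The indicator becomes linear in the
      -- deltas, so sums against it collapse by `∑-Δ`.
      ne-ne : ∀ c → ne c p * ne c q ≈ ν c
      ne-ne c = ≈-trans (*-cong (ne-Δ c p) (ne-Δ c q)) (≈-trans
        (solve 2 (λ a b → (con 1ℤ :- a) :* (con 1ℤ :- b) := (con 1ℤ :- a :- b) :+ a :* b) ≈-refl (Δ c p) (Δ c q))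
        (≈-trans (+-congˡ (ΔΔ c)) (+-identityʳ _)))

      ν-idem : ∀ c → ν c * ν c ≈ ν c
      ν-idem c = begin
        ν c * ν c
          ≈⟨ solve 2 (λ a b → (con 1ℤ :- a :- b) :* (con 1ℤ :- a :- b)
               := (con 1ℤ :- (a :+ a) :- (b :+ b)) :+ (a :* a :+ b :* b) :+ (a :* b :+ a :* b)) ≈-refl (Δ c p) (Δ c q) ⟩
        (1# - (Δ c p + Δ c p) - (Δ c q + Δ c q)) + (Δ c p * Δ c p + Δ c q * Δ c q) + (Δ c p * Δ c q + Δ c p * Δ c q)
          ≈⟨ +-cong (+-congˡ (+-cong (Δ-idem c p) (Δ-idem c q))) (+-cong (ΔΔ c) (ΔΔ c)) ⟩
        (1# - (Δ c p + Δ c p) - (Δ c q + Δ c q)) + (Δ c p + Δ c q) + (0# + 0#)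
          ≈⟨ solve 2 (λ a b → (con 1ℤ :- (a :+ a) :- (b :+ b)) :+ (a :+ b) :+ (con (+ 0) :+ con (+ 0))
               := con 1ℤ :- a :- b) ≈-refl (Δ c p) (Δ c q) ⟩
        ν c ∎

      ∑-ν : ∀ (f : Fin N → Carrier) → Σᶜ (λ c → ν c * f c) ≈ Σᶜ f - f p - f q
      ∑-ν f = ≈-trans
        (Σᶜ-cong λ c → solve 3 (λ a b y → (con 1ℤ :- a :- b) :* y := (y :- a :* y) :- b :* y) ≈-refl (Δ c p) (Δ c q) (f c))
        (≈-trans (∑-minus (allFin N) _ _) (+-cong
          (≈-trans (∑-minus (allFin N) _ _) (+-congˡ (-‿cong (∑-Δ p f)))) (-‿cong (∑-Δ q f))))

      avoid-≈ : ∀ s → avoid s p q ≈ u p q - ν s * x s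
      avoid-≈ s = ≈-trans
        (Σᶜ-cong λ c → ≈-trans (*-congʳ (*-congˡ (ne-ne c))) (*-assoc _ _ _))
        (≈-trans (∑-ne s (λ c → ν c * x c)) (+-congʳ (∑-ν x)))

      -- `v₁` and `v₃` are not adjacent, so for a fixed colour `s` of `v₂` they contribute a square.
      -- Since `v₂` may itself have colour `p` or `q`, the correction `x s` in `avoid-≈` carries
      -- `ν s`; as `ν` is idempotent, the square stays linear in `ν` and `∑-ν` evaluates the sum.
      cycle-part : Σᶜ (λ s → x s * (avoid s p q * avoid s p q)) ≈ A p q
      cycle-part = begin
        Σᶜ (λ s → x s * (avoid s p q * avoid s p q))
          ≈⟨ Σᶜ-cong (λ s → ≈-trans (*-congˡ (*-cong (avoid-≈ s) (avoid-≈ s))) (expand s)) ⟩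
        Σᶜ (λ s → (U * U) * x s + ν s * g s)
          ≈⟨ ≈-trans (∑-+ (allFin N) _ _) (+-cong (∑-*ˡ (allFin N) (U * U) x) (∑-ν g)) ⟩
        (U * U) * p₁ + (Σᶜ g - g p - g q)
          ≈⟨ +-congˡ (+-congʳ (+-congʳ (≈-trans (∑-minus (allFin N) _ _) (+-congˡ (-‿cong (∑-*ˡ (allFin N) (U + U) _)))))) ⟩
        (U * U) * p₁ + ((p₃ - (U + U) * p₂) - g p - g q)
          ≈⟨ solve 6 (λ U P₁ P₂ P₃ a b →
               (U :* U) :* P₁ :+ ((P₃ :- (U :+ U) :* P₂)
                 :- (a :* (a :* a) :- (U :+ U) :* (a :* a)) :- (b :* (b :* b) :- (U :+ U) :* (b :* b)))
               := (((P₁ :* U) :* U :- (P₂ :+ P₂) :* U) :+ P₃)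
                  :+ ((a :* (a :* (U :+ U)) :- a :* (a :* a)) :+ (b :* (b :* (U :+ U)) :- b :* (b :* b))))
               ≈-refl U p₁ p₂ p₃ (x p) (x q) ⟩
        A p q ∎
        where
        U : Carrier
        U = u p q
        g : Fin N → Carrier
        g s = x s * (x s * x s) - (U + U) * (x s * x s)
        expand : ∀ s → x s * ((U - ν s * x s) * (U - ν s * x s)) ≈ (U * U) * x s + ν s * g s
        expand s = begin
          x s * ((U - ν s * x s) * (U - ν s * x s))
            ≈⟨ solve 3 (λ U n y → y :* ((U :- n :* y) :* (U :- n :* y))
                 := (U :* U) :* y :+ ((n :* n) :* (y :* (y :* y)) :- n :* ((U :+ U) :* (y :* y)))) ≈-refl U (ν s) (x s) ⟩
          (U * U) * x s + ((ν s * ν s) * (x s * (x s * x s)) - ν s * ((U + U) * (x s * x s)))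
            ≈⟨ +-congˡ (+-congʳ (*-congʳ (ν-idem s))) ⟩
          (U * U) * x s + (ν s * (x s * (x s * x s)) - ν s * ((U + U) * (x s * x s)))
            ≈⟨ +-congˡ (solve 3 (λ n y z → n :* y :- n :* z := n :* (y :- z)) ≈-refl (ν s) _ _) ⟩
          (U * U) * x s + ν s * g s ∎

      tail-part : ∀ n → Σᶜ (λ d → (ne d p * ne d q) * W n d) ≈ tail n p q
      tail-part n = ≈-trans (Σᶜ-cong λ d → *-congʳ (ne-ne d)) (∑-ν (W n))

  summand : ℕ → Fin N → Fin N → Carrier
  summand n p q = ne p q * (((x p * x q) * tail n p q) * A p q)

  private
    -- All factors without a tail vertex. The colours `c₁` and `c₃` enter through identical factors,
    -- so that summing over both yields the square of `avoid`.
    K : Fin N → Fin N → Fin N → Fin N → Fin N → Carrier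
    K c₁ c₂ c₃ p q = (ne p q * (x p * x q)) *
      (x c₂ * (((ne c₁ c₂ * (ne c₁ p * ne c₁ q)) * x c₁) * ((ne c₃ c₂ * (ne c₃ p * ne c₃ q)) * x c₃)))

    pointwise : ∀ {n} c₁ c₂ c₃ p d (κ : Vec (Fin N) n) q →
      [ proper (TwinTad (suc n)) ((c₁ ∷ c₂ ∷ c₃ ∷ p ∷ d ∷ κ) ∷ʳ q) ]ᵇ * prod x ((c₁ ∷ c₂ ∷ c₃ ∷ p ∷ d ∷ κ) ∷ʳ q)
      ≈ (K c₁ c₂ c₃ p q * (ne d p * ne d q)) * ([ chain (d ∷ κ) ]ᵇ * prod x (d ∷ κ))
    pointwise {n} c₁ c₂ c₃ p d κ q = begin
      [ proper (TwinTad (suc n)) ((c₁ ∷ c₂ ∷ c₃ ∷ p ∷ d ∷ κ) ∷ʳ q) ]ᵇ * prod x ((c₁ ∷ c₂ ∷ c₃ ∷ p ∷ d ∷ κ) ∷ʳ q)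
        ≈⟨ *-cong (≈-trans (reflexive (cong [_]ᵇ (proper-TwinTad c₁ c₂ c₃ p d κ q)))
             (≈-trans ([]ᵇ-∧ (chain (c₁ ∷ c₂ ∷ c₃ ∷ p ∷ d ∷ κ) ∧ neᵇ c₁ p) _) (*-cong
               (≈-trans ([]ᵇ-∧ (chain (c₁ ∷ c₂ ∷ c₃ ∷ p ∷ d ∷ κ)) (neᵇ c₁ p)) (*-congʳ
                 (≈-trans ([]ᵇ-∧ (neᵇ c₁ c₂) _) (*-congˡ (≈-trans ([]ᵇ-∧ (neᵇ c₂ c₃) _)
                   (*-cong (ne-sym c₂ c₃) (≈-trans ([]ᵇ-∧ (neᵇ c₃ p) _) (*-congˡ (≈-trans ([]ᵇ-∧ (neᵇ p d) _)
                     (*-congʳ (ne-sym p d)))))))))))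
               (≈-trans ([]ᵇ-∧ (neᵇ c₁ q) _) (*-congˡ (≈-trans ([]ᵇ-∧ (neᵇ c₃ q) _)
                 (*-congˡ ([]ᵇ-∧ (neᵇ p q) _))))))))
             (prod-∷ʳ (c₁ ∷ c₂ ∷ c₃ ∷ p ∷ d ∷ κ) q) ⟩
      ((ne c₁ c₂ * (ne c₃ c₂ * (ne c₃ p * (ne d p * ch)))) * ne c₁ p * (ne c₁ q * (ne c₃ q * (ne p q * ne d q))))
        * ((x c₁ * (x c₂ * (x c₃ * (x p * pr)))) * x q)
        ≈⟨ *-congˡ (solve 6 (λ a b c d f g → (a :* (b :* (c :* (d :* f)))) :* g := ((b :* (a :* c)) :* (d :* g)) :* f)
             ≈-refl (x c₁) (x c₂) (x c₃) (x p) pr (x q)) ⟩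
      ((ne c₁ c₂ * (ne c₃ c₂ * (ne c₃ p * (ne d p * ch)))) * ne c₁ p * (ne c₁ q * (ne c₃ q * (ne p q * ne d q))))
        * (((x c₂ * (x c₁ * x c₃)) * (x p * x q)) * pr)
        ≈⟨ *-congʳ (≈-trans
             (*-congˡ (solve 4 (λ a b c d → a :* (b :* (c :* d)) := (c :* d) :* (a :* b)) ≈-refl
               (ne c₁ q) (ne c₃ q) (ne p q) (ne d q)))
             (solve 9 (λ a b c d f g h i j →
               ((a :* (b :* (c :* (d :* f)))) :* g) :* ((h :* i) :* j)
               := ((h :* (a :* g :* b :* c)) :* (d :* i) :* f) :* j)
              ≈-refl (ne c₁ c₂) (ne c₃ c₂) (ne c₃ p) (ne d p) ch (ne c₁ p) (ne p q) (ne d q) (ne c₁ q * ne c₃ q))) ⟩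
      (((ne p q * (ne c₁ c₂ * ne c₁ p * ne c₃ c₂ * ne c₃ p)) * (ne d p * ne d q) * ch) * (ne c₁ q * ne c₃ q))
        * (((x c₂ * (x c₁ * x c₃)) * (x p * x q)) * pr)
        ≈⟨ solve 9 (λ pq B D ch E x₂ x₁₃ xx pr →
             (((pq :* B) :* D :* ch) :* E) :* (((x₂ :* x₁₃) :* xx) :* pr)
             := (((pq :* xx) :* (x₂ :* ((B :* E) :* x₁₃))) :* D) :* (ch :* pr)) ≈-refl
             (ne p q) (ne c₁ c₂ * ne c₁ p * ne c₃ c₂ * ne c₃ p) (ne d p * ne d q) ch (ne c₁ q * ne c₃ q)
             (x c₂) (x c₁ * x c₃) (x p * x q) pr ⟩
      (((ne p q * (x p * x q)) * (x c₂ * (((ne c₁ c₂ * ne c₁ p * ne c₃ c₂ * ne c₃ p) * (ne c₁ q * ne c₃ q)) * (x c₁ * x c₃))))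
         * (ne d p * ne d q)) * (ch * pr)
        ≈⟨ *-congʳ (*-congʳ (*-congˡ (*-congˡ (solve 8 (λ a b c d e f y z →
             ((a :* b :* c :* d) :* (e :* f)) :* (y :* z) := ((a :* (b :* e)) :* y) :* ((c :* (d :* f)) :* z)) ≈-refl
             (ne c₁ c₂) (ne c₁ p) (ne c₃ c₂) (ne c₃ p) (ne c₁ q) (ne c₃ q) (x c₁) (x c₃))))) ⟩
      (K c₁ c₂ c₃ p q * (ne d p * ne d q)) * (ch * pr) ∎
      where
      ch pr : Carrier
      ch = [ chain (d ∷ κ) ]ᵇ
      pr = prod x (d ∷ κ)

    Ks : Fin N → Fin N → Carrier
    Ks p q = Σᶜ (λ s → x s * (avoid s p q * avoid s p q))

    Hs : ℕ → Fin N → Fin N → Carrier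
    Hs n p q = Σᶜ (λ d → (ne d p * ne d q) * W n d)

    ∑-K : ∀ p q → Σᶜ (λ c₁ → Σᶜ (λ c₂ → Σᶜ (λ c₃ → K c₁ c₂ c₃ p q))) ≈ (ne p q * (x p * x q)) * Ks p q
    ∑-K p q = ≈-trans (∑-swap (allFin N) (allFin N) _) (≈-trans
      (Σᶜ-cong λ c₂ → ≈-trans
        (Σᶜ-cong λ c₁ → ≈-trans (∑-*ˡ (allFin N) _ _) (*-congˡ (≈-trans (∑-*ˡ (allFin N) _ _) (*-congˡ (∑-*ˡ (allFin N) _ _)))))
        (≈-trans (∑-*ˡ (allFin N) _ _) (*-congˡ (≈-trans (∑-*ˡ (allFin N) _ _) (*-congˡ (∑-*ʳ (allFin N) _ _))))))
      (∑-*ˡ (allFin N) _ _))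

    tail-sums : ∀ n c₁ c₂ c₃ p →
      Σᶜ (λ d → ∑ (allVecs (allFin N) n) (λ κ → Σᶜ (λ q →
        (K c₁ c₂ c₃ p q * (ne d p * ne d q)) * ([ chain (d ∷ κ) ]ᵇ * prod x (d ∷ κ)))))
      ≈ Σᶜ (λ q → K c₁ c₂ c₃ p q * Hs n p q)
    tail-sums n c₁ c₂ c₃ p = ≈-trans (Σᶜ-cong λ d → ∑-swap (allVecs (allFin N) n) (allFin N) _) (≈-trans
      (∑-swap (allFin N) (allFin N) _)
      (Σᶜ-cong λ q → ≈-trans
        (Σᶜ-cong λ d → ≈-trans (∑-*ˡ (allVecs (allFin N) n) _ _) (≈-trans (*-congˡ (path-sum n d)) (*-assoc _ _ _)))
        (∑-*ˡ (allFin N) (K c₁ c₂ c₃ p q) _)))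

    -- The evaluations of the cycle and of the tail require distinct colours; on the diagonal both
    -- sides vanish through `ne p q`.
    pair : ∀ n p q → ((ne p q * (x p * x q)) * Ks p q) * Hs n p q ≈ summand n p q
    pair n p q with p ≟ q
    ... | yes _  = ≈-trans (*-congʳ (≈-trans (*-congʳ (zeroˡ _)) (zeroˡ _))) (≈-trans (zeroˡ _) (≈-sym (zeroˡ _)))
    ... | no p≢q = ≈-trans (*-cong (*-congˡ (cycle-part p q p≢q)) (tail-part p q p≢q n))
      (solve 3 (λ y a t → ((con 1ℤ :* y) :* a) :* t := con 1ℤ :* ((y :* t) :* a)) ≈-refl (x p * x q) (A p q) (tail n p q))

  X-TwinTad : ∀ n → X (TwinTad (suc n)) x ≈ Σᶜ (λ p → Σᶜ (λ q → summand n p q))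
  X-TwinTad n = begin
    X (TwinTad (suc n)) x
      ≈⟨ ∑-allVecs-∷ʳ (allFin N) (5 ℕ.+ n) _ ⟩
    ∑ (allVecs (allFin N) (5 ℕ.+ n)) _
      ≈⟨ ≈-trans (∑-allVecs (allFin N) (4 ℕ.+ n) _) (Σᶜ-cong λ c₁ →
         ≈-trans (∑-allVecs (allFin N) (3 ℕ.+ n) _) (Σᶜ-cong λ c₂ →
         ≈-trans (∑-allVecs (allFin N) (2 ℕ.+ n) _) (Σᶜ-cong λ c₃ →
         ≈-trans (∑-allVecs (allFin N) (1 ℕ.+ n) _) (Σᶜ-cong λ p →
         ≈-trans (∑-allVecs (allFin N) n _) (≈-trans (Σᶜ-cong λ d →
           ∑-cong (allVecs (allFin N) n) λ κ → Σᶜ-cong λ q → pointwise c₁ c₂ c₃ p d κ q)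
         (tail-sums n c₁ c₂ c₃ p)))))) ⟩
    Σᶜ (λ c₁ → Σᶜ (λ c₂ → Σᶜ (λ c₃ → Σᶜ (λ p → Σᶜ (λ q → K c₁ c₂ c₃ p q * Hs n p q)))))
      ≈⟨ Σᶜ-cong (λ c₁ → Σᶜ-cong λ c₂ → out _) ⟩
    Σᶜ (λ c₁ → Σᶜ (λ c₂ → Σᶜ (λ p → Σᶜ (λ q → Σᶜ (λ c₃ → K c₁ c₂ c₃ p q * Hs n p q)))))
      ≈⟨ Σᶜ-cong (λ c₁ → out _) ⟩
    Σᶜ (λ c₁ → Σᶜ (λ p → Σᶜ (λ q → Σᶜ (λ c₂ → Σᶜ (λ c₃ → K c₁ c₂ c₃ p q * Hs n p q)))))
      ≈⟨ out _ ⟩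
    Σᶜ (λ p → Σᶜ (λ q → Σᶜ (λ c₁ → Σᶜ (λ c₂ → Σᶜ (λ c₃ → K c₁ c₂ c₃ p q * Hs n p q)))))
      ≈⟨ Σᶜ-cong (λ p → Σᶜ-cong λ q → ≈-trans
           (≈-trans (Σᶜ-cong λ c₁ → ≈-trans (Σᶜ-cong λ c₂ → ∑-*ʳ (allFin N) _ _) (∑-*ʳ (allFin N) _ _)) (∑-*ʳ (allFin N) _ _))
           (≈-trans (*-congʳ (∑-K p q)) (pair n p q))) ⟩
    Σᶜ (λ p → Σᶜ (λ q → summand n p q)) ∎
    where
    out : ∀ (f : Fin N → Fin N → Fin N → Carrier) →
      Σᶜ (λ c → Σᶜ (λ p → Σᶜ (f c p))) ≈ Σᶜ (λ p → Σᶜ (λ q → Σᶜ (λ c → f c p q)))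
    out f = ≈-trans (∑-swap (allFin N) (allFin N) _) (Σᶜ-cong λ p → ∑-swap (allFin N) (allFin N) _)

-- Newton's identities through hook-type sums.

module Newton (R : CommutativeRing 0ℓ 0ℓ) where
  open RingKit R
  open Symmetric R

  pw : ∀ {N} → ℕ → (Fin N → Carrier) → Carrier
  pw {N} i x = ∑ (allFin N) (λ c → x c ^ i)

  -- S r i x is the sum of all x^T · x_c^i with |T| = r and c ∉ T.
  S : ℕ → ℕ → ∀ {N} → (Fin N → Carrier) → Carrier
  S r       i {zero}  x = 0#
  S zero    i {suc N} x = S zero i (x ∘ suc) + x zero ^ i
  S (suc r) i {suc N} x = S (suc r) i (x ∘ suc) + (x zero * S r i (x ∘ suc) + x zero ^ i * e (suc r) (x ∘ suc))

  S-pw : ∀ i {N} (x : Fin N → Carrier) → S 0 i x ≈ pw i x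
  S-pw i {zero}  x = ≈-refl
  S-pw i {suc N} x = ≈-trans (+-congʳ (S-pw i (x ∘ suc))) (≈-trans (+-comm _ _) (≈-sym (∑-allFin (λ c → x c ^ i))))

  -- A set of `r + 1` variables arises as `T` together with `c` in `r + 1` ways, one for each choice
  -- of `c`.
  S-e : ∀ r {N} (x : Fin N → Carrier) → S r 1 x ≈ ⟦ + suc r ⟧ * e (suc r) x
  S-e r       {zero}  x = ≈-sym (zeroʳ _)
  S-e zero    {suc N} x = ≈-trans (+-congʳ (S-e zero (x ∘ suc)))
    (solve 2 (λ a y → con 1ℤ :* a :+ y :* con 1ℤ := con 1ℤ :* (a :+ y :* con 1ℤ)) ≈-refl (e 1 (x ∘ suc)) (x zero))
  S-e (suc r) {suc N} x = begin
    S (suc r) 1 x′ + (x zero * S r 1 x′ + x zero ^ 1 * e (suc r) x′)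
      ≈⟨ +-cong (S-e (suc r) x′) (+-congʳ (*-congˡ (S-e r x′))) ⟩
    ⟦ + suc (suc r) ⟧ * e (suc (suc r)) x′ + (x zero * (⟦ + suc r ⟧ * e (suc r) x′) + x zero ^ 1 * e (suc r) x′)
      ≈⟨ +-congʳ (*-congʳ (1+× (suc r) 1#)) ⟩
    (1# + ⟦ + suc r ⟧) * e (suc (suc r)) x′ + (x zero * (⟦ + suc r ⟧ * e (suc r) x′) + x zero ^ 1 * e (suc r) x′)
      ≈⟨ solve 4 (λ k a b y → (con 1ℤ :+ k) :* a :+ (y :* (k :* b) :+ (y :* con 1ℤ) :* b)
           := (con 1ℤ :+ k) :* (a :+ y :* b)) ≈-refl ⟦ + suc r ⟧ _ _ (x zero) ⟩
    (1# + ⟦ + suc r ⟧) * e (suc (suc r)) x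
      ≈⟨ *-congʳ (≈-sym (1+× (suc r) 1#)) ⟩
    ⟦ + suc (suc r) ⟧ * e (suc (suc r)) x ∎
    where
    x′ : Fin N → Carrier
    x′ = x ∘ suc

  -- Expand `e (suc r) x * pw i x` as a sum over sets `T` of size `r + 1` and variables `c`. The
  -- pairs with `c ∈ T` give `S r (suc i)` once `c` is taken out of `T`, and those with `c ∉ T` give
  -- `S (suc r) i`.
  newton : ∀ r i {N} (x : Fin N → Carrier) → S r (suc i) x ≈ e (suc r) x * pw i x - S (suc r) i x
  newton r i {zero} x = solve 0 (con (+ 0) := con (+ 0) :* con (+ 0) :- con (+ 0)) ≈-refl
  newton zero i {suc N} x = begin
    S 0 (suc i) x′ + x zero ^ suc i
      ≈⟨ +-congʳ (newton 0 i x′) ⟩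
    (e 1 x′ * pw i x′ - S 1 i x′) + x zero ^ suc i
      ≈⟨ solve 5 (λ a p s y z → (a :* p :- s) :+ y :* z
           := (a :+ y :* con 1ℤ) :* (z :+ p) :- (s :+ (y :* p :+ z :* a))) ≈-refl (e 1 x′) (pw i x′) (S 1 i x′) (x zero) (x zero ^ i) ⟩
    e 1 x * (x zero ^ i + pw i x′) - (S 1 i x′ + (x zero * pw i x′ + x zero ^ i * e 1 x′))
      ≈⟨ +-cong (*-congˡ (≈-sym (∑-allFin (λ c → x c ^ i)))) (-‿cong (+-congˡ (+-congʳ (*-congˡ (≈-sym (S-pw i x′)))))) ⟩
    e 1 x * pw i x - S 1 i x ∎
    where
    x′ : Fin N → Carrier
    x′ = x ∘ suc
  newton (suc r) i {suc N} x = begin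
    S (suc r) (suc i) x′ + (x zero * S r (suc i) x′ + x zero ^ suc i * e (suc r) x′)
      ≈⟨ +-cong (newton (suc r) i x′) (+-congʳ (*-congˡ (newton r i x′))) ⟩
    (e (suc (suc r)) x′ * pw i x′ - S (suc (suc r)) i x′)
      + (x zero * (e (suc r) x′ * pw i x′ - S (suc r) i x′) + x zero ^ suc i * e (suc r) x′)
      ≈⟨ solve 7 (λ a b p s t y z → (a :* p :- s) :+ (y :* (b :* p :- t) :+ (y :* z) :* b)
           := (a :+ y :* b) :* (z :+ p) :- (s :+ (y :* t :+ z :* a))) ≈-refl
           (e (suc (suc r)) x′) (e (suc r) x′) (pw i x′) (S (suc (suc r)) i x′) (S (suc r) i x′) (x zero) (x zero ^ i) ⟩
    e (suc (suc r)) x * (x zero ^ i + pw i x′) - S (suc (suc r)) i x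
      ≈⟨ +-congʳ (*-congˡ (≈-sym (∑-allFin (λ c → x c ^ i)))) ⟩
    e (suc (suc r)) x * pw i x - S (suc (suc r)) i x ∎
    where
    x′ : Fin N → Carrier
    x′ = x ∘ suc

  E-++ : ∀ λ' μ {N} (x : Fin N → Carrier) → E (λ' ++ μ) x ≈ E λ' x * E μ x
  E-++ []       μ x = ≈-sym (*-identityˡ _)
  E-++ (r ∷ λ') μ x = ≈-trans (*-congˡ (E-++ λ' μ x)) (≈-sym (*-assoc _ _ _))

-- Path totals and off-diagonal sums in terms of power sums.

module PathSums (R : CommutativeRing 0ℓ 0ℓ) {N : ℕ} (x : Fin N → CommutativeRing.Carrier R) where
  open RingKit R
  open Newton R using (pw)
  open TwinTadpole R x

  P : ℕ → Carrier
  P n = Σᶜ (W n)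

  -- Moments are needed because the totals `P` do not satisfy a closed recursion: each step of `W`
  -- multiplies by `x c` and so raises the exponent by one, as in `Q-suc`.
  Q : ℕ → ℕ → Carrier
  Q n i = Σᶜ (λ c → x c ^ i * W n c)

  P-Q : ∀ n → P n ≈ Q n 0
  P-Q n = Σᶜ-cong λ c → ≈-sym (*-identityˡ _)

  Q-zero : ∀ i → Q 0 i ≈ pw (suc i) x
  Q-zero i = Σᶜ-cong λ c → *-comm _ _

  Q-suc : ∀ n i → Q (suc n) i ≈ pw (suc i) x * P n - Q n (suc i)
  Q-suc n i = ≈-trans
    (Σᶜ-cong λ c → solve 4 (λ z y p w → z :* (y :* (p :- w)) := (y :* z) :* p :- (y :* z) :* w) ≈-refl (x c ^ i) (x c) (P n) (W n c))
    (≈-trans (∑-minus (allFin N) _ _) (+-congʳ (∑-*ʳ (allFin N) (P n) _)))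

  offDiagonal : (Fin N → Fin N → Carrier) → Carrier
  offDiagonal f = Σᶜ (λ p → Σᶜ (λ q → ne p q * f p q))

  offDiagonal-cong : ∀ {f g : Fin N → Fin N → Carrier} → (∀ p q → f p q ≈ g p q) → offDiagonal f ≈ offDiagonal g
  offDiagonal-cong h = Σᶜ-cong λ p → Σᶜ-cong λ q → *-congˡ (h p q)

  offDiagonal-+ : ∀ f g → offDiagonal (λ p q → f p q + g p q) ≈ offDiagonal f + offDiagonal g
  offDiagonal-+ f g = ≈-trans
    (Σᶜ-cong λ p → ≈-trans (Σᶜ-cong λ q → distribˡ _ _ _) (∑-+ (allFin N) _ _)) (∑-+ (allFin N) _ _)

  offDiagonal-neg : ∀ f → offDiagonal (λ p q → - f p q) ≈ - offDiagonal f
  offDiagonal-neg f = ≈-trans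
    (Σᶜ-cong λ p → ≈-trans (Σᶜ-cong λ q → ≈-sym (-‿distribʳ-* _ _)) (∑-neg (allFin N) _)) (∑-neg (allFin N) _)

  offDiagonal-*ˡ : ∀ k f → offDiagonal (λ p q → k * f p q) ≈ k * offDiagonal f
  offDiagonal-*ˡ k f = ≈-trans
    (Σᶜ-cong λ p → ≈-trans
      (Σᶜ-cong λ q → solve 3 (λ a b c → a :* (b :* c) := b :* (a :* c)) ≈-refl (ne p q) k (f p q)) (∑-*ˡ (allFin N) k _))
    (∑-*ˡ (allFin N) k _)

  offDiagonal-split : ∀ f → offDiagonal f ≈ Σᶜ (λ p → Σᶜ (f p)) - Σᶜ (λ p → f p p)
  offDiagonal-split f = ≈-trans
    (Σᶜ-cong λ p → ≈-trans (Σᶜ-cong λ q → *-congʳ (ne-sym p q)) (∑-ne p (f p)))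
    (∑-minus (allFin N) _ _)

  weight : ℕ → ℕ → ℕ → Fin N → Fin N → Carrier
  weight n i j p q = (x p ^ i * x q ^ j) * tail n p q

  -- The full double sum factorises in `p` and `q`; the diagonal, where `tail` is `P n - 2 W n p`,
  -- is subtracted.
  weight-sum : ∀ n a b → offDiagonal (weight n a b) ≈
    (pw a x * (pw b x * P n - Q n b) - Q n a * pw b x) - (pw (a ℕ.+ b) x * P n - (Q n (a ℕ.+ b) + Q n (a ℕ.+ b)))
  weight-sum n a b = ≈-trans (offDiagonal-split (weight n a b)) (+-cong
    (≈-trans (Σᶜ-cong λ p → row p)
      (≈-trans (∑-minus (allFin N) _ _) (+-cong (∑-*ʳ (allFin N) _ _) (-‿cong (∑-*ʳ (allFin N) _ _)))))
    (-‿cong (≈-trans (Σᶜ-cong λ p → ≈-trans (*-congʳ (≈-sym (^-homo-* (x p) a b)))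
        (solve 3 (λ y t w → y :* (t :- w :- w) := y :* t :- (y :* w :+ y :* w)) ≈-refl (x p ^ (a ℕ.+ b)) (P n) (W n p)))
      (≈-trans (∑-minus (allFin N) _ _) (+-cong (∑-*ʳ (allFin N) _ _) (-‿cong (∑-+ (allFin N) _ _)))))))
    where
    row : ∀ p → Σᶜ (weight n a b p) ≈ x p ^ a * (pw b x * P n - Q n b) - (x p ^ a * W n p) * pw b x
    row p = ≈-trans
      (Σᶜ-cong λ q → solve 5 (λ y z t w v → (y :* z) :* (t :- w :- v)
         := y :* (z :* t :- z :* v) :- (y :* w) :* z) ≈-refl (x p ^ a) (x q ^ b) (P n) (W n p) (W n q))
      (≈-trans (∑-minus (allFin N) _ _) (+-cong
        (≈-trans (∑-*ˡ (allFin N) _ _) (*-congˡ (≈-trans (∑-minus (allFin N) _ _) (+-congʳ (∑-*ʳ (allFin N) _ _)))))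
        (-‿cong (∑-*ˡ (allFin N) _ _))))

-- Integer expansions in elementary functions, uniform in the number of variables.

module Expansions (R : ℕ → CommutativeRing 0ℓ 0ℓ) (var : ∀ N → Fin N → CommutativeRing.Carrier (R N)) where

  module V (N : ℕ) where
    open RingKit (R N) public
    open Symmetric (R N) public
    open Newton (R N) public
    open TwinTadpole (R N) (var N) public
    open PathSums (R N) (var N) public

  SymFun : Set
  SymFun = (N : ℕ) → V.Carrier N

  evalE : List (ℤ × List ℕ) → SymFun
  evalE F N = V.∑ N F (λ { (z , λ') → V._*_ N (V.⟦_⟧ N z) (V.E N λ' (var N)) })

  PositiveOfSize : ℕ → List ℕ → Set
  PositiveOfSize d λ' = sum λ' ≡ d × All (1 ≤_) λ'

  -- `terms` is fixed before `N` is quantified, as `Represents` demands. Index lists may be unsorted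
  -- and may repeat, so a sum is a concatenation of term lists and a product concatenates index
  -- lists.
  record EExpansion (d : ℕ) (f : SymFun) : Set where
    constructor expansion
    field
      terms       : List (ℤ × List ℕ)
      homogeneous : All (λ t → PositiveOfSize d (proj₂ t)) terms
      represents  : ∀ N → V._≈_ N (f N) (evalE terms N)

  exp-resp : ∀ {d f g} → (∀ N → V._≈_ N (g N) (f N)) → EExpansion d f → EExpansion d g
  exp-resp h (expansion F hom r) = expansion F hom λ N → V.≈-trans N (h N) (r N)

  exp-size : ∀ {d d′ f} → d ≡ d′ → EExpansion d f → EExpansion d′ f
  exp-size refl E = E

  exp-0 : ∀ {d} → EExpansion d (λ N → V.0# N)
  exp-0 = expansion [] [] λ N → V.≈-refl N

  exp-e : ∀ r → EExpansion (suc r) (λ N → V.e N (suc r) (var N))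
  exp-e r = expansion ((1ℤ , suc r ∷ []) ∷ []) ((ℕₚ.+-identityʳ _ , s≤s z≤n ∷ []) ∷ []) λ N → let open V N in
    ≈-sym (solve 1 (λ y → con 1ℤ :* (y :* con 1ℤ) :+ con (+ 0) := y) ≈-refl (e (suc r) (var N)))

  exp-+ : ∀ {d f g} → EExpansion d f → EExpansion d g → EExpansion d (λ N → V._+_ N (f N) (g N))
  exp-+ (expansion F homF rF) (expansion G homG rG) = expansion (F ++ G) (Allₚ.++⁺ homF homG) λ N → let open V N in
    ≈-trans (+-cong (rF N) (rG N)) (≈-sym (∑-++ F G _))

  exp-neg : ∀ {d f} → EExpansion d f → EExpansion d (λ N → V.-_ N (f N))
  exp-neg (expansion F hom r) = expansion (map (λ { (z , λ') → ℤ.- z , λ' }) F) (Allₚ.map⁺ hom) λ N → let open V N in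
    ≈-trans (-‿cong (r N)) (≈-sym (≈-trans (∑-map F _ _)
      (≈-trans (∑-cong F λ { (z , λ') → ≈-trans (*-congʳ (⟦⟧-neg z)) (≈-sym (-‿distribˡ-* _ _)) }) (∑-neg F _))))

  exp-minus : ∀ {d f g} → EExpansion d f → EExpansion d g → EExpansion d (λ N → V._-_ N (f N) (g N))
  exp-minus E E′ = exp-+ E (exp-neg E′)

  exp-* : ∀ {d d′ f g} → EExpansion d f → EExpansion d′ g → EExpansion (d ℕ.+ d′) (λ N → V._*_ N (f N) (g N))
  exp-* {d} {d′} (expansion F homF rF) (expansion G homG rG) =
    expansion (concatMap (λ t → map (times t) G) F)
      (Allₚ.concat⁺ (Allₚ.map⁺ (All.map (λ {t} h → Allₚ.map⁺ (All.map (λ {s} → sizes {t} h {s}) homG)) homF)))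
      λ N → let open V N in ≈-trans (*-cong (rF N) (rG N)) (≈-sym (≈-trans (∑-concatMap F _ _) (≈-trans
        (∑-cong F λ { (z , λ') → ≈-trans (∑-map G _ _) (≈-trans
          (∑-cong G λ { (w , μ) → ≈-trans (*-cong (⟦⟧-* z w) (E-++ λ' μ (var N)))
            (solve 4 (λ a b c d → (a :* b) :* (c :* d) := (a :* c) :* (b :* d)) ≈-refl ⟦ z ⟧ ⟦ w ⟧ _ _) })
          (∑-*ˡ G _ _)) })
        (∑-*ʳ F _ _))))
    where
    times : ℤ × List ℕ → ℤ × List ℕ → ℤ × List ℕ
    times (z , λ') (w , μ) = z ℤ.* w , λ' ++ μ

    sizes : ∀ {t} → PositiveOfSize d (proj₂ t) → ∀ {s} → PositiveOfSize d′ (proj₂ s) →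
            PositiveOfSize (d ℕ.+ d′) (proj₂ (times t s))
    sizes {z , λ'} (refl , pos) {w , μ} (refl , pos′) = sum-++ λ' μ , Allₚ.++⁺ pos pos′

  exp-multiple : ∀ {d f} n → EExpansion d f → EExpansion d (λ N → V._*_ N (V.⟦_⟧ N (+ n)) (f N))
  exp-multiple zero    E = exp-resp (λ N → V.zeroˡ N _) exp-0
  exp-multiple (suc n) E = exp-resp
    (λ N → let open V N in ≈-trans (*-congʳ (1+× n 1#)) (≈-trans (distribʳ _ _ _) (+-congʳ (*-identityˡ _))))
    (exp-+ E (exp-multiple n E))

  -- Induction on the exponent with `r` free, since `newton` lowers the exponent at the cost of
  -- enlarging `T`. The power sum in it is the case `r = 0` of the induction hypothesis, and `S-e`
  -- is the base; no division occurs.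
  exp-S : ∀ i r → EExpansion (r ℕ.+ suc i) (λ N → V.S N r (suc i) (var N))
  exp-S zero    r = exp-size (ℕₚ.+-comm 1 r) (exp-resp (λ N → V.S-e N r (var N)) (exp-multiple (suc r) (exp-e r)))
  exp-S (suc i) r = exp-resp (λ N → V.newton N r (suc i) (var N)) (exp-minus
    (exp-size (sym (ℕₚ.+-suc r (suc i))) (exp-* (exp-e r) (exp-resp (λ N → V.≈-sym N (V.S-pw N (suc i) (var N))) (exp-S i 0))))
    (exp-size (sym (ℕₚ.+-suc r (suc i))) (exp-S i (suc r))))

  exp-pw : ∀ i → EExpansion (suc i) (λ N → V.pw N (suc i) (var N))
  exp-pw i = exp-resp (λ N → V.≈-sym N (V.S-pw N (suc i) (var N))) (exp-S i 0)

  exp-Q : ∀ n i → EExpansion (i ℕ.+ suc n) (λ N → V.Q N n i)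
  exp-P : ∀ n → EExpansion (suc n) (λ N → V.P N n)
  exp-P n = exp-resp (λ N → V.P-Q N n) (exp-Q n 0)
  exp-Q zero    i = exp-size (ℕₚ.+-comm 1 i) (exp-resp (λ N → V.Q-zero N i) (exp-pw i))
  exp-Q (suc n) i = exp-size (sym (ℕₚ.+-suc i (suc n))) (exp-resp (λ N → V.Q-suc N n i)
    (exp-minus (exp-* (exp-pw i) (exp-P n)) (exp-Q n (suc i))))

  exp-weight : ∀ n i j → EExpansion (suc i ℕ.+ (suc j ℕ.+ suc n)) (λ N → V.offDiagonal N (V.weight N n (suc i) (suc j)))
  exp-weight n i j = exp-resp (λ N → V.weight-sum N n (suc i) (suc j)) (exp-minus
    (exp-minus (exp-* (exp-pw i) (exp-minus (exp-* (exp-pw j) (exp-P n)) (exp-Q n (suc j))))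
               (exp-size (trans (ℕₚ.+-assoc (suc i) (suc n) (suc j)) (cong (suc i ℕ.+_) (ℕₚ.+-comm (suc n) (suc j))))
                         (exp-* (exp-Q n (suc i)) (exp-pw j))))
    (exp-size (ℕₚ.+-assoc (suc i) (suc j) (suc n))
      (exp-minus (exp-* (exp-pw (i ℕ.+ suc j)) (exp-P n)) (exp-+ (exp-Q n (suc i ℕ.+ suc j)) (exp-Q n (suc i ℕ.+ suc j))))))

  PairFun : Set
  PairFun = (N : ℕ) → Fin N → Fin N → V.Carrier N

  -- Quantifying over the exponents i, j makes this class closed under
  -- multiplication by x_p and x_q.
  record PairExpansion (n d : ℕ) (φ : PairFun) : Set where
    constructor weighted
    field expand : ∀ i j → EExpansion (d ℕ.+ (suc i ℕ.+ (suc j ℕ.+ suc n)))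
            (λ N → V.offDiagonal N (λ p q → V._*_ N (V.weight N n (suc i) (suc j) p q) (φ N p q)))
  open PairExpansion

  module PairClosure (n : ℕ) where

    pair-resp : ∀ {d φ ψ} → (∀ N p q → V._≈_ N (ψ N p q) (φ N p q)) → PairExpansion n d φ → PairExpansion n d ψ
    pair-resp h E = weighted λ i j → exp-resp (λ N → let open V N in offDiagonal-cong λ p q → *-congˡ (h N p q)) (expand E i j)

    pair-+ : ∀ {d φ ψ} → PairExpansion n d φ → PairExpansion n d ψ →
             PairExpansion n d (λ N p q → V._+_ N (φ N p q) (ψ N p q))
    pair-+ E E′ = weighted λ i j → exp-resp (λ N → let open V N in
      ≈-trans (offDiagonal-cong λ p q → distribˡ _ _ _) (offDiagonal-+ _ _)) (exp-+ (expand E i j) (expand E′ i j))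

    pair-neg : ∀ {d φ} → PairExpansion n d φ → PairExpansion n d (λ N p q → V.-_ N (φ N p q))
    pair-neg E = weighted λ i j → exp-resp (λ N → let open V N in
      ≈-trans (offDiagonal-cong λ p q → ≈-sym (-‿distribʳ-* _ _)) (offDiagonal-neg _)) (exp-neg (expand E i j))

    pair-minus : ∀ {d φ ψ} → PairExpansion n d φ → PairExpansion n d ψ →
                 PairExpansion n d (λ N p q → V._-_ N (φ N p q) (ψ N p q))
    pair-minus E E′ = pair-+ E (pair-neg E′)

    pair-*ˡ : ∀ {d d′ f φ} → EExpansion d f → PairExpansion n d′ φ →
              PairExpansion n (d ℕ.+ d′) (λ N p q → V._*_ N (f N) (φ N p q))
    pair-*ˡ {d} {d′} E E′ = weighted λ i j → exp-size (sym (ℕₚ.+-assoc d d′ _)) (exp-resp (λ N → let open V N in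
      ≈-trans (offDiagonal-cong λ p q → solve 3 (λ a b c → a :* (b :* c) := b :* (a :* c)) ≈-refl _ _ _)
              (offDiagonal-*ˡ _ _)) (exp-* E (expand E′ i j)))

    pair-const : ∀ {d f} → EExpansion d f → PairExpansion n d (λ N p q → f N)
    pair-const {d} {f} E = weighted λ i j → exp-resp (λ N → let open V N in
      ≈-trans (offDiagonal-cong λ p q → *-comm _ _) (offDiagonal-*ˡ (f N) _)) (exp-* E (exp-weight n i j))

    pair-xₚ* : ∀ {d φ} → PairExpansion n d φ → PairExpansion n (suc d) (λ N p q → V._*_ N (var N p) (φ N p q))
    pair-xₚ* {d} {φ} E = weighted λ i j → exp-size (ℕₚ.+-suc d _) (exp-resp (λ N → let open V N in
      offDiagonal-cong λ p q → solve 5 (λ y a b t f → ((a :* b) :* t) :* (y :* f) := (((y :* a) :* b) :* t) :* f) ≈-refl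
        (var N p) (var N p ^ suc i) (var N q ^ suc j) (tail n p q) (φ N p q)) (expand E (suc i) j))

    pair-x_q* : ∀ {d φ} → PairExpansion n d φ → PairExpansion n (suc d) (λ N p q → V._*_ N (var N q) (φ N p q))
    pair-x_q* {d} {φ} E = weighted λ i j → exp-size (trans (cong (d ℕ.+_) (ℕₚ.+-suc (suc i) _)) (ℕₚ.+-suc d _)) (exp-resp (λ N → let open V N in
      offDiagonal-cong λ p q → solve 5 (λ y a b t f → ((a :* b) :* t) :* (y :* f) := ((a :* (y :* b)) :* t) :* f) ≈-refl
        (var N q) (var N p ^ suc i) (var N q ^ suc j) (tail n p q) (φ N p q)) (expand E i (suc j)))

    pair-1 : PairExpansion n 0 (λ N p q → V.1# N)
    pair-1 = weighted λ i j → exp-resp (λ N → let open V N in offDiagonal-cong λ p q → *-identityʳ _) (exp-weight n i j)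

    pair-xₚ : PairExpansion n 1 (λ N p q → var N p)
    pair-xₚ = pair-resp (λ N p q → V.≈-sym N (V.*-identityʳ N _)) (pair-xₚ* pair-1)

    pair-x_q : PairExpansion n 1 (λ N p q → var N q)
    pair-x_q = pair-resp (λ N p q → V.≈-sym N (V.*-identityʳ N _)) (pair-x_q* pair-1)

    exp-p₁ : EExpansion 1 (λ N → V.p₁ N)
    exp-p₁ = exp-resp (λ N → let open V N in Σᶜ-cong λ c → ≈-sym (*-identityʳ _)) (exp-pw 0)

    exp-p₂ : EExpansion 2 (λ N → V.p₂ N)
    exp-p₂ = exp-resp (λ N → let open V N in Σᶜ-cong λ c → *-congˡ (≈-sym (*-identityʳ _))) (exp-pw 1)

    exp-p₃ : EExpansion 3 (λ N → V.p₃ N)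
    exp-p₃ = exp-resp (λ N → let open V N in Σᶜ-cong λ c → *-congˡ (*-congˡ (≈-sym (*-identityʳ _)))) (exp-pw 2)

    pair-u : PairExpansion n 1 (λ N p q → V.u N p q)
    pair-u = pair-minus (pair-minus (pair-const exp-p₁) pair-xₚ) pair-x_q

    pair-*u : ∀ {d φ} → PairExpansion n d φ → PairExpansion n (suc d) (λ N p q → V._*_ N (φ N p q) (V.u N p q))
    pair-*u {φ = φ} E = pair-resp (λ N p q → let open V N in
        solve 4 (λ f a y z → f :* (a :- y :- z) := (a :* f :- y :* f) :- z :* f) ≈-refl (φ N p q) p₁ (var N p) (var N q))
      (pair-minus (pair-minus (pair-*ˡ exp-p₁ E) (pair-xₚ* E)) (pair-x_q* E))

    -- Follows the bracketing of `A`, in which `x p` and `x q` always multiply from the left and `u`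
    -- from the right, so that each factor is absorbed by one closure rule.
    pair-A : PairExpansion n 3 (λ N p q → V.A N p q)
    pair-A = pair-+
      (pair-+ (pair-minus (pair-*u (pair-*ˡ exp-p₁ pair-u)) (pair-*u (pair-const (exp-+ exp-p₂ exp-p₂)))) (pair-const exp-p₃))
      (pair-+ (pair-minus (pair-xₚ* (pair-xₚ* (pair-+ pair-u pair-u))) (pair-xₚ* (pair-xₚ* pair-xₚ)))
              (pair-minus (pair-x_q* (pair-x_q* (pair-+ pair-u pair-u))) (pair-x_q* (pair-x_q* pair-x_q))))

  exp-X : ∀ n → EExpansion (6 ℕ.+ n) (λ N → V.X N (TwinTad (suc n)) (var N))
  exp-X n = exp-resp (λ N → let open V N in ≈-trans (X-TwinTad n)
      (offDiagonal-cong λ p q → *-congʳ (*-congʳ (*-cong (≈-sym (*-identityʳ _)) (≈-sym (*-identityʳ _))))))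
    -- Exponents `suc 0` account for the colours of `v₄` and its twin. The degree
    -- `3 + (1 + (1 + (n + 1)))` computes to `6 + n`, the number of vertices.
    (expand (PairClosure.pair-A n) 0 0)

-- Partitions, sorting, and the enumeration of partitions.

data IsPartition : ℕ → ℕ → List ℕ → Set where
  []  : ∀ {m} → IsPartition m 0 []
  add : ∀ {m n k λ'} → 1 ≤ k → k ≤ m → IsPartition k n λ' → IsPartition m (k ℕ.+ n) (k ∷ λ')

weaken : ∀ {m m′ n λ'} → m ≤ m′ → IsPartition m n λ' → IsPartition m′ n λ'
weaken m≤m′ []                = []
weaken m≤m′ (add 1≤k k≤m p) = add 1≤k (ℕₚ.≤-trans k≤m m≤m′) p

insert : ℕ → List ℕ → List ℕ
insert r []       = r ∷ []
insert r (k ∷ λ') with k ℕ.≤? r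
... | yes _ = r ∷ k ∷ λ'
... | no _  = k ∷ insert r λ'

sort : List ℕ → List ℕ
sort = foldr insert []

insert-partition : ∀ {m n r λ'} → 1 ≤ r → r ≤ m → IsPartition m n λ' → IsPartition m (r ℕ.+ n) (insert r λ')
insert-partition 1≤r r≤m [] = add 1≤r r≤m []
insert-partition {m} {r = r} 1≤r r≤m (add {n = n} {k = k} {λ' = λ'} 1≤k k≤m p) with k ℕ.≤? r
... | yes k≤r = add 1≤r r≤m (add 1≤k k≤r p)
... | no k≰r  = subst (λ s → IsPartition m s (k ∷ insert r λ')) (swap k r n)
                  (add 1≤k k≤m (insert-partition 1≤r (ℕₚ.<⇒≤ (ℕₚ.≰⇒> k≰r)) p))
  where
  swap : ∀ a b c → a ℕ.+ (b ℕ.+ c) ≡ b ℕ.+ (a ℕ.+ c)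
  swap a b c = trans (sym (ℕₚ.+-assoc a b c)) (trans (cong (ℕ._+ c) (ℕₚ.+-comm a b)) (ℕₚ.+-assoc b a c))

sort-partition : ∀ {λ'} → All (1 ≤_) λ' → IsPartition (sum λ') (sum λ') (sort λ')
sort-partition []                       = []
sort-partition {r ∷ λ'} (1≤r ∷ pos) =
  insert-partition 1≤r (ℕₚ.m≤m+n r _) (weaken (ℕₚ.m≤n+m (sum λ') r) (sort-partition pos))

module _ (R : CommutativeRing 0ℓ 0ℓ) where
  open RingKit R
  open Symmetric R

  E-insert : ∀ r λ' {N} (x : Fin N → Carrier) → E (insert r λ') x ≈ e r x * E λ' x
  E-insert r []       x = ≈-refl
  E-insert r (k ∷ λ') x with k ℕ.≤? r
  ... | yes _ = ≈-refl
  ... | no _  = ≈-trans (*-congˡ (E-insert r λ' x))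
    (solve 3 (λ a b c → a :* (b :* c) := b :* (a :* c)) ≈-refl (e k x) (e r x) (E λ' x))

  E-sort : ∀ λ' {N} (x : Fin N → Carrier) → E (sort λ') x ≈ E λ' x
  E-sort []       x = ≈-refl
  E-sort (r ∷ λ') x = ≈-trans (E-insert r (sort λ') x) (*-congˡ (E-sort λ' x))

_==ᴸ_ : List ℕ → List ℕ → Bool
λ' ==ᴸ μ = ⌊ ≡-dec ℕ._≟_ λ' μ ⌋

==ᴸ-refl : ∀ λ' → (λ' ==ᴸ λ') ≡ true
==ᴸ-refl λ' with ≡-dec ℕ._≟_ λ' λ'
... | yes _ = refl
... | no ne = contradiction refl ne

==ᴸ-∷ : ∀ j k μ λ' → ((j ∷ μ) ==ᴸ (k ∷ λ')) ≡ ⌊ j ℕ.≟ k ⌋ ∧ (μ ==ᴸ λ')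
==ᴸ-∷ j k μ λ' with j ℕ.≟ k | ≡-dec ℕ._≟_ μ λ' | ≡-dec ℕ._≟_ (j ∷ μ) (k ∷ λ')
... | yes refl | yes refl | yes _ = refl
... | yes refl | yes refl | no ne = contradiction refl ne
... | yes refl | no ne | yes refl = contradiction refl ne
... | yes refl | no ne | no _ = refl
... | no ne | _ | yes refl = contradiction refl ne
... | no ne | _ | no _ = refl

suc-≟ : ∀ j k → ⌊ suc j ℕ.≟ suc k ⌋ ≡ ⌊ j ℕ.≟ k ⌋
suc-≟ j k with j ℕ.≟ k | suc j ℕ.≟ suc k
... | yes _    | yes _    = refl
... | no _     | no _     = refl
... | yes refl | no ne    = contradiction refl ne
... | no ne    | yes refl = contradiction refl ne

∑-upTo : ∀ k M (g : ℕ → ℤ) → k < M → ℤK.∑ (upTo M) (λ j → ℤK.[ ⌊ j ℕ.≟ k ⌋ ]ᵇ ℤ.* g j) ≡ g k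
∑-upTo k (suc M) g k<M = trans
  (cong (λ L → first ℤ.+ ℤK.∑ L term) (sym (map-upTo suc M)))
  (trans (cong (λ z → first ℤ.+ z) (ℤK.∑-map (upTo M) suc term)) (rest k k<M))
  where
  term : ℕ → ℤ
  term j = ℤK.[ ⌊ j ℕ.≟ k ⌋ ]ᵇ ℤ.* g j
  first : ℤ
  first = term 0
  rest : ∀ k → k < suc M → ℤK.[ ⌊ 0 ℕ.≟ k ⌋ ]ᵇ ℤ.* g 0
         ℤ.+ ℤK.∑ (upTo M) (λ j → ℤK.[ ⌊ suc j ℕ.≟ k ⌋ ]ᵇ ℤ.* g (suc j)) ≡ g k
  rest zero    _         = trans (cong₂ ℤ._+_ (ℤₚ.*-identityˡ (g 0))
    (trans (ℤK.∑-cong (upTo M) λ j → ℤₚ.*-zeroˡ (g (suc j))) (ℤK.∑-0 (upTo M)))) (ℤₚ.+-identityʳ _)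
  rest (suc k) (s≤s k<M) = trans (cong₂ ℤ._+_ (ℤₚ.*-zeroˡ (g 0))
    (trans (ℤK.∑-cong (upTo M) λ j → cong (λ b → ℤK.[ b ]ᵇ ℤ.* g (suc j)) (suc-≟ j k)) (∑-upTo k M (λ j → g (suc j)) k<M)))
    (ℤₚ.+-identityˡ _)

-- One equation that says both that `λ'` is enumerated and that it is not repeated. The free `v`
-- lets the induction pass from `μ` to `suc k ∷ μ`.
∑-partsF : ∀ {m n λ'} f → IsPartition m n λ' → n ≤ f → ∀ (v : List ℕ → ℤ) →
  ℤK.∑ (partsF f n m) (λ μ → ℤK.[ μ ==ᴸ λ' ]ᵇ ℤ.* v μ) ≡ v λ'
∑-partsF f [] _ v = trans (ℤₚ.+-identityʳ _) (ℤₚ.*-identityˡ _)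
∑-partsF {m} (suc f) (add {n = n} {k = suc k} {λ' = λ'} (s≤s z≤n) k<m p) (s≤s n≤f) v = begin
  ℤK.∑ (partsF (suc f) (suc (k ℕ.+ n)) m) (λ μ → ℤK.[ μ ==ᴸ (suc k ∷ λ') ]ᵇ ℤ.* v μ)
    ≡⟨ trans (ℤK.∑-concatMap (map suc (upTo (suc (k ℕ.+ n) ⊓ m))) _ _) (ℤK.∑-map (upTo (suc (k ℕ.+ n) ⊓ m)) suc _) ⟩
  ℤK.∑ (upTo (suc (k ℕ.+ n) ⊓ m)) (λ j → ℤK.∑ (map (suc j ∷_) (parts j)) (λ μ → ℤK.[ μ ==ᴸ (suc k ∷ λ') ]ᵇ ℤ.* v μ))
    ≡⟨ ℤK.∑-cong (upTo (suc (k ℕ.+ n) ⊓ m)) (λ j → trans (ℤK.∑-map (parts j) (suc j ∷_) _)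
         (trans (ℤK.∑-cong (parts j) λ μ → split j μ) (ℤK.∑-*ˡ (parts j) ℤK.[ ⌊ j ℕ.≟ k ⌋ ]ᵇ _))) ⟩
  ℤK.∑ (upTo (suc (k ℕ.+ n) ⊓ m)) (λ j → ℤK.[ ⌊ j ℕ.≟ k ⌋ ]ᵇ ℤ.* ℤK.∑ (parts j) (λ μ → ℤK.[ μ ==ᴸ λ' ]ᵇ ℤ.* v (suc j ∷ μ)))
    ≡⟨ ∑-upTo k (suc (k ℕ.+ n) ⊓ m) _ (ℕₚ.⊓-glb (s≤s (ℕₚ.m≤m+n k n)) k<m) ⟩
  ℤK.∑ (partsF f (k ℕ.+ n ∸ k) (suc k)) (λ μ → ℤK.[ μ ==ᴸ λ' ]ᵇ ℤ.* v (suc k ∷ μ))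
    ≡⟨ cong (λ s → ℤK.∑ (partsF f s (suc k)) (λ μ → ℤK.[ μ ==ᴸ λ' ]ᵇ ℤ.* v (suc k ∷ μ))) (ℕₚ.m+n∸m≡n k n) ⟩
  ℤK.∑ (partsF f n (suc k)) (λ μ → ℤK.[ μ ==ᴸ λ' ]ᵇ ℤ.* v (suc k ∷ μ))
    ≡⟨ ∑-partsF f p (ℕₚ.≤-trans (ℕₚ.m≤n+m n k) n≤f) (λ μ → v (suc k ∷ μ)) ⟩
  v (suc k ∷ λ') ∎
  where
  open ≡.≡-Reasoning
  parts : ℕ → List (List ℕ)
  parts j = partsF f (k ℕ.+ n ∸ j) (suc j)
  split : ∀ j μ → ℤK.[ (suc j ∷ μ) ==ᴸ (suc k ∷ λ') ]ᵇ ℤ.* v (suc j ∷ μ)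
        ≡ ℤK.[ ⌊ j ℕ.≟ k ⌋ ]ᵇ ℤ.* (ℤK.[ μ ==ᴸ λ' ]ᵇ ℤ.* v (suc j ∷ μ))
  split j μ = trans (cong (ℤ._* v (suc j ∷ μ)) (trans
    (cong ℤK.[_]ᵇ (trans (==ᴸ-∷ (suc j) (suc k) μ λ') (cong (_∧ (μ ==ᴸ λ')) (suc-≟ j k))))
    (ℤK.[]ᵇ-∧ ⌊ j ℕ.≟ k ⌋ (μ ==ᴸ λ')))) (ℤₚ.*-assoc ℤK.[ ⌊ j ℕ.≟ k ⌋ ]ᵇ _ _)

partsF-partition : ∀ f n m → All (IsPartition m n) (partsF f n m)
partsF-partition f       zero    m = [] ∷ []
partsF-partition zero    (suc n) m = []
partsF-partition (suc f) (suc n) m = Allₚ.concat⁺ (Allₚ.map⁺ (Allₚ.map⁺ (Allₚ.applyUpTo⁺₁ _ (suc n ⊓ m) λ {j} j<M →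
  Allₚ.map⁺ (All.map (λ {μ} p → subst (λ s → IsPartition m s (suc j ∷ μ))
      (cong suc (ℕₚ.m+[n∸m]≡n (ℕₚ.≤-pred (ℕₚ.≤-trans j<M (ℕₚ.m⊓n≤m (suc n) m)))))
      (add (s≤s z≤n) (ℕₚ.≤-trans j<M (ℕₚ.m⊓n≤n (suc n) m)) p))
    (partsF-partition f (n ∸ j) (suc j))))))

partition-∈ : ∀ {m n λ'} f → IsPartition m n λ' → n ≤ f → λ' ∈ partsF f n m
partition-∈ f [] _ = here refl
partition-∈ {m} (suc f) (add {n = n} {k = suc k} {λ' = λ'} (s≤s z≤n) k<m p) (s≤s n≤f) =
  ∈-concatMap⁺ (λ j → map (j ∷_) (partsF f (suc (k ℕ.+ n) ∸ j) j))
    (Any.map (λ { refl → ∈-map⁺ (suc k ∷_) (subst (λ s → λ' ∈ partsF f s (suc k)) (sym (ℕₚ.m+n∸m≡n k n))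
        (partition-∈ f p (ℕₚ.≤-trans (ℕₚ.m≤n+m n k) n≤f))) })
      (∈-map⁺ suc (∈-upTo⁺ (ℕₚ.⊓-glb (s≤s (ℕₚ.m≤m+n k n)) k<m))))

∑-cong-All : ∀ {A : Set} {L : List A} {f g : A → ℤ} → All (λ a → f a ≡ g a) L → ℤK.∑ L f ≡ ℤK.∑ L g
∑-cong-All []       = refl
∑-cong-All (p ∷ ps) = cong₂ ℤ._+_ p (∑-cong-All ps)

-- Existence of the expansion in the sense of `Represents`.

module Poly (N : ℕ) where
  open Generic N public
  open RingKit polyRing public using (⟦_⟧; 1+×; 1#)

  ⟨⟦+⟧⟩ : ∀ n g → ⟨ ⟦ + n ⟧ , g ⟩ ≡ + n ℤ.* g 𝟎
  ⟨⟦+⟧⟩ zero    g = sym (ℤₚ.*-zeroˡ (g 𝟎))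
  ⟨⟦+⟧⟩ (suc n) g = trans (at (1+× n 1#) g) (trans (⟨⟩-++ (const 1ℤ) ⟦ + n ⟧ g)
    (trans (cong₂ ℤ._+_ (⟨⟩-const 1ℤ g) (⟨⟦+⟧⟩ n g)) (sym (ℤₚ.*-distribʳ-+ (g 𝟎) 1ℤ (+ n)))))

  ⟨⟦⟧⟩ : ∀ z g → ⟨ ⟦ z ⟧ , g ⟩ ≡ z ℤ.* g 𝟎
  ⟨⟦⟧⟩ (+ n)    g = ⟨⟦+⟧⟩ n g
  ⟨⟦⟧⟩ -[1+ n ] g = trans (⟨⟩-neg ⟦ + suc n ⟧ g)
    (trans (cong ℤ.-_ (⟨⟦+⟧⟩ (suc n) g)) (ℤₚ.neg-distribˡ-* (+ suc n) (g 𝟎)))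

  ⟨⟦⟧*⟩ : ∀ z L g → ⟨ ⟦ z ⟧ ⊛ L , g ⟩ ≡ z ℤ.* ⟨ L , g ⟩
  ⟨⟦⟧*⟩ z L g = trans (⟨⟩-⊛ ⟦ z ⟧ L g) (trans (⟨⟦⟧⟩ z (λ m → ⟨ L , (λ n → g (m ⊕ n)) ⟩))
    (cong (z ℤ.*_) (⟨⟩-cong L λ m → cong g (⊕-identityˡ m))))

open Expansions (λ N → Generic.polyRing N) (λ N → Generic.var N) using (module V; EExpansion; expansion; PositiveOfSize; exp-X)

-- `c μ` gathers the coefficients of all terms whose index list sorts to `μ`. Sorting leaves `E`
-- unchanged, and by `∑-partsF` each term meets the sum over partitions exactly once; exchanging the
-- two sums finishes.
expansion⇒representable : ∀ G → EExpansion (size G) (λ N → V.X N G (Generic.var N)) → Σ (List ℕ → ℤ) (Represents G)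
expansion⇒representable G (expansion terms homogeneous represents) = c , λ N α → trans (sym (Generic.⟨X⟩ N G α)) (trans
    (Generic.at (represents N) (δ α)) (trans
    (Generic.⟨∑⟩ N terms _ (δ α)) (trans
    (∑-cong-All (All.map (λ {t} h → term N α t h) homogeneous)) (sym (regroup N α)))))
  where
  d : ℕ
  d = size G

  c : List ℕ → ℤ
  c μ = ℤK.∑ terms (λ { (z , λ') → z ℤ.* ℤK.[ μ ==ᴸ sort λ' ]ᵇ })

  collect : ∀ N (α : Fin N → ℕ) → ℤ × List ℕ → ℤ
  collect N α (z , λ') = z ℤ.* ℤK.∑ (partitions d) (λ μ → ℤK.[ μ ==ᴸ sort λ' ]ᵇ ℤ.* + eCoeff μ N α)

  term : ∀ N α t → PositiveOfSize d (proj₂ t) →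
    Generic.⟨_,_⟩ N (V._*_ N (V.⟦_⟧ N (proj₁ t)) (V.E N (proj₂ t) (Generic.var N))) (δ α) ≡ collect N α t
  term N α (z , λ') (size≡d , pos) = trans (Poly.⟨⟦⟧*⟩ N z (V.E N λ' (Generic.var N)) (δ α)) (cong (z ℤ.*_)
    (trans (sym (Generic.at (E-sort (Generic.polyRing N) λ' (Generic.var N)) (δ α)))
    (trans (Generic.⟨E⟩ N (sort λ') α)
    (sym (∑-partsF d (subst (λ s → IsPartition s s (sort λ')) size≡d (sort-partition pos)) ℕₚ.≤-refl (λ μ → + eCoeff μ N α))))))

  regroup : ∀ N α → sumℤ (map (λ μ → c μ ℤ.* + eCoeff μ N α) (partitions d)) ≡ ℤK.∑ terms (collect N α)
  regroup N α = trans
    (ℤK.∑-cong (partitions d) λ μ → trans (sym (ℤK.∑-*ʳ terms _ _))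
      (ℤK.∑-cong terms λ { (z , λ') → ℤₚ.*-assoc z _ _ }))
    (trans (ℤK.∑-swap (partitions d) terms _)
      (ℤK.∑-cong terms λ { (z , λ') → ℤK.∑-*ˡ (partitions d) z _ }))

TwinTad-representable : ∀ n → Σ (List ℕ → ℤ) (Represents (TwinTad (suc n)))
TwinTad-representable n = expansion⇒representable (TwinTad (suc n)) (exp-X n)

-- From equal coefficients to equal values of every functional.

matches-refl : ∀ {N} (m : Vec ℕ N) → matches (lookup m) m ≡ true
matches-refl {N} m = allᵇ-intro _ (λ i → ≡ᵇ-refl (lookup m i)) (allFin N)
  where
  ≡ᵇ-refl : ∀ k → (k ≡ᵇ k) ≡ true
  ≡ᵇ-refl zero    = refl
  ≡ᵇ-refl (suc k) = ≡ᵇ-refl k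

matches⇒≡ : ∀ {N} (m n : Vec ℕ N) → matches (lookup m) n ≡ true → n ≡ m
matches⇒≡ m n h = pointwise m n (λ i → ≡ᵇ⇒≡ _ _ (allᵇ-elim (λ i → lookup n i ≡ᵇ lookup m i) h i))
  where
  ≡ᵇ⇒≡ : ∀ j k → (j ≡ᵇ k) ≡ true → j ≡ k
  ≡ᵇ⇒≡ zero    zero    _ = refl
  ≡ᵇ⇒≡ (suc j) (suc k) h = cong suc (≡ᵇ⇒≡ j k h)
  pointwise : ∀ {N} (m n : Vec ℕ N) → (∀ i → lookup n i ≡ lookup m i) → n ≡ m
  pointwise []      []      _ = refl
  pointwise (k ∷ m) (l ∷ n) h = cong₂ _∷_ (h zero) (pointwise m n (h ∘ suc))

module _ {N : ℕ} where
  open Polynomials N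

  private
    remove : Vec ℕ N → Poly → Poly
    remove m []            = []
    remove m ((w , n) ∷ L) = if matches (lookup m) n then remove m L else (w , n) ∷ remove m L

    remove-length : ∀ m L → length (remove m L) ≤ length L
    remove-length m []            = z≤n
    remove-length m ((w , n) ∷ L) with matches (lookup m) n
    ... | true  = ℕₚ.m≤n⇒m≤1+n (remove-length m L)
    ... | false = s≤s (remove-length m L)

    remove-sum : ∀ m L g → ⟨ L , g ⟩ ≡ ⟨ L , δ (lookup m) ⟩ ℤ.* g m ℤ.+ ⟨ remove m L , g ⟩
    remove-sum m []            g = refl
    remove-sum m ((w , n) ∷ L) g with matches (lookup m) n in eq
    ... | true  rewrite matches⇒≡ m n eq = trans (cong (λ s → w ℤ.* g m ℤ.+ s) (remove-sum m L g))
      (ℤK.solve 4 (λ w y a b → w :* y :+ (a :* y :+ b) := (w :* con 1ℤ :+ a) :* y :+ b) refl w (g m) ⟨ L , δ (lookup m) ⟩ _)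
      where open ℤK
    ... | false = trans (cong (λ s → w ℤ.* g n ℤ.+ s) (remove-sum m L g))
      (ℤK.solve 5 (λ w y v a b → w :* v :+ (a :* y :+ b) := (w :* con 0ℤ :+ a) :* y :+ (w :* v :+ b)) refl
        w (g m) (g n) ⟨ L , δ (lookup m) ⟩ _)
      where open ℤK

    -- Taking for `α` the first monomial `m`, the hypothesis says that the terms with monomial `m`
    -- have total coefficient zero. Deleting them all changes no functional and shortens the list;
    -- `k` bounds its length.
    vanish : ∀ k L → length L ≤ k → (∀ α → ⟨ L , δ α ⟩ ≡ 0ℤ) → ∀ g → ⟨ L , g ⟩ ≡ 0ℤ
    vanish k       []              _         h g = refl
    vanish (suc k) L@((w , m) ∷ K) (s≤s len) h g = trans (removed g) (vanish k (remove m L) shorter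
      (λ α → trans (sym (removed (δ α))) (h α)) g)
      where
      removed : ∀ g → ⟨ L , g ⟩ ≡ ⟨ remove m L , g ⟩
      removed g = trans (remove-sum m L g) (trans
        (cong (λ z → z ℤ.* g m ℤ.+ ⟨ remove m L , g ⟩) (h (lookup m))) (ℤₚ.+-identityˡ _))
      shorter : length (remove m L) ≤ k
      shorter rewrite matches-refl m = ℕₚ.≤-trans (remove-length m K) len

  coefficients-determine : ∀ L → (∀ α → ⟨ L , δ α ⟩ ≡ 0ℤ) → ∀ g → ⟨ L , g ⟩ ≡ 0ℤ
  coefficients-determine L = vanish (length L) L ℕₚ.≤-refl

-- `Represents` speaks only of monomial coefficients. Extending it to all functionals permits
-- evaluation at points of a ring.
represents-functional : ∀ {G c} → Represents G c → ∀ {N} (g : Vec ℕ N → ℤ) →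
  ℤK.∑ (XMonomials G N) g ≡ ℤK.∑ (partitions (size G)) (λ λ' → c λ' ℤ.* ℤK.∑ (eMonomials λ' N) g)
represents-functional {G} {c} rep {N} g = ℤₚ.i-j≡0⇒i≡j _ _ (trans (sym (⟨difference⟩ g))
  (coefficients-determine difference (λ α → trans (⟨difference⟩ (δ α)) (ℤₚ.i≡j⇒i-j≡0 (coefficients α))) g))
  where
  open Polynomials N
  difference : Poly
  difference = map (1ℤ ,_) (XMonomials G N)
    ++ neg (concatMap (λ λ' → map (c λ' ,_) (eMonomials λ' N)) (partitions (size G)))

  ⟨difference⟩ : ∀ g → ⟨ difference , g ⟩ ≡ ℤK.∑ (XMonomials G N) g
    ℤ.- ℤK.∑ (partitions (size G)) (λ λ' → c λ' ℤ.* ℤK.∑ (eMonomials λ' N) g)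
  ⟨difference⟩ g = trans (⟨⟩-++ (map (1ℤ ,_) (XMonomials G N)) _ g) (cong₂ ℤ._+_
    (trans (ℤK.∑-map (XMonomials G N) (1ℤ ,_) _) (ℤK.∑-cong (XMonomials G N) λ m → ℤₚ.*-identityˡ (g m)))
    (trans (⟨⟩-neg (concatMap _ (partitions (size G))) g) (cong ℤ.-_
      (trans (ℤK.∑-concatMap (partitions (size G)) _ _) (ℤK.∑-cong (partitions (size G)) λ λ' →
        trans (ℤK.∑-map (eMonomials λ' N) (c λ' ,_) _) (ℤK.∑-*ˡ (eMonomials λ' N) (c λ') g))))))

  coefficients : ∀ α → ℤK.∑ (XMonomials G N) (δ α)
    ≡ ℤK.∑ (partitions (size G)) (λ λ' → c λ' ℤ.* ℤK.∑ (eMonomials λ' N) (δ α))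
  coefficients α = trans (sym (XCoeff-sum G N α)) (trans (rep N α)
    (ℤK.∑-cong (partitions (size G)) λ λ' → cong (c λ' ℤ.*_) (eCoeff-sum λ' N α)))

-- Specialisation of an expansion to points of a ring.

record AdditiveFunctional (R : CommutativeRing 0ℓ 0ℓ) : Set where
  open CommutativeRing R using (Carrier; _≈_; _+_; 0#)
  field
    π      : Carrier → ℤ
    π-cong : ∀ {a b} → a ≈ b → π a ≡ π b
    π-+    : ∀ a b → π (a + b) ≡ π a ℤ.+ π b
    π-0    : π 0# ≡ 0ℤ

module Specialisation (R : CommutativeRing 0ℓ 0ℓ) (F : AdditiveFunctional R) where
  open RingKit R
  open Symmetric R
  open AdditiveFunctional F

  π-∑ : ∀ {A : Set} (L : List A) f → π (∑ L f) ≡ ℤK.∑ L (π ∘ f)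
  π-∑ []      f = π-0
  π-∑ (a ∷ L) f = trans (π-+ (f a) _) (cong (λ z → π (f a) ℤ.+ z) (π-∑ L f))

  π-neg : ∀ a → π (- a) ≡ ℤ.- π a
  π-neg a = inverseˡ-unique _ _ (trans (sym (π-+ (- a) a)) (trans (π-cong (-‿inverseˡ a)) π-0))

  π-⟦+⟧ : ∀ n y → π (⟦ + n ⟧ * y) ≡ + n ℤ.* π y
  π-⟦+⟧ zero    y = trans (π-cong (zeroˡ y)) (trans π-0 (sym (ℤₚ.*-zeroˡ (π y))))
  π-⟦+⟧ (suc n) y = trans
    (π-cong (≈-trans (*-congʳ (1+× n 1#)) (≈-trans (distribʳ _ _ _) (+-congʳ (*-identityˡ y)))))
    (trans (π-+ y _) (trans (cong (λ z → π y ℤ.+ z) (π-⟦+⟧ n y))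
      (trans (cong (ℤ._+ (+ n ℤ.* π y)) (sym (ℤₚ.*-identityˡ (π y)))) (sym (ℤₚ.*-distribʳ-+ (π y) 1ℤ (+ n))))))

  π-⟦⟧ : ∀ z y → π (⟦ z ⟧ * y) ≡ z ℤ.* π y
  π-⟦⟧ (+ n)    y = π-⟦+⟧ n y
  π-⟦⟧ -[1+ n ] y = trans (π-cong (≈-sym (-‿distribˡ-* _ y))) (trans (π-neg _)
    (trans (cong ℤ.-_ (π-⟦+⟧ (suc n) y)) (ℤₚ.neg-distribˡ-* (+ suc n) (π y))))

  -- The coefficients of `c` are integers while values lie in `R`. Reading off one integer
  -- coordinate `π` turns evaluation at `x` into the functional `π ∘ mon x`.
  specialise : ∀ {G c} → Represents G c → ∀ {N} (x : Fin N → Carrier) →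
    π (X G x) ≡ ℤK.∑ (partitions (size G)) (λ λ' → c λ' ℤ.* π (E λ' x))
  specialise {G} {c} rep {N} x = trans
    (trans (π-cong (≈-sym (XMonomials-sum G x))) (π-∑ (XMonomials G N) (mon x)))
    (trans (represents-functional {G} {c} rep (π ∘ mon x)) (ℤK.∑-cong (partitions (size G)) λ λ' →
      cong (c λ' ℤ.*_) (trans (sym (π-∑ (eMonomials λ' N) (mon x))) (π-cong (eMonomials-sum λ' x)))))

-- Reading off one coefficient in three variables.

rest : Fin 3 → List ℕ
rest zero             = []
rest (suc zero)       = 1 ∷ []
rest (suc (suc zero)) = 2 ∷ []

threes : ℕ → Fin 3 → List ℕ
threes k r = replicate k 3 ++ rest r

threes-size : ∀ k K (r s : Fin 3) → k ℕ.* 3 ℕ.+ toℕ r ≡ K ℕ.* 3 ℕ.+ toℕ s → k ≡ K × r ≡ s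
threes-size zero    zero    r s h = refl , toℕ-injective h
threes-size (suc k) (suc K) r s h with threes-size k K r s (ℕₚ.+-cancelˡ-≡ 3 _ _ h)
... | refl , refl = refl , refl
threes-size zero    (suc K) zero s ()
threes-size zero    (suc K) (suc zero) s ()
threes-size zero    (suc K) (suc (suc zero)) s ()
threes-size (suc k) zero    r zero ()
threes-size (suc k) zero    r (suc zero) ()
threes-size (suc k) zero    r (suc (suc zero)) ()

threes-partition : ∀ m k r → 3 ≤ m → IsPartition m (k ℕ.* 3 ℕ.+ toℕ r) (threes k r)
threes-partition m (suc k) r 3≤m = add (s≤s z≤n) 3≤m (threes-partition 3 k r ℕₚ.≤-refl)
threes-partition m zero zero             3≤m = []
threes-partition m zero (suc zero)       3≤m = add (s≤s z≤n) (ℕₚ.≤-trans (s≤s z≤n) 3≤m) []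
threes-partition m zero (suc (suc zero)) 3≤m = add (s≤s z≤n) (ℕₚ.≤-trans (s≤s (s≤s z≤n)) 3≤m) []

-- If e₃ = 1 and all products of two of e₁, e₂ vanish, then only the partitions
-- (3ᵏ), (3ᵏ,1) and (3ᵏ,2) survive in three variables.
record FirstOrder (R : CommutativeRing 0ℓ 0ℓ) (x : Fin 3 → CommutativeRing.Carrier R) : Set where
  open CommutativeRing R using (_≈_; _*_; 0#; 1#)
  open Symmetric R using (e)
  field
    e₁e₁ : e 1 x * e 1 x ≈ 0#
    e₂e₁ : e 2 x * e 1 x ≈ 0#
    e₂e₂ : e 2 x * e 2 x ≈ 0#
    e₃≈1 : e 3 x ≈ 1#

module ThreeVariables (R : CommutativeRing 0ℓ 0ℓ) (x : Fin 3 → CommutativeRing.Carrier R) (H : FirstOrder R x) where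
  open RingKit R
  open Symmetric R
  open FirstOrder H

  e-vanish : ∀ r {N} (y : Fin N → Carrier) → N < r → e r y ≈ 0#
  e-vanish (suc r) {zero}  y _         = ≈-refl
  e-vanish (suc r) {suc N} y (s≤s N<r) = ≈-trans
    (+-cong (e-vanish (suc r) (y ∘ suc) (ℕₚ.m<n⇒m<1+n N<r)) (≈-trans (*-congˡ (e-vanish r (y ∘ suc) N<r)) (zeroʳ _)))
    (+-identityˡ _)

  kill : ∀ {a b} y → a * b ≈ 0# → a * (b * y) ≈ 0#
  kill y h = ≈-trans (≈-sym (*-assoc _ _ y)) (≈-trans (*-congʳ h) (zeroˡ y))

  E-threes : ∀ k r → E (threes k r) x ≈ E (rest r) x
  E-threes zero    r = ≈-refl
  E-threes (suc k) r = ≈-trans (*-cong e₃≈1 (E-threes k r)) (*-identityˡ _)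

  -- Parts decrease, so the first one decides: above 3 its `e` vanishes, 3 recurses, and after 1 or
  -- 2 any further part creates a vanishing product of two of `e₁`, `e₂`.
  classify : ∀ {m n λ'} → IsPartition m n λ' →
    (Σ ℕ λ k → Σ (Fin 3) λ r → λ' ≡ threes k r × n ≡ k ℕ.* 3 ℕ.+ toℕ r) ⊎ (E λ' x ≈ 0#)
  classify [] = inj₁ (0 , zero , refl , refl)
  classify (add {k = 1} _ _ []) = inj₁ (0 , suc zero , refl , refl)
  classify (add {k = 1} _ _ (add {k = 1} _ _ _)) = inj₂ (kill _ e₁e₁)
  classify (add {k = 1} _ _ (add {k = suc (suc _)} _ (s≤s ()) _))
  classify (add {k = 2} _ _ []) = inj₁ (0 , suc (suc zero) , refl , refl)
  classify (add {k = 2} _ _ (add {k = 1} _ _ _)) = inj₂ (kill _ e₂e₁)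
  classify (add {k = 2} _ _ (add {k = 2} _ _ _)) = inj₂ (kill _ e₂e₂)
  classify (add {k = 2} _ _ (add {k = suc (suc (suc _))} _ (s≤s (s≤s ())) _))
  classify (add {k = 3} _ _ p) with classify p
  ... | inj₁ (k , r , refl , refl) = inj₁ (suc k , r , refl , refl)
  ... | inj₂ E≈0                   = inj₂ (≈-trans (*-congˡ E≈0) (zeroʳ _))
  classify (add {k = suc (suc (suc (suc k)))} _ _ _) =
    inj₂ (≈-trans (*-congʳ (e-vanish (4 ℕ.+ k) x (s≤s (s≤s (s≤s (s≤s z≤n)))))) (zeroˡ _))

  module Extract (F : AdditiveFunctional R) where
    open AdditiveFunctional F
    open Specialisation R F

    -- The size determines `k` and `r`, so at most the term of `threes k r` survives, and
    -- `c t * π Y = z * π Y`. Cancellation takes place in `ℤ`, where it is enough that `π Y` is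
    -- nonzero; it will be 1 or 3.
    extract : ∀ {G c} → Represents G c → ∀ k r → size G ≡ k ℕ.* 3 ℕ.+ toℕ r → 3 ≤ size G →
      ∀ z → X G x ≈ ⟦ z ⟧ * E (rest r) x → π (E (rest r) x) ≢ 0ℤ → c (threes k r) ≡ z
    extract {G} {c} rep k r size≡ 3≤ z value nz = ℤₚ.*-cancelʳ-≡ (c t) z (π Y) {{ℤ.≢-nonZero nz}} (sym
      (trans (sym (trans (π-cong value) (π-⟦⟧ z Y)))
      (trans (specialise {G} {c} rep x)
      (trans (∑-cong-All (All.map select (partsF-partition (size G) (size G) (size G))))
             (∑-partsF (size G) t-partition ℕₚ.≤-refl (λ λ' → c λ' ℤ.* π Y))))))
      where
      Y : Carrier
      Y = E (rest r) x
      t : List ℕ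
      t = threes k r
      t-partition : IsPartition (size G) (size G) t
      t-partition = subst (λ s → IsPartition (size G) s t) (sym size≡) (threes-partition (size G) k r 3≤)
      select : ∀ {λ'} → IsPartition (size G) (size G) λ' →
        c λ' ℤ.* π (E λ' x) ≡ ℤK.[ λ' ==ᴸ t ]ᵇ ℤ.* (c λ' ℤ.* π Y)
      select {λ'} p with classify p
      select p | inj₁ (k′ , r′ , refl , n≡) with threes-size k′ k r′ r (trans (sym n≡) size≡)
      ... | refl , refl rewrite ==ᴸ-refl t = trans (cong (c t ℤ.*_) (π-cong (E-threes k r))) (sym (ℤₚ.*-identityˡ _))
      select {λ'} p | inj₂ E≈0 = trans (trans (cong (c λ' ℤ.*_) (trans (π-cong E≈0) π-0)) (ℤₚ.*-zeroʳ (c λ'))) (sym zero-rhs)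
        where
        zero-rhs : ℤK.[ λ' ==ᴸ t ]ᵇ ℤ.* (c λ' ℤ.* π Y) ≡ 0ℤ
        zero-rhs with ≡-dec ℕ._≟_ λ' t
        -- `classify` offers alternatives that need not exclude each other, so `t` itself may land
        -- here; then `π Y` is zero as well.
        ... | yes refl = trans (ℤₚ.*-identityˡ _) (trans
          (cong (c λ' ℤ.*_) (trans (sym (π-cong (E-threes k r))) (trans (π-cong E≈0) π-0))) (ℤₚ.*-zeroʳ (c λ')))
        ... | no _ = ℤₚ.*-zeroˡ (c λ' ℤ.* π Y)

-- Quadratic extensions of a commutative ring.

module _ (R : CommutativeRing 0ℓ 0ℓ) where
  private module R = RingKit R
  open R using (Carrier; solve; _:+_; _:*_; _:-_; :-_; _:=_; con; ≈-refl; ≈-sym; ≈-trans)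

  -- R[t] / (t² - b t - a)
  quadraticExtension : Carrier → Carrier → CommutativeRing 0ℓ 0ℓ
  quadraticExtension a b = record
    { Carrier = Carrier × Carrier
    ; _≈_ = λ { (u₀ , u₁) (v₀ , v₁) → (u₀ R.≈ v₀) × (u₁ R.≈ v₁) }
    ; _+_ = λ { (u₀ , u₁) (v₀ , v₁) → u₀ R.+ v₀ , u₁ R.+ v₁ }
    ; _*_ = λ { (u₀ , u₁) (v₀ , v₁) → u₀ R.* v₀ R.+ a R.* (u₁ R.* v₁)
                                    , (u₀ R.* v₁ R.+ u₁ R.* v₀) R.+ b R.* (u₁ R.* v₁) }
    ; -_ = λ { (u₀ , u₁) → R.- u₀ , R.- u₁ }
    ; 0# = R.0# , R.0#
    ; 1# = R.1# , R.0#
    ; isCommutativeRing = record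
      { isRing = record
        { +-isAbelianGroup = record
          { isGroup = record
            { isMonoid = record
              { isSemigroup = record
                { isMagma = record
                  { isEquivalence = record
                    { refl = ≈-refl , ≈-refl
                    ; sym = λ { (p , q) → ≈-sym p , ≈-sym q }
                    ; trans = λ { (p , q) (p′ , q′) → ≈-trans p p′ , ≈-trans q q′ } }
                  ; ∙-cong = λ { (p , q) (p′ , q′) → R.+-cong p p′ , R.+-cong q q′ } }
                ; assoc = λ _ _ _ → R.+-assoc _ _ _ , R.+-assoc _ _ _ }
              ; identity = (λ _ → R.+-identityˡ _ , R.+-identityˡ _) , (λ _ → R.+-identityʳ _ , R.+-identityʳ _) }
            ; inverse = (λ _ → R.-‿inverseˡ _ , R.-‿inverseˡ _) , (λ _ → R.-‿inverseʳ _ , R.-‿inverseʳ _)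
            ; ⁻¹-cong = λ { (p , q) → R.-‿cong p , R.-‿cong q } }
          ; comm = λ _ _ → R.+-comm _ _ , R.+-comm _ _ }
        ; *-cong = λ { (p , q) (p′ , q′) →
            R.+-cong (R.*-cong p p′) (R.*-congˡ (R.*-cong q q′))
          , R.+-cong (R.+-cong (R.*-cong p q′) (R.*-cong q p′)) (R.*-congˡ (R.*-cong q q′)) }
        ; *-assoc = λ { (u₀ , u₁) (v₀ , v₁) (w₀ , w₁) →
            solve 8 (λ a b u₀ u₁ v₀ v₁ w₀ w₁ →
              (u₀ :* v₀ :+ a :* (u₁ :* v₁)) :* w₀ :+ a :* (((u₀ :* v₁ :+ u₁ :* v₀) :+ b :* (u₁ :* v₁)) :* w₁)
              := u₀ :* (v₀ :* w₀ :+ a :* (v₁ :* w₁)) :+ a :* (u₁ :* ((v₀ :* w₁ :+ v₁ :* w₀) :+ b :* (v₁ :* w₁))))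
              ≈-refl a b u₀ u₁ v₀ v₁ w₀ w₁
          , solve 8 (λ a b u₀ u₁ v₀ v₁ w₀ w₁ →
              ((u₀ :* v₀ :+ a :* (u₁ :* v₁)) :* w₁ :+ ((u₀ :* v₁ :+ u₁ :* v₀) :+ b :* (u₁ :* v₁)) :* w₀)
                :+ b :* (((u₀ :* v₁ :+ u₁ :* v₀) :+ b :* (u₁ :* v₁)) :* w₁)
              := (u₀ :* ((v₀ :* w₁ :+ v₁ :* w₀) :+ b :* (v₁ :* w₁)) :+ u₁ :* (v₀ :* w₀ :+ a :* (v₁ :* w₁)))
                :+ b :* (u₁ :* ((v₀ :* w₁ :+ v₁ :* w₀) :+ b :* (v₁ :* w₁))))
              ≈-refl a b u₀ u₁ v₀ v₁ w₀ w₁ }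
        ; *-identity = (λ { (u₀ , u₁) →
              solve 3 (λ a u₀ u₁ → con 1ℤ :* u₀ :+ a :* (con 0ℤ :* u₁) := u₀) ≈-refl a u₀ u₁
            , solve 3 (λ b u₀ u₁ → (con 1ℤ :* u₁ :+ con 0ℤ :* u₀) :+ b :* (con 0ℤ :* u₁) := u₁) ≈-refl b u₀ u₁ })
          , (λ { (u₀ , u₁) →
              solve 3 (λ a u₀ u₁ → u₀ :* con 1ℤ :+ a :* (u₁ :* con 0ℤ) := u₀) ≈-refl a u₀ u₁
            , solve 3 (λ b u₀ u₁ → (u₀ :* con 0ℤ :+ u₁ :* con 1ℤ) :+ b :* (u₁ :* con 0ℤ) := u₁) ≈-refl b u₀ u₁ })
        ; distrib = (λ { (u₀ , u₁) (v₀ , v₁) (w₀ , w₁) →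
              solve 7 (λ a u₀ u₁ v₀ v₁ w₀ w₁ → u₀ :* (v₀ :+ w₀) :+ a :* (u₁ :* (v₁ :+ w₁))
                := (u₀ :* v₀ :+ a :* (u₁ :* v₁)) :+ (u₀ :* w₀ :+ a :* (u₁ :* w₁))) ≈-refl a u₀ u₁ v₀ v₁ w₀ w₁
            , solve 7 (λ b u₀ u₁ v₀ v₁ w₀ w₁ → (u₀ :* (v₁ :+ w₁) :+ u₁ :* (v₀ :+ w₀)) :+ b :* (u₁ :* (v₁ :+ w₁))
                := ((u₀ :* v₁ :+ u₁ :* v₀) :+ b :* (u₁ :* v₁)) :+ ((u₀ :* w₁ :+ u₁ :* w₀) :+ b :* (u₁ :* w₁))) ≈-refl b u₀ u₁ v₀ v₁ w₀ w₁ })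
          , (λ { (u₀ , u₁) (v₀ , v₁) (w₀ , w₁) →
              solve 7 (λ a u₀ u₁ v₀ v₁ w₀ w₁ → (v₀ :+ w₀) :* u₀ :+ a :* ((v₁ :+ w₁) :* u₁)
                := (v₀ :* u₀ :+ a :* (v₁ :* u₁)) :+ (w₀ :* u₀ :+ a :* (w₁ :* u₁))) ≈-refl a u₀ u₁ v₀ v₁ w₀ w₁
            , solve 7 (λ b u₀ u₁ v₀ v₁ w₀ w₁ → ((v₀ :+ w₀) :* u₁ :+ (v₁ :+ w₁) :* u₀) :+ b :* ((v₁ :+ w₁) :* u₁)
                := ((v₀ :* u₁ :+ v₁ :* u₀) :+ b :* (v₁ :* u₁)) :+ ((w₀ :* u₁ :+ w₁ :* u₀) :+ b :* (w₁ :* u₁))) ≈-refl b u₀ u₁ v₀ v₁ w₀ w₁ }) }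
      ; *-comm = λ { (u₀ , u₁) (v₀ , v₁) →
            solve 5 (λ a u₀ u₁ v₀ v₁ → u₀ :* v₀ :+ a :* (u₁ :* v₁) := v₀ :* u₀ :+ a :* (v₁ :* u₁)) ≈-refl a u₀ u₁ v₀ v₁
          , solve 5 (λ b u₀ u₁ v₀ v₁ → (u₀ :* v₁ :+ u₁ :* v₀) :+ b :* (u₁ :* v₁) := (v₀ :* u₁ :+ v₁ :* u₀) :+ b :* (v₁ :* u₁)) ≈-refl b u₀ u₁ v₀ v₁ } } }

-- The chromatic sum with three colours.

module ThreeColours (R : CommutativeRing 0ℓ 0ℓ) (x : Fin 3 → CommutativeRing.Carrier R) where
  open RingKit R
  open Symmetric R
  open TwinTadpole R x

  private
    x₀ x₁ x₂ : Carrier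
    x₀ = x zero
    x₁ = x (suc zero)
    x₂ = x (suc (suc zero))

    -- For the third colour `c` the factor `A` collapses to `c² (a + b)`: `v₁` and `v₃` take `c`,
    -- and `v₂` takes `a` or `b`. The sums enter as variables with equations, so that one identity
    -- serves all six ordered pairs.
    pair-term : ∀ a b c wa wb wc q₁ q₂ q₃ w →
      q₁ ≈ a + b + c → q₂ ≈ a * a + b * b + c * c → q₃ ≈ a * (a * a) + b * (b * b) + c * (c * c) → w ≈ wa + wb + wc →
      let U = q₁ - a - b in
      1# * (((a * b) * (w - wa - wb)) *
        ((((q₁ * U) * U - ((q₂ + q₂) * U)) + q₃)
          + (((a * (a * (U + U))) - a * (a * a)) + ((b * (b * (U + U))) - b * (b * b)))))
      ≈ (a * b * c) * ((c * (a + b)) * wc)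
    pair-term a b c wa wb wc q₁ q₂ q₃ w h₁ h₂ h₃ hw = ≈-trans
      (*-congˡ (*-cong (*-congˡ (≈-trans (+-congʳ (+-congʳ hw))
          (solve 3 (λ y z t → (y :+ z :+ t) :- y :- z := t) ≈-refl wa wb wc)))
        (+-cong (+-cong (+-cong (*-cong (*-cong h₁ u≈) u≈) (-‿cong (*-cong (+-cong h₂ h₂) u≈))) h₃)
          (+-cong (+-congʳ (*-congˡ (*-congˡ (+-cong u≈ u≈)))) (+-congʳ (*-congˡ (*-congˡ (+-cong u≈ u≈))))))))
      (solve 4 (λ a b c w → con 1ℤ :* (((a :* b) :* w) :*
          (((((a :+ b :+ c) :* c) :* c :- ((a :* a :+ b :* b :+ c :* c) :+ (a :* a :+ b :* b :+ c :* c)) :* c)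
             :+ (a :* (a :* a) :+ b :* (b :* b) :+ c :* (c :* c)))
            :+ ((a :* (a :* (c :+ c)) :- a :* (a :* a)) :+ (b :* (b :* (c :+ c)) :- b :* (b :* b)))))
        := (a :* b :* c) :* ((c :* (a :+ b)) :* w)) ≈-refl a b c wc)
      where
      u≈ : q₁ - a - b ≈ c
      u≈ = ≈-trans (+-congʳ (+-congʳ h₁)) (solve 3 (λ y z t → (y :+ z :+ t) :- y :- z := t) ≈-refl a b c)

    sum₃ : ∀ f → Σᶜ f ≈ f zero + f (suc zero) + f (suc (suc zero))
    sum₃ f = solve 3 (λ a b c → a :+ (b :+ (c :+ con 0ℤ)) := a :+ b :+ c) ≈-refl _ _ _

    perm₁ : ∀ a b c → a + b + c ≈ a + c + b
    perm₁ = solve 3 (λ a b c → a :+ b :+ c := a :+ c :+ b) ≈-refl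
    perm₂ : ∀ a b c → a + b + c ≈ b + a + c
    perm₂ = solve 3 (λ a b c → a :+ b :+ c := b :+ a :+ c) ≈-refl
    perm₃ : ∀ a b c → a + b + c ≈ b + c + a
    perm₃ = solve 3 (λ a b c → a :+ b :+ c := b :+ c :+ a) ≈-refl
    perm₄ : ∀ a b c → a + b + c ≈ c + a + b
    perm₄ = solve 3 (λ a b c → a :+ b :+ c := c :+ a :+ b) ≈-refl
    perm₅ : ∀ a b c → a + b + c ≈ c + b + a
    perm₅ = solve 3 (λ a b c → a :+ b :+ c := c :+ b :+ a) ≈-refl

    term₃ : ∀ n p q r → (∀ (f : Fin 3 → Carrier) → Σᶜ f ≈ f p + f q + f r) → ne p q ≈ 1# →
      summand n p q ≈ (x p * x q * x r) * ((x r * (x p + x q)) * W n r)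
    term₃ n p q r perm ne≈1 = ≈-trans (*-congʳ ne≈1)
      (pair-term (x p) (x q) (x r) (W n p) (W n q) (W n r) p₁ p₂ p₃ (Σᶜ (W n))
        (perm x) (perm (λ c → x c * x c)) (perm (λ c → x c * (x c * x c))) (perm (W n)))

  -- With three colours v₁, v₃ and the first tail vertex all get the colour
  -- missing at v₄ and its twin.
  X-three : x₀ * (x₁ * x₂) ≈ 1# → ∀ n → X (TwinTad (suc n)) x ≈ (1# + 1#) * Σᶜ (λ c → (x c * (p₁ - x c)) * W n c)
  X-three xyz≈1 n = begin
    X (TwinTad (suc n)) x
      ≈⟨ X-TwinTad n ⟩
    Σᶜ (λ p → Σᶜ (λ q → summand n p q))
      ≈⟨ ≈-trans (sum₃ (λ p → Σᶜ (summand n p)))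
           (+-cong (+-cong (sum₃ (summand n zero)) (sum₃ (summand n (suc zero)))) (sum₃ (summand n (suc (suc zero))))) ⟩
    ((summand n zero zero + summand n zero (suc zero) + summand n zero (suc (suc zero)))
      + (summand n (suc zero) zero + summand n (suc zero) (suc zero) + summand n (suc zero) (suc (suc zero))))
      + (summand n (suc (suc zero)) zero + summand n (suc (suc zero)) (suc zero) + summand n (suc (suc zero)) (suc (suc zero)))
      ≈⟨ +-cong (+-cong
           (+-cong (+-cong (zeroˡ _)
               (term₃ n zero (suc zero) (suc (suc zero)) sum₃ ≈-refl))
               (term₃ n zero (suc (suc zero)) (suc zero) (λ f → ≈-trans (sum₃ f) (perm₁ _ _ _)) ≈-refl))
           (+-cong (+-cong
               (term₃ n (suc zero) zero (suc (suc zero)) (λ f → ≈-trans (sum₃ f) (perm₂ _ _ _)) ≈-refl) (zeroˡ _))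
               (term₃ n (suc zero) (suc (suc zero)) zero (λ f → ≈-trans (sum₃ f) (perm₃ _ _ _)) ≈-refl)))
           (+-cong (+-cong
               (term₃ n (suc (suc zero)) zero (suc zero) (λ f → ≈-trans (sum₃ f) (perm₄ _ _ _)) ≈-refl)
               (term₃ n (suc (suc zero)) (suc zero) zero (λ f → ≈-trans (sum₃ f) (perm₅ _ _ _)) ≈-refl)) (zeroˡ _)) ⟩
    ((0# + (x₀ * x₁ * x₂) * ((x₂ * (x₀ + x₁)) * w₂) + (x₀ * x₂ * x₁) * ((x₁ * (x₀ + x₂)) * w₁))
      + ((x₁ * x₀ * x₂) * ((x₂ * (x₁ + x₀)) * w₂) + 0# + (x₁ * x₂ * x₀) * ((x₀ * (x₁ + x₂)) * w₀)))
      + ((x₂ * x₀ * x₁) * ((x₁ * (x₂ + x₀)) * w₁) + (x₂ * x₁ * x₀) * ((x₀ * (x₂ + x₁)) * w₀) + 0#)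
      -- Each colour is the missing one for two ordered pairs, whence the factor 2; the sum of the
      -- other two variables is `s` minus its own.
      ≈⟨ solve 6 (λ a b c u v w →
           ((con 0ℤ :+ (a :* b :* c) :* ((c :* (a :+ b)) :* w) :+ (a :* c :* b) :* ((b :* (a :+ c)) :* v))
             :+ ((b :* a :* c) :* ((c :* (b :+ a)) :* w) :+ con 0ℤ :+ (b :* c :* a) :* ((a :* (b :+ c)) :* u)))
             :+ ((c :* a :* b) :* ((b :* (c :+ a)) :* v) :+ (c :* b :* a) :* ((a :* (c :+ b)) :* u) :+ con 0ℤ)
           := (a :* (b :* c)) :* ((con 1ℤ :+ con 1ℤ) :* ((a :* ((a :+ b :+ c) :- a)) :* u
                :+ (b :* ((a :+ b :+ c) :- b)) :* v :+ (c :* ((a :+ b :+ c) :- c)) :* w)))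
           ≈-refl x₀ x₁ x₂ w₀ w₁ w₂ ⟩
    (x₀ * (x₁ * x₂)) * ((1# + 1#) * ((x₀ * (s - x₀)) * w₀ + (x₁ * (s - x₁)) * w₁ + (x₂ * (s - x₂)) * w₂))
      ≈⟨ ≈-trans (*-congʳ xyz≈1) (*-identityˡ _) ⟩
    (1# + 1#) * ((x₀ * (s - x₀)) * w₀ + (x₁ * (s - x₁)) * w₁ + (x₂ * (s - x₂)) * w₂)
      ≈⟨ *-congˡ (≈-trans (≈-sym (sum₃ (λ c → (x c * (s - x c)) * W n c)))
           (Σᶜ-cong {λ c → (x c * (s - x c)) * W n c} {λ c → (x c * (p₁ - x c)) * W n c} λ c → *-congʳ (*-congˡ (+-congʳ (≈-sym (sum₃ x)))))) ⟩
    (1# + 1#) * Σᶜ (λ c → (x c * (p₁ - x c)) * W n c) ∎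
    where
    w₀ w₁ w₂ s : Carrier
    w₀ = W n zero
    w₁ = W n (suc zero)
    w₂ = W n (suc (suc zero))
    s = x₀ + x₁ + x₂

-- Only N = 3 is used; N is kept abstract so that sums over colours do not unfold.
record LikeThreeColours (R : CommutativeRing 0ℓ 0ℓ) {N : ℕ} (x : Fin N → CommutativeRing.Carrier R) : Set where
  open CommutativeRing R using (_≈_; _+_; _*_; _-_; 0#; 1#)
  open Symmetric R using (X)
  open TwinTadpole R x using (Σᶜ; p₁; W)
  field
    ∑-const   : ∀ t → Σᶜ (λ _ → t) ≈ t + (t + (t + 0#))
    X-formula : ∀ n → X (TwinTad (suc n)) x ≈ (1# + 1#) * Σᶜ (λ c → (x c * (p₁ - x c)) * W n c)

-- The data of `(e₁, e₂, e₃) = (E, 0, 1)`: the power sums follow from Newton's identities and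
-- `E² = 0`, and `cubic` is `T³ = e₁T² - e₂T + e₃` at the variables.
record Case-e₁ (R : CommutativeRing 0ℓ 0ℓ) {N : ℕ} (x : Fin N → CommutativeRing.Carrier R) (E : CommutativeRing.Carrier R) : Set where
  open RingKit R using (_≈_; _+_; _*_; 0#; 1#; ⟦_⟧)
  open TwinTadpole R x using (p₁; p₂; p₃)
  field
    E²≈0  : E * E ≈ 0#
    p₁≈E  : p₁ ≈ E
    p₂≈0  : p₂ ≈ 0#
    p₃≈3  : p₃ ≈ ⟦ + 3 ⟧
    cubic : ∀ c → x c * (x c * x c) ≈ E * (x c * x c) + 1#

-- The same for `(e₁, e₂, e₃) = (0, E, 1)`, where `p₂ = e₁² - 2e₂`.
record Case-e₂ (R : CommutativeRing 0ℓ 0ℓ) {N : ℕ} (x : Fin N → CommutativeRing.Carrier R) (E : CommutativeRing.Carrier R) : Set where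
  open RingKit R using (_≈_; _+_; _*_; _-_; -_; 0#; 1#; ⟦_⟧)
  open TwinTadpole R x using (p₁; p₂; p₃)
  field
    E²≈0   : E * E ≈ 0#
    p₁≈0   : p₁ ≈ 0#
    p₂≈-2E : p₂ ≈ - (E + E)
    p₃≈3   : p₃ ≈ ⟦ + 3 ⟧
    cubic  : ∀ c → x c * (x c * x c) ≈ 1# - E * x c

-- Closed forms of the path sums, with period three.

module PathValues (R : CommutativeRing 0ℓ 0ℓ) {N : ℕ} (x : Fin N → CommutativeRing.Carrier R) (L : LikeThreeColours R x) where
  open RingKit R
  open Symmetric R
  open TwinTadpole R x
  open LikeThreeColours L

  private
    pow2 : ∀ k → ⟦ + (2 ℕ.^ suc k) ⟧ ≈ ⟦ + (2 ℕ.^ k) ⟧ + ⟦ + (2 ℕ.^ k) ⟧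
    pow2 k = ≈-trans (⟦⟧-+ (+ (2 ℕ.^ k)) (+ (2 ℕ.^ k ℕ.+ 0)))
      (+-congˡ (reflexive (cong (λ m → ⟦ + m ⟧) (ℕₚ.+-identityʳ (2 ℕ.^ k)))))

  module FirstOrder-e₁ (E : Carrier) (H : Case-e₁ R x E) where
    open Case-e₁ H

    module _ {n} (t : Carrier) (W₀ : ∀ c → W n c ≈ t * x c) where

      W₁ : ∀ c → W (1 ℕ.+ n) c ≈ t * (E * x c - x c * x c)
      W₁ c = ≈-trans (*-congˡ (+-cong (≈-trans (Σᶜ-cong W₀) (≈-trans (∑-*ˡ (allFin N) t x) (*-congˡ p₁≈E))) (-‿cong (W₀ c))))
        (solve 3 (λ t y E → y :* (t :* E :- t :* y) := t :* (E :* y :- y :* y)) ≈-refl t (x c) E)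

      -- The total of the previous step is of order `E²` and vanishes; what remains is
      -- `t (x³ - E x²)`, which `cubic` makes constant.
      W₂ : ∀ c → W (2 ℕ.+ n) c ≈ t
      W₂ c = begin
        x c * (Σᶜ (W (1 ℕ.+ n)) - W (1 ℕ.+ n) c)
          ≈⟨ *-congˡ (+-cong sum≈0 (-‿cong (W₁ c))) ⟩
        x c * (0# - t * (E * x c - x c * x c))
          ≈⟨ solve 3 (λ t y E → y :* (con 0ℤ :- t :* (E :* y :- y :* y)) := t :* (y :* (y :* y) :- E :* (y :* y))) ≈-refl t (x c) E ⟩
        t * (x c * (x c * x c) - E * (x c * x c))
          ≈⟨ *-congˡ (+-congʳ (cubic c)) ⟩
        t * ((E * (x c * x c) + 1#) - E * (x c * x c))
          ≈⟨ solve 2 (λ t z → t :* ((z :+ con 1ℤ) :- z) := t) ≈-refl t (E * (x c * x c)) ⟩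
        t ∎
        where
        sum≈0 : Σᶜ (W (1 ℕ.+ n)) ≈ 0#
        sum≈0 = ≈-trans (Σᶜ-cong W₁) (≈-trans (∑-*ˡ (allFin N) t _) (≈-trans
          (*-congˡ (≈-trans (∑-minus (allFin N) _ _) (+-cong (≈-trans (∑-*ˡ (allFin N) E x) (≈-trans (*-congˡ p₁≈E) E²≈0)) (-‿cong p₂≈0))))
          (solve 1 (λ t → t :* (con 0ℤ :- con 0ℤ) := con 0ℤ) ≈-refl t)))

      -- A constant `t` has total `3t`, and `3t - t = 2t`: the shape of `W₀` returns with `t`
      -- doubled.
      W₃ : ∀ c → W (3 ℕ.+ n) c ≈ (t + t) * x c
      W₃ c = ≈-trans (*-congˡ (+-cong (≈-trans (Σᶜ-cong W₂) (∑-const t)) (-‿cong (W₂ c))))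
        (solve 2 (λ t y → y :* ((t :+ (t :+ (t :+ con 0ℤ))) :- t) := (t :+ t) :* y) ≈-refl t (x c))

      -- Since `p₂ = 0`, only `-2 t p₃` is left, and `p₃ = 3`.
      value₁ : X (TwinTad (1 ℕ.+ n)) x ≈ ⟦ ℤ.- (+ 6) ⟧ * t
      value₁ = ≈-trans (X-formula n) (≈-trans
        (*-congˡ (≈-trans
          (Σᶜ-cong λ c → ≈-trans (*-cong (*-congˡ (+-congʳ p₁≈E)) (W₀ c))
            (solve 3 (λ t y E → (y :* (E :- y)) :* (t :* y) := t :* (E :* (y :* y) :- y :* (y :* y))) ≈-refl t (x c) E))
          (≈-trans (∑-*ˡ (allFin N) t _) (*-congˡ (≈-trans (∑-minus (allFin N) _ _)
            (+-cong (≈-trans (∑-*ˡ (allFin N) E _) (*-congˡ p₂≈0)) (-‿cong p₃≈3)))))))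
        (solve 2 (λ t E → (con 1ℤ :+ con 1ℤ) :* (t :* (E :* con 0ℤ :- con (+ 3))) := con (ℤ.- (+ 6)) :* t) ≈-refl t E))

      -- `cubic` lowers the fourth power of `x c`; the result is `2 t (p₁ - E p₃) = 2 t (E - 3E)`.
      value₂ : X (TwinTad (2 ℕ.+ n)) x ≈ (⟦ ℤ.- (+ 4) ⟧ * t) * E
      value₂ = ≈-trans (X-formula (1 ℕ.+ n)) (≈-trans
        (*-congˡ (≈-trans
          (Σᶜ-cong λ c → ≈-trans (*-cong (*-congˡ (+-congʳ p₁≈E)) (W₁ c)) (≈-trans
            (solve 3 (λ t y E → (y :* (E :- y)) :* (t :* (E :* y :- y :* y))
               := t :* ((E :* E) :* (y :* y) :+ (y :* (y :* (y :* y)) :- (E :+ E) :* (y :* (y :* y))))) ≈-refl t (x c) E)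
            (*-congˡ (≈-trans (+-cong (*-congʳ E²≈0) (+-congʳ (*-congˡ (cubic c))))
              (solve 2 (λ y E → con 0ℤ :* (y :* y) :+ (y :* (E :* (y :* y) :+ con 1ℤ) :- (E :+ E) :* (y :* (y :* y)))
                := y :- E :* (y :* (y :* y))) ≈-refl (x c) E)))))
          (≈-trans (∑-*ˡ (allFin N) t _) (*-congˡ (≈-trans (∑-minus (allFin N) _ _)
            (+-cong p₁≈E (-‿cong (≈-trans (∑-*ˡ (allFin N) E _) (*-congˡ p₃≈3)))))))))
        (solve 2 (λ t E → (con 1ℤ :+ con 1ℤ) :* (t :* (E :- E :* con (+ 3))) := (con (ℤ.- (+ 4)) :* t) :* E) ≈-refl t E))

    path-values : ∀ k c → W (k ℕ.* 3) c ≈ ⟦ + (2 ℕ.^ k) ⟧ * x c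
    path-values zero    c = ≈-sym (*-identityˡ _)
    path-values (suc k) c = ≈-trans (W₃ {k ℕ.* 3} ⟦ + (2 ℕ.^ k) ⟧ (path-values k) c) (*-congʳ (≈-sym (pow2 k)))

  module FirstOrder-e₂ (E : Carrier) (H : Case-e₂ R x E) where
    open Case-e₂ H

    module _ {n} (t s : Carrier) (W₀ : ∀ c → W n c ≈ t * x c - (s * E) * (x c * x c)) where

      W₁ : ∀ c → W (1 ℕ.+ n) c ≈ s * E - t * (x c * x c)
      W₁ c = begin
        x c * (Σᶜ (W n) - W n c)
          ≈⟨ *-congˡ (+-cong sum≈0 (-‿cong (W₀ c))) ⟩
        x c * (0# - (t * x c - (s * E) * (x c * x c)))
          ≈⟨ solve 4 (λ t s E y → y :* (con 0ℤ :- (t :* y :- (s :* E) :* (y :* y)))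
               := (s :* E) :* (y :* (y :* y)) :- t :* (y :* y)) ≈-refl t s E (x c) ⟩
        (s * E) * (x c * (x c * x c)) - t * (x c * x c)
          ≈⟨ +-congʳ (≈-trans (*-congˡ (cubic c)) (≈-trans
               (solve 3 (λ s E y → (s :* E) :* (con 1ℤ :- E :* y) := s :* E :- (s :* y) :* (E :* E)) ≈-refl s E (x c))
               (≈-trans (+-congˡ (-‿cong (*-congˡ E²≈0))) (solve 2 (λ a b → a :- b :* con 0ℤ := a) ≈-refl (s * E) (s * x c))))) ⟩
        s * E - t * (x c * x c) ∎
        where
        sum≈0 : Σᶜ (W n) ≈ 0#
        sum≈0 = ≈-trans (Σᶜ-cong W₀) (≈-trans (∑-minus (allFin N) _ _) (≈-trans
          (+-cong (≈-trans (∑-*ˡ (allFin N) t x) (*-congˡ p₁≈0)) (-‿cong (≈-trans (∑-*ˡ (allFin N) (s * E) _) (*-congˡ p₂≈-2E))))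
          (≈-trans (solve 3 (λ t s E → t :* con 0ℤ :- (s :* E) :* (:- (E :+ E)) := (s :+ s) :* (E :* E)) ≈-refl t s E)
            (≈-trans (*-congˡ E²≈0) (zeroʳ _)))))

      W₂ : ∀ c → W (2 ℕ.+ n) c ≈ t + ((t + (s + s)) * E) * x c
      W₂ c = begin
        x c * (Σᶜ (W (1 ℕ.+ n)) - W (1 ℕ.+ n) c)
          ≈⟨ *-congˡ (+-cong sum≈ (-‿cong (W₁ c))) ⟩
        x c * (((s * E + (s * E + (s * E + 0#))) - t * - (E + E)) - (s * E - t * (x c * x c)))
          ≈⟨ solve 4 (λ t s E y → y :* (((s :* E :+ (s :* E :+ (s :* E :+ con 0ℤ))) :- t :* (:- (E :+ E))) :- (s :* E :- t :* (y :* y)))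
               := t :* (y :* (y :* y)) :+ (((t :+ t) :+ (s :+ s)) :* E) :* y) ≈-refl t s E (x c) ⟩
        t * (x c * (x c * x c)) + (((t + t) + (s + s)) * E) * x c
          ≈⟨ +-congʳ (*-congˡ (cubic c)) ⟩
        t * (1# - E * x c) + (((t + t) + (s + s)) * E) * x c
          ≈⟨ solve 4 (λ t s E y → t :* (con 1ℤ :- E :* y) :+ (((t :+ t) :+ (s :+ s)) :* E) :* y
               := t :+ ((t :+ (s :+ s)) :* E) :* y) ≈-refl t s E (x c) ⟩
        t + ((t + (s + s)) * E) * x c ∎
        where
        sum≈ : Σᶜ (W (1 ℕ.+ n)) ≈ (s * E + (s * E + (s * E + 0#))) - t * - (E + E)
        sum≈ = ≈-trans (Σᶜ-cong W₁) (≈-trans (∑-minus (allFin N) _ _)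
          (+-cong (∑-const (s * E)) (-‿cong (≈-trans (∑-*ˡ (allFin N) t _) (*-congˡ p₂≈-2E)))))

      -- One period sends `(t, s)` to `(2t, t + 2s)`. The quadratic term with `s` is absent at the
      -- start, but has to be carried along because each period creates it from `t`.
      W₃ : ∀ c → W (3 ℕ.+ n) c ≈ (t + t) * x c - ((t + (s + s)) * E) * (x c * x c)
      W₃ c = ≈-trans
        (*-congˡ (+-cong (≈-trans (Σᶜ-cong W₂) (≈-trans (∑-+ (allFin N) _ _)
            (+-cong (∑-const t) (≈-trans (∑-*ˡ (allFin N) _ x) (≈-trans (*-congˡ p₁≈0) (zeroʳ _))))))
          (-‿cong (W₂ c))))
        (solve 3 (λ t a y → y :* (((t :+ (t :+ (t :+ con 0ℤ))) :+ con 0ℤ) :- (t :+ a :* y)) := (t :+ t) :* y :- a :* (y :* y))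
          ≈-refl t ((t + (s + s)) * E) (x c))

      -- With `p₁ = 0` the sum is `-t p₂ - (t + 2s) E p₃ = 2tE - 3(t + 2s)E`, and it is doubled.
      value₃ : X (TwinTad (3 ℕ.+ n)) x ≈ (⟦ ℤ.- (+ 2) ⟧ * t + ⟦ ℤ.- (+ 12) ⟧ * s) * E
      value₃ = ≈-trans (X-formula (2 ℕ.+ n)) (≈-trans
        (*-congˡ (≈-trans
          (Σᶜ-cong λ c → ≈-trans (*-cong (*-congˡ (+-congʳ p₁≈0)) (W₂ c))
            (solve 3 (λ t a y → (y :* (con 0ℤ :- y)) :* (t :+ a :* y) := (:- t) :* (y :* y) :- a :* (y :* (y :* y))) ≈-refl t a (x c)))
          (≈-trans (∑-minus (allFin N) _ _) (+-cong (≈-trans (∑-*ˡ (allFin N) (- t) _) (*-congˡ p₂≈-2E))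
            (-‿cong (≈-trans (∑-*ˡ (allFin N) a _) (*-congˡ p₃≈3)))))))
        (solve 3 (λ t s E → (con 1ℤ :+ con 1ℤ) :* ((:- t) :* (:- (E :+ E)) :- ((t :+ (s :+ s)) :* E) :* con (+ 3))
          := (con (ℤ.- (+ 2)) :* t :+ con (ℤ.- (+ 12)) :* s) :* E) ≈-refl t s E))
        where
        a : Carrier
        a = (t + (s + s)) * E

    -- The value of `s` after `k` periods, by the recursion `s ↦ t + 2s` with `t = 2^k`.
    shift : ℕ → ℕ
    shift zero    = 0
    shift (suc k) = 2 ℕ.^ k ℕ.+ (shift k ℕ.+ shift k)

    path-values : ∀ k c → W (k ℕ.* 3) c ≈ ⟦ + (2 ℕ.^ k) ⟧ * x c - (⟦ + shift k ⟧ * E) * (x c * x c)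
    path-values zero    c = solve 2 (λ y E → y := con 1ℤ :* y :- (con 0ℤ :* E) :* (y :* y)) ≈-refl (x c) E
    path-values (suc k) c = ≈-trans (W₃ {k ℕ.* 3} ⟦ + (2 ℕ.^ k) ⟧ ⟦ + shift k ⟧ (path-values k) c)
      (+-cong (*-congʳ (≈-sym (pow2 k))) (-‿cong (*-congʳ (*-congʳ (≈-sym
        (≈-trans (⟦⟧-+ (+ (2 ℕ.^ k)) (+ (shift k ℕ.+ shift k))) (+-congˡ (⟦⟧-+ (+ shift k) (+ shift k)))))))))

-- ℤ[ω][ε] with ω² + ω + 1 = 0 and ε² = 0.
dualEisenstein : CommutativeRing 0ℓ 0ℓ
dualEisenstein = quadraticExtension (quadraticExtension ℤₚ.+-*-commutativeRing -1ℤ -1ℤ) (0ℤ , 0ℤ) (0ℤ , 0ℤ)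

open CommutativeRing dualEisenstein using (Carrier)

-- The roots of T³ - 3εT² - 1, namely ωⁱ + ε.
ξ : Fin 3 → Carrier
ξ zero             = (+ 1 , + 0) , (+ 1 , + 0)
ξ (suc zero)       = (+ 0 , + 1) , (+ 1 , + 0)
ξ (suc (suc zero)) = (-1ℤ , -1ℤ) , (+ 1 , + 0)

-- The roots of T³ + 3εT - 1, namely ωⁱ - εω⁻ⁱ.
η : Fin 3 → Carrier
η zero             = (+ 1 , + 0) , (-1ℤ , + 0)
η (suc zero)       = (+ 0 , + 1) , (+ 1 , + 1)
η (suc (suc zero)) = (-1ℤ , -1ℤ) , (+ 0 , -1ℤ)

3ε : Carrier
3ε = (+ 0 , + 0) , (+ 3 , + 0)

-- The two specialisations, verified by computation.

module K = RingKit dualEisenstein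

rfl : ∀ {u : Carrier} → K._≈_ u u
rfl = K.≈-refl

ξ-firstOrder : FirstOrder dualEisenstein ξ
ξ-firstOrder = record { e₁e₁ = rfl ; e₂e₁ = rfl ; e₂e₂ = rfl ; e₃≈1 = rfl }

η-firstOrder : FirstOrder dualEisenstein η
η-firstOrder = record { e₁e₁ = rfl ; e₂e₁ = rfl ; e₂e₂ = rfl ; e₃≈1 = rfl }

ξ-threeColours : LikeThreeColours dualEisenstein ξ
ξ-threeColours = record { ∑-const = λ _ → rfl ; X-formula = ThreeColours.X-three dualEisenstein ξ rfl }

η-threeColours : LikeThreeColours dualEisenstein η
η-threeColours = record { ∑-const = λ _ → rfl ; X-formula = ThreeColours.X-three dualEisenstein η rfl }

ξ-case : Case-e₁ dualEisenstein ξ 3ε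
ξ-case = record { E²≈0 = rfl ; p₁≈E = rfl ; p₂≈0 = rfl ; p₃≈3 = rfl
  ; cubic = λ { zero → rfl ; (suc zero) → rfl ; (suc (suc zero)) → rfl } }

η-case : Case-e₂ dualEisenstein η 3ε
η-case = record { E²≈0 = rfl ; p₁≈0 = rfl ; p₂≈-2E = rfl ; p₃≈3 = rfl
  ; cubic = λ { zero → rfl ; (suc zero) → rfl ; (suc (suc zero)) → rfl } }

-- The surviving `E (rest r)` is `1` for `r = 0`, and `3ε` for `r = 1` at `ξ` and for `r = 2` at
-- `η`; these are the coordinates in which it is nonzero.
constant-part ε-part : AdditiveFunctional dualEisenstein
constant-part = record
  { π = λ { ((a , _) , _) → a } ; π-cong = λ { ((p , _) , _) → p } ; π-+ = λ _ _ → refl ; π-0 = refl }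
ε-part = record
  { π = λ { (_ , (a , _)) → a } ; π-cong = λ { (_ , (p , _)) → p } ; π-+ = λ _ _ → refl ; π-0 = refl }

module ξ-vars = ThreeVariables dualEisenstein ξ ξ-firstOrder
module η-vars = ThreeVariables dualEisenstein η η-firstOrder
module ξ-values = PathValues.FirstOrder-e₁ dualEisenstein ξ ξ-threeColours 3ε ξ-case
module η-values = PathValues.FirstOrder-e₂ dualEisenstein η η-threeColours 3ε η-case
module ξ-constant = ξ-vars.Extract constant-part
module ξ-ε = ξ-vars.Extract ε-part
module η-ε = η-vars.Extract ε-part

-- The three coefficients.

neg-pos-* : ∀ m n → (ℤ.- (+ m)) ℤ.* + n ≡ ℤ.- (+ (m ℕ.* n))
neg-pos-* m n = trans (sym (ℤₚ.neg-distribˡ-* (+ m) (+ n))) (cong ℤ.-_ (sym (ℤₚ.pos-* m n)))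

6*2^k : ∀ k → 6 ℕ.* 2 ℕ.^ k ≡ 3 ℕ.* 2 ℕ.^ (k ℕ.+ 1)
6*2^k k = trans (regroup (2 ℕ.^ k)) (cong (3 ℕ.*_) (sym (ℕₚ.^-distribˡ-+-* 2 k 1)))
  where
  regroup : ∀ m → 6 ℕ.* m ≡ 3 ℕ.* (m ℕ.* 2)
  regroup = solve-∀

4*2^k : ∀ k → 4 ℕ.* 2 ℕ.^ k ≡ 2 ℕ.^ (k ℕ.+ 2)
4*2^k k = trans (ℕₚ.*-comm 4 (2 ℕ.^ k)) (sym (ℕₚ.^-distribˡ-+-* 2 k 2))

-- The closed form is `shift k = k * 2^(k-1)`; it is stated doubled to avoid the predecessor.
shift-closed : ∀ k → η-values.shift k ℕ.+ η-values.shift k ≡ k ℕ.* 2 ℕ.^ k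
shift-closed zero    = refl
shift-closed (suc k) = trans (cong (λ m → (2 ℕ.^ k ℕ.+ m) ℕ.+ (2 ℕ.^ k ℕ.+ m)) (shift-closed k)) (regroup k (2 ℕ.^ k))
  where
  regroup : ∀ k m → (m ℕ.+ k ℕ.* m) ℕ.+ (m ℕ.+ k ℕ.* m) ≡ (1 ℕ.+ k) ℕ.* (2 ℕ.* m)
  regroup = solve-∀

2*2^k+12*shift : ∀ k → 2 ℕ.* 2 ℕ.^ k ℕ.+ 12 ℕ.* η-values.shift k ≡ (3 ℕ.* k ℕ.+ 1) ℕ.* 2 ℕ.^ (k ℕ.+ 1)
2*2^k+12*shift k = trans (double (2 ℕ.^ k) (η-values.shift k))
  (trans (cong (λ m → 2 ℕ.* 2 ℕ.^ k ℕ.+ 6 ℕ.* m) (shift-closed k))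
  (trans (regroup k (2 ℕ.^ k)) (cong ((3 ℕ.* k ℕ.+ 1) ℕ.*_) (sym (ℕₚ.^-distribˡ-+-* 2 k 1)))))
  where
  double : ∀ m s → 2 ℕ.* m ℕ.+ 12 ℕ.* s ≡ 2 ℕ.* m ℕ.+ 6 ℕ.* (s ℕ.+ s)
  double = solve-∀
  regroup : ∀ k m → 2 ℕ.* m ℕ.+ 6 ℕ.* (k ℕ.* m) ≡ (3 ℕ.* k ℕ.+ 1) ℕ.* (m ℕ.* 2)
  regroup = solve-∀

coefficient-3ᵏ : ∀ k c → Represents (TwinTad (1 ℕ.+ k ℕ.* 3)) c →
  c (threes (2 ℕ.+ k) zero) ≡ ℤ.- (+ (3 ℕ.* 2 ℕ.^ (k ℕ.+ 1)))
coefficient-3ᵏ k c rep = ξ-constant.extract {TwinTad (1 ℕ.+ k ℕ.* 3)} {c} rep (2 ℕ.+ k) zero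
  (sym (ℕₚ.+-identityʳ _)) (s≤s (s≤s (s≤s z≤n))) _
  (K.≈-trans (ξ-values.value₁ {k ℕ.* 3} K.⟦ + (2 ℕ.^ k) ⟧ (ξ-values.path-values k))
    (K.≈-trans (K.≈-sym (K.⟦⟧-* (ℤ.- (+ 6)) (+ (2 ℕ.^ k))))
    (K.≈-trans (K.reflexive (cong K.⟦_⟧ (trans (neg-pos-* 6 (2 ℕ.^ k)) (cong (λ m → ℤ.- (+ m)) (6*2^k k)))))
      (K.≈-sym (K.*-identityʳ _)))))
  (λ ())

coefficient-3ᵏ1 : ∀ k c → Represents (TwinTad (2 ℕ.+ k ℕ.* 3)) c →
  c (threes (2 ℕ.+ k) (suc zero)) ≡ ℤ.- (+ (2 ℕ.^ (k ℕ.+ 2)))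
coefficient-3ᵏ1 k c rep = ξ-ε.extract {TwinTad (2 ℕ.+ k ℕ.* 3)} {c} rep (2 ℕ.+ k) (suc zero)
  (cong (6 ℕ.+_) (ℕₚ.+-comm 1 (k ℕ.* 3))) (s≤s (s≤s (s≤s z≤n))) _
  (K.≈-trans (ξ-values.value₂ {k ℕ.* 3} K.⟦ + (2 ℕ.^ k) ⟧ (ξ-values.path-values k))
    (K.*-cong (K.≈-trans (K.≈-sym (K.⟦⟧-* (ℤ.- (+ 4)) (+ (2 ℕ.^ k))))
                 (K.reflexive (cong K.⟦_⟧ (trans (neg-pos-* 4 (2 ℕ.^ k)) (cong (λ m → ℤ.- (+ m)) (4*2^k k))))))
              rfl))
  (λ ())

coefficient-3ᵏ2 : ∀ k c → Represents (TwinTad (3 ℕ.+ k ℕ.* 3)) c →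
  c (threes (2 ℕ.+ k) (suc (suc zero))) ≡ ℤ.- (+ ((3 ℕ.* k ℕ.+ 1) ℕ.* 2 ℕ.^ (k ℕ.+ 1)))
coefficient-3ᵏ2 k c rep = η-ε.extract {TwinTad (3 ℕ.+ k ℕ.* 3)} {c} rep (2 ℕ.+ k) (suc (suc zero))
  (cong (6 ℕ.+_) (ℕₚ.+-comm 2 (k ℕ.* 3))) (s≤s (s≤s (s≤s z≤n))) _
  (K.≈-trans (η-values.value₃ {k ℕ.* 3} K.⟦ + t ⟧ K.⟦ + s ⟧ (η-values.path-values k))
    (K.*-cong (K.≈-trans (K.+-cong (K.≈-sym (K.⟦⟧-* (ℤ.- (+ 2)) (+ t))) (K.≈-sym (K.⟦⟧-* (ℤ.- (+ 12)) (+ s))))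
                (K.≈-trans (K.≈-sym (K.⟦⟧-+ (ℤ.- (+ 2) ℤ.* + t) (ℤ.- (+ 12) ℤ.* + s)))
                 (K.reflexive (cong K.⟦_⟧ integers))))
              rfl))
  (λ ())
  where
  t s : ℕ
  t = 2 ℕ.^ k
  s = η-values.shift k
  integers : ℤ.- (+ 2) ℤ.* + t ℤ.+ ℤ.- (+ 12) ℤ.* + s ≡ ℤ.- (+ ((3 ℕ.* k ℕ.+ 1) ℕ.* 2 ℕ.^ (k ℕ.+ 1)))
  integers = trans (cong₂ ℤ._+_ (neg-pos-* 2 t) (neg-pos-* 12 s))
    (trans (sym (ℤₚ.neg-distrib-+ (+ (2 ℕ.* t)) (+ (12 ℕ.* s))))
    (cong ℤ.-_ (trans (sym (ℤₚ.pos-+ (2 ℕ.* t) (12 ℕ.* s))) (cong +_ (2*2^k+12*shift k)))))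

-- Failure of positivity for every tail length.

negative-coefficient : ∀ G k r m → size G ≡ k ℕ.* 3 ℕ.+ toℕ r → 3 ≤ size G → 0 < m →
  (∀ c → Represents G c → c (threes k r) ≡ ℤ.- (+ m)) → ¬ EPositive G
negative-coefficient G k r (suc m) size≡ 3≤ _ coefficient (c , rep , pos) with subst (+ 0 ℤ.≤_) (coefficient c rep) (pos (threes k r)
  (partition-∈ (size G) (subst (λ s → IsPartition (size G) s (threes k r)) (sym size≡) (threes-partition (size G) k r 3≤)) ℕₚ.≤-refl))
... | ()

data ResidueView : ℕ → Set where
  one   : ∀ k → ResidueView (1 ℕ.+ k ℕ.* 3)
  two   : ∀ k → ResidueView (2 ℕ.+ k ℕ.* 3)
  three : ∀ k → ResidueView (3 ℕ.+ k ℕ.* 3)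

residueView : ∀ b → ResidueView (suc b)
residueView zero                = one 0
residueView (suc zero)          = two 0
residueView (suc (suc zero))    = three 0
residueView (suc (suc (suc b))) with residueView b
... | one k   = one (suc k)
... | two k   = two (suc k)
... | three k = three (suc k)

not-EPositive : ∀ {b} → ResidueView b → ¬ EPositive (TwinTad b)
not-EPositive (one k) = negative-coefficient (TwinTad (1 ℕ.+ k ℕ.* 3)) (2 ℕ.+ k) zero (3 ℕ.* 2 ℕ.^ (k ℕ.+ 1))
  (sym (ℕₚ.+-identityʳ _)) (s≤s (s≤s (s≤s z≤n))) (ℕₚ.*-mono-< {0} {3} (s≤s z≤n) (ℕₚ.m^n>0 2 (k ℕ.+ 1))) (coefficient-3ᵏ k)
not-EPositive (two k) = negative-coefficient (TwinTad (2 ℕ.+ k ℕ.* 3)) (2 ℕ.+ k) (suc zero) (2 ℕ.^ (k ℕ.+ 2))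
  (cong (6 ℕ.+_) (ℕₚ.+-comm 1 (k ℕ.* 3))) (s≤s (s≤s (s≤s z≤n))) (ℕₚ.m^n>0 2 (k ℕ.+ 2)) (coefficient-3ᵏ1 k)
not-EPositive (three k) = negative-coefficient (TwinTad (3 ℕ.+ k ℕ.* 3)) (2 ℕ.+ k) (suc (suc zero)) ((3 ℕ.* k ℕ.+ 1) ℕ.* 2 ℕ.^ (k ℕ.+ 1))
  (cong (6 ℕ.+_) (ℕₚ.+-comm 2 (k ℕ.* 3))) (s≤s (s≤s (s≤s z≤n)))
  (ℕₚ.*-mono-< {0} {3 ℕ.* k ℕ.+ 1} (ℕₚ.m≤n+m 1 (3 ℕ.* k)) (ℕₚ.m^n>0 2 (k ℕ.+ 1))) (coefficient-3ᵏ2 k)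

-- The computations use lengths `j + k * 3`, where the leading `suc` and the period three are
-- visible to reduction; this carries them over to the lengths and partitions as they are written in
-- the theorem.
e-coefficient : ∀ {n b λ' μ z} → suc n ≡ b → λ' ≡ μ →
  (∀ c → Represents (TwinTad (suc n)) c → c λ' ≡ z) → ECoeffIs (TwinTad b) μ z
e-coefficient {n} refl refl coefficient = TwinTad-representable n , coefficient

replicate-comm : ∀ k r → threes (2 ℕ.+ k) r ≡ replicate (k ℕ.+ 2) 3 ++ rest r
replicate-comm k r = cong (λ m → replicate m 3 ++ rest r) (ℕₚ.+-comm 2 k)

tail-length : ∀ k j → j ℕ.+ k ℕ.* 3 ≡ 3 ℕ.* k ℕ.+ j
tail-length k j = trans (ℕₚ.+-comm j (k ℕ.* 3)) (cong (ℕ._+ j) (ℕₚ.*-comm k 3))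

open import Data.Nat using (_+_; _*_; _^_)
open import Data.Integer using (-_)

theorem3p6 : ((b : ℕ) → 1 ≤ b → ¬ EPositive (TwinTad b))
    × ((k : ℕ) → ECoeffIs (TwinTad (3 * k + 1)) (replicate (k + 2) 3) (- (+ (3 * 2 ^ (k + 1)))))
    × ((k : ℕ) → ECoeffIs (TwinTad (3 * k + 2)) (replicate (k + 2) 3 ++ [ 1 ]) (- (+ (2 ^ (k + 2)))))
    × ((k : ℕ) → ECoeffIs (TwinTad (3 * k + 3)) (replicate (k + 2) 3 ++ [ 2 ]) (- (+ ((3 * k + 1) * 2 ^ (k + 1)))))
theorem3p6 =
    (λ { (suc b) _ → not-EPositive (residueView b) })
  , (λ k → e-coefficient (tail-length k 1) (trans (replicate-comm k zero) (++-identityʳ _)) (coefficient-3ᵏ k))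
  , (λ k → e-coefficient (tail-length k 2) (replicate-comm k (suc zero)) (coefficient-3ᵏ1 k))
  , (λ k → e-coefficient (tail-length k 3) (replicate-comm k (suc (suc zero))) (coefficient-3ᵏ2 k))
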